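{- The problem Saving Landmarks can be solved in time $O^*(4^{k+o(k)})$; that is, there is an algorithm which, given a graph $G$ on $n$ vertices and an integer $k$, decides whether $G$ has a resolving set of size at most $n-k$ in time $4^{k+o(k)}\cdot n^{O(1)}$.
   Context: Graphs are finite, simple and undirected. For a graph $G$, $\operatorname{d}_G(u,v)$ denotes the length of a shortest path between $u$ and $v$ in $G$ ($\infty$ if there is none). A set $W\subseteq V(G)$ is a resolving set of $G$ if for any two distinct $x,y\in V(G)$ there is $v\in W$ with $\operatorname{d}_G(v,x)\neq \operatorname{d}_G(v,y)$. Saving Landmarks: the input is a graph $G$ and a (non-negative) integer $k$, and the question is whether $G$ has a resolving set of size at most $n-k$, where $n=|V(G)|$. The notation $O^*$ suppresses factors polynomial in the input size. -}

module Defs where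

open import Data.Bool.Base using (Bool; true; false)
open import Data.Fin.Base using (Fin)
open import Data.Fin.Subset using (Subset; _∈_; ∣_∣)
open import Data.List.Base using (List; []; _∷_; tabulate)
open import Data.Nat.Base using (ℕ; zero; suc; _+_; _*_; _≤_)
open import Data.Nat.Binary.Base using (ℕᵇ; zero; 2[1+_]; 1+[2_]; fromℕ)
open import Data.Product.Base using (Σ-syntax; ∃-syntax; _×_)
open import Data.Vec.Base using (Vec; []; _∷_; lookup)
open import Data.Vec.Relation.Unary.Unique.Propositional using (Unique)
open import Relation.Binary.PropositionalEquality.Core using (_≡_; _≢_)
open import Relation.Nullary.Construct.Add.Supremum using (_⁺; ⊤⁺; [_])
open import Relation.Nullary.Negation.Core using (¬_)

------------------------------------------------------------------------
-- Graphs and resolving sets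

record Graph (n : ℕ) : Set where
  field
    adj    : Fin n → Fin n → Bool
    sym    : ∀ u v → adj u v ≡ adj v u
    irrefl : ∀ u → adj u u ≡ false

module _ {n : ℕ} (G : Graph n) where

  open Graph G using (adj)

  data Walk : Fin n → Fin n → ℕ → Set where
    []  : ∀ {u} → Walk u u 0
    _∷_ : ∀ {u v w ℓ} → adj u v ≡ true → Walk v w ℓ → Walk u w (suc ℓ)

  vertices : ∀ {u v ℓ} → Walk u v ℓ → Vec (Fin n) (suc ℓ)
  vertices {u} []      = u ∷ []
  vertices {u} (_ ∷ p) = u ∷ vertices p

  Path : Fin n → Fin n → ℕ → Set
  Path u v ℓ = Σ[ p ∈ Walk u v ℓ ] Unique (vertices p)

  -- The graph of the function d_G, with values in ℕ ∪ {∞}.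
  data Distance (u v : Fin n) : ℕ ⁺ → Set where
    finite   : ∀ {ℓ} → Path u v ℓ → (∀ m → Path u v m → ℓ ≤ m) →
               Distance u v [ ℓ ]
    infinite : (∀ m → ¬ Path u v m) → Distance u v ⊤⁺

  Resolves : Fin n → Fin n → Fin n → Set
  Resolves v x y =
    ∃[ d ] ∃[ e ] Distance v x d × Distance v y e × d ≢ e

  Resolving : Subset n → Set
  Resolving W = ∀ x y → x ≢ y → ∃[ v ] v ∈ W × Resolves v x y

-- ∣ W ∣ ≤ n - k as integers: there is no such W when k > n.
SavingLandmarks : ∀ {n} → Graph n → ℕ → Set
SavingLandmarks {n} G k = ∃[ W ] Resolving G W × ∣ W ∣ + k ≤ n

------------------------------------------------------------------------
-- Model of computation
--
-- Structured WHILE programs on binary trees with unit-cost operations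
-- (in the style of N. D. Jones, "Computability and Complexity from a
-- Programming Perspective"), with lexically scoped, immutable variables.
-- With shared cons cells every rule below takes O(1) steps of a pointer
-- machine or RAM, since a program has a fixed number of variables.
-- Conversely, keeping the memory in a balanced tree simulates T steps of
-- a RAM whose words have O(log T) bits with overhead polynomial in log T.
-- For T = 4^(k+o(k)) · n^O(1) that overhead is absorbed into the bound,
-- so the bound means the same in either model.

infixr 5 _∙_

data Tree : Set where
  nil : Tree
  _∙_ : Tree → Tree → Tree

head : Tree → Tree
head nil     = nil
head (s ∙ _) = s

tail : Tree → Tree
tail nil     = nil
tail (_ ∙ t) = t

-- Programs with n free variables (de Bruijn indices).
data Program (n : ℕ) : Set where
  var  : Fin n → Program n
  nil  : Program n
  cons : Program n → Program n → Program n
  hd   : Program n → Program n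
  tl   : Program n → Program n
  if   : Program n → Program n → Program n → Program n
  let′ : Program n → Program (suc n) → Program n
  -- while g b p: variable 0, bound in g and b, starts as the value of p
  -- and is replaced by the value of b as long as g evaluates to non-nil;
  -- the result is its final value.
  while : Program (suc n) → Program (suc n) → Program n → Program n

infix 4 _⊢_⇓_after_

-- ρ ⊢ p ⇓ v after t: in environment ρ, program p halts with value v
-- after exactly t steps.
mutual

  data _⊢_⇓_after_ {n : ℕ} (ρ : Vec Tree n) : Program n → Tree → ℕ → Set where
    var     : ∀ i → ρ ⊢ var i ⇓ lookup ρ i after 1
    nil     : ρ ⊢ nil ⇓ nil after 1
    cons    : ∀ {p q v w s t} →
              ρ ⊢ p ⇓ v after s → ρ ⊢ q ⇓ w after t →
              ρ ⊢ cons p q ⇓ v ∙ w after suc (s + t)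
    hd      : ∀ {p v t} → ρ ⊢ p ⇓ v after t → ρ ⊢ hd p ⇓ head v after suc t
    tl      : ∀ {p v t} → ρ ⊢ p ⇓ v after t → ρ ⊢ tl p ⇓ tail v after suc t
    if-cons : ∀ {c p q x y v s t} →
              ρ ⊢ c ⇓ x ∙ y after s → ρ ⊢ p ⇓ v after t →
              ρ ⊢ if c p q ⇓ v after suc (s + t)
    if-nil  : ∀ {c p q v s t} →
              ρ ⊢ c ⇓ nil after s → ρ ⊢ q ⇓ v after t →
              ρ ⊢ if c p q ⇓ v after suc (s + t)
    let′    : ∀ {p q v w s t} →
              ρ ⊢ p ⇓ v after s → v ∷ ρ ⊢ q ⇓ w after t →
              ρ ⊢ let′ p q ⇓ w after suc (s + t)
    while   : ∀ {g b p v w s t} →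
              ρ ⊢ p ⇓ v after s → Loop ρ g b v w t →
              ρ ⊢ while g b p ⇓ w after suc (s + t)

  data Loop {n : ℕ} (ρ : Vec Tree n) (g b : Program (suc n)) :
            Tree → Tree → ℕ → Set where
    stop : ∀ {v t} →
           v ∷ ρ ⊢ g ⇓ nil after t → Loop ρ g b v v (suc t)
    step : ∀ {v v′ w x y r s t} →
           v ∷ ρ ⊢ g ⇓ x ∙ y after r → v ∷ ρ ⊢ b ⇓ v′ after s →
           Loop ρ g b v′ w t → Loop ρ g b v w (suc (r + s + t))

------------------------------------------------------------------------
-- Inputs and outputs

encodeBool : Bool → Tree
encodeBool false = nil
encodeBool true  = nil ∙ nil

encodeList : List Tree → Tree
encodeList []       = nil
encodeList (t ∷ ts) = t ∙ encodeList ts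

-- Bijective binary notation, least significant digit first.
encodeBinary : ℕᵇ → Tree
encodeBinary zero     = nil
encodeBinary 2[1+ x ] = encodeBool true ∙ encodeBinary x
encodeBinary 1+[2 x ] = encodeBool false ∙ encodeBinary x

-- The adjacency matrix, as a list of rows.
encodeGraph : ∀ {n} → Graph n → Tree
encodeGraph G =
  encodeList (tabulate λ u → encodeList (tabulate λ v → encodeBool (adj u v)))
  where open Graph G using (adj)

encodeInput : ∀ {n} → Graph n → ℕ → Tree
encodeInput G k = encodeGraph G ∙ encodeBinary (fromℕ k)

------------------------------------------------------------------------
-- Asymptotics

-- f(k) = o(k), with ε = 1/m.  Taking f integer-valued loses nothing,
-- since rounding up a real-valued o(k) function again gives one.
IsLittleO : (ℕ → ℕ) → Set
IsLittleO f = ∀ m → ∃[ k₀ ] (∀ k → k₀ ≤ k → m * f k ≤ k)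

{-# OPTIONS --safe #-}
-- A set S of k vertices can be spared if and only if any two elements of S
-- are separated by a vertex outside S (a vertex outside S separates itself
-- from everything).  Grow sets P and W of equal size such that W is disjoint
-- from P and separates it.  If |P| = k, then P can be spared.  Otherwise the
-- growth gets stuck with |P| < k, and then any two vertices outside P ∪ W with
-- the same distances to P ∪ W are twins.  So it suffices to look for S among
-- P ∪ W and one representative of each class of twins, and k such
-- representatives could be spared at once; a kernel of 3k vertices remains.
--
-- At most k landmarks are needed to separate S, so a solution makes at most 2k
-- demands on the set of landmarks.  Cut the kernel into blocks of length
-- L ≈ log k.  A random subset of a block meets b demands with probability
-- 2^-b, hence a greedily chosen family of (2L+1) 2^b subsets meets all
-- possible collections of b demands.  Branching on b and on the family, block
-- by block, gives 4^k L^O(k/L) = 4^(k+o(k)) nodes.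
module Submission where

open import Defs
open import Data.Bool.Base using (Bool; true; false; if_then_else_; not; _∧_; _∨_; _xor_; T)
open import Data.Bool.ListAction using (any; all; or; and)
open import Data.Bool.Properties using (T-∧; T-∨; T-≡; ∨-identityʳ)
open import Data.Empty using (⊥; ⊥-elim)
open import Data.Fin.Base using (Fin; zero; suc; toℕ; fromℕ<)
import Data.Fin.Properties as Fin
open import Data.Fin.Subset using (Subset; ∣_∣) renaming (_∈_ to _∈ˢ_)
open import Data.List.Base using (List; []; _∷_; _++_; length; foldl; foldr; map; reverse; replicate; concat; concatMap; null; take; drop; filterᵇ; downFrom; allFin; tabulate)
open import Data.List.Membership.Propositional using (_∈_; _∉_; find; lose)
open import Data.List.Membership.Propositional.Properties
  using (∈-++⁺ˡ; ∈-++⁺ʳ; ∈-++⁻; ∈-∃++; ∈-filter⁺; ∈-filter⁻; ∈-map⁺; ∈-map⁻; ∈-concat⁺′; ∈-concat⁻′; ∈-downFrom⁺; ∈-downFrom⁻; ∈-allFin; ∈-length; ∉[])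
open import Data.List.Relation.Binary.Permutation.Propositional using (_↭_; ↭-sym; ↭⇒↭ₛ)
open import Data.List.Relation.Binary.Permutation.Propositional.Properties using (shift; ∈-resp-↭)
open import Data.List.Relation.Binary.Permutation.Setoid.Properties using (Unique-resp-↭)
open import Data.List.Relation.Unary.All using (All; []; _∷_)
open import Data.List.Relation.Unary.AllPairs using (AllPairs; []; _∷_)
open import Data.List.Relation.Unary.Any using (here; there)
open import Data.List.Relation.Unary.Unique.Propositional using (Unique)
import Data.List.Properties as List
import Data.List.Relation.Unary.All as All
import Data.List.Relation.Unary.All.Properties as All
import Data.List.Relation.Unary.AllPairs as AllPairs
import Data.List.Relation.Unary.Any.Properties as Any
import Data.List.Relation.Unary.Unique.Propositional.Properties as Unique
open import Data.Maybe.Base using (Maybe; just; nothing)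
open import Data.Nat.Base
open import Data.Nat.Binary.Base using (ℕᵇ; zero; 2[1+_]; 1+[2_]; fromℕ) renaming (toℕ to ⟦_⟧)
open import Data.Nat.Binary.Properties using (toℕ-fromℕ)
open import Data.Nat.DivMod
open import Data.Nat.GeneralisedArithmetic using (fold)
open import Data.Nat.Properties
open import Data.Nat.Tactic.RingSolver using (solve-∀)
open import Data.Product.Base using (Σ-syntax; ∃-syntax; _×_; _,_; proj₁; proj₂)
open import Data.Sum.Base using (_⊎_; inj₁; inj₂; [_,_]′)
open import Data.Unit.Base using (⊤; tt)
open import Data.Vec.Base using (Vec; []; _∷_; lookup)
import Data.Vec.Base as Vec
import Data.Vec.Properties as Vec
open import Data.Vec.Relation.Unary.All using ([]; _∷_)
import Data.Vec.Relation.Unary.All as Vec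
open import Data.Vec.Relation.Unary.AllPairs using ([]; _∷_)
open import Data.Vec.Relation.Unary.Unique.Propositional.Properties using (lookup-injective)
open import Function.Base using (_∘_; flip; id)
open import Function.Bundles using (_⇔_; mk⇔; Equivalence)
open import Relation.Binary.PropositionalEquality hiding ([_])
open import Relation.Nullary using (¬_; Dec; yes; no; contradiction)
open import Relation.Nullary.Construct.Add.Supremum using (⊤⁺; [_])
open import Relation.Nullary.Decidable using (T?; map′)

-- Polynomial-time programs

-- Trying all subsets of the kernel would cost `8^k`. A guess `B` is good as soon as it contains at
-- most `k` particular kernel vertices and avoids `k` others, whatever it does elsewhere, which
-- lowers the base to 4. The acceptance test does not know these demands: for any `B` it takes as
-- landmarks all vertices except the unguessed ones of the kernel, and counts the classes that they
-- distinguish among the unguessed ones. Representatives of these classes can be spared for every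
-- `B`, so soundness does not depend on the search at all. The block length balances two costs. All
-- `2^L` subsets and up to `4^L` assignments of a block are listed explicitly, which must stay
-- polynomial in `k`, so `L = O(log k)`. A factor of order `L^2` is lost in each of about `3k / L`
-- blocks, which is subexponential only if `L` is unbounded. On the side of the machine, shared
-- cells let a short run build an exponentially large tree. Each subprogram therefore comes with a
-- bound on the size of its result besides the bound on its time.

infix 4 _≼_

-- Polynomial boundedness, with one exponent for all `i`. For `w` at least 2 a pure power also
-- absorbs leading constants and sums.
_≼_ : {I : Set} → (I → ℕ) → (I → ℕ) → Set
g ≼ w = ∃[ d ] (∀ i → g i ≤ w i ^ d)

module _ {I : Set} {w : I → ℕ} (2≤w : ∀ i → 2 ≤ w i) where

  private
    1≤w^ : ∀ i d → 1 ≤ w i ^ d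
    1≤w^ i d = ≤-trans (≤-reflexive (sym (^-zeroˡ d))) (^-monoˡ-≤ d (<⇒≤ (2≤w i)))

    w^-mono : ∀ i {d e} → d ≤ e → w i ^ d ≤ w i ^ e
    w^-mono i {d} {e} d≤e = begin
      w i ^ d                  ≡⟨ *-identityʳ _ ⟨
      w i ^ d * 1              ≤⟨ *-monoʳ-≤ (w i ^ d) (1≤w^ i (e ∸ d)) ⟩
      w i ^ d * w i ^ (e ∸ d)  ≡⟨ ^-distribˡ-+-* (w i) d (e ∸ d) ⟨
      w i ^ (d + (e ∸ d))      ≡⟨ cong (w i ^_) (m+[n∸m]≡n d≤e) ⟩
      w i ^ e                  ∎
      where open ≤-Reasoning

  ≼-const : ∀ c → (λ _ → c) ≼ w
  ≼-const c = c , λ i → ≤-trans (c≤2^c c) (^-monoˡ-≤ c (2≤w i))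
    where
    c≤2^c : ∀ c → c ≤ 2 ^ c
    c≤2^c zero    = z≤n
    c≤2^c (suc c) = +-mono-≤ (m^n>0 2 c) (≤-trans (c≤2^c c) (m≤m+n _ 0))

  ≼-+ : ∀ {g h} → g ≼ w → h ≼ w → (λ i → g i + h i) ≼ w
  ≼-+ {g} {h} (d , g≤) (e , h≤) = suc (d + e) , λ i → begin
    g i + h i                  ≤⟨ +-mono-≤ (≤-trans (g≤ i) (w^-mono i (m≤m+n d e)))
                                           (≤-trans (h≤ i) (w^-mono i (m≤n+m e d))) ⟩
    w i ^ (d + e) + w i ^ (d + e)  ≡⟨ cong (w i ^ (d + e) +_) (+-identityʳ _) ⟨
    2 * w i ^ (d + e)          ≤⟨ *-monoˡ-≤ (w i ^ (d + e)) (2≤w i) ⟩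
    w i ^ suc (d + e)          ∎
    where open ≤-Reasoning

  ≼-suc : ∀ {g} → g ≼ w → (λ i → suc (g i)) ≼ w
  ≼-suc = ≼-+ (≼-const 1)

≼-refl : {I : Set} {w : I → ℕ} → w ≼ w
≼-refl = 1 , λ i → ≤-reflexive (sym (^-identityʳ _))

≼-* : {I : Set} {g h w : I → ℕ} → g ≼ w → h ≼ w → (λ i → g i * h i) ≼ w
≼-* {w = w} (d , g≤) (e , h≤) = d + e , λ i →
  ≤-trans (*-mono-≤ (g≤ i) (h≤ i)) (≤-reflexive (sym (^-distribˡ-+-* (w i) d e)))

-- Polynomials compose, the exponents being multiplied. `φ` is a change of environment, as when a
-- program is used in a larger context.
≼-trans-∘ : {I J : Set} {g : J → ℕ} {v : J → ℕ} {w : I → ℕ} (φ : I → J) →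
            g ≼ v → (v ∘ φ) ≼ w → (g ∘ φ) ≼ w
≼-trans-∘ {w = w} φ (d , g≤) (e , v≤) = e * d , λ i →
  ≤-trans (g≤ (φ i)) (≤-trans (^-monoˡ-≤ d (v≤ i)) (≤-reflexive (^-*-assoc (w i) e d)))

≼-below : {I : Set} {g h w : I → ℕ} → (∀ i → g i ≤ h i) → h ≼ w → g ≼ w
≼-below g≤h (d , h≤) = d , λ i → ≤-trans (g≤h i) (h≤ i)

-- Data types, their encodings as trees, and programs that compute functions on them

infixr 6 _⊗_

data Ty : Set where
  bool nat : Ty
  list     : Ty → Ty
  _⊗_      : Ty → Ty → Ty

El : Ty → Set
El bool     = Bool
El nat      = ℕ
El (list τ) = List (El τ)
El (σ ⊗ τ)  = El σ × El τ

-- Unary, so that a number is as large as its value and counting loops are loops over lists.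
encodeℕ : ℕ → Tree
encodeℕ zero    = nil
encodeℕ (suc n) = nil ∙ encodeℕ n

mutual
  encode : ∀ τ → El τ → Tree
  encode bool     b       = encodeBool b
  encode nat      n       = encodeℕ n
  encode (list τ) xs      = encodeItems τ xs
  encode (σ ⊗ τ)  (x , y) = encode σ x ∙ encode τ y

  encodeItems : ∀ τ → List (El τ) → Tree
  encodeItems τ []       = nil
  encodeItems τ (x ∷ xs) = encode τ x ∙ encodeItems τ xs

treeSize : Tree → ℕ
treeSize nil     = 0
treeSize (s ∙ t) = suc (treeSize s + treeSize t)

size : ∀ τ → El τ → ℕ
size τ x = treeSize (encode τ x)

Ctx : Set
Ctx = List Ty

Env : Ctx → Set
Env []      = ⊤
Env (τ ∷ Γ) = El τ × Env Γ

encodeEnv : ∀ Γ → Env Γ → Vec Tree (length Γ)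
encodeEnv []      tt      = []
encodeEnv (τ ∷ Γ) (x , ρ) = encode τ x ∷ encodeEnv Γ ρ

-- It is at least 2, so that its powers absorb constants.
width : ∀ Γ → Env Γ → ℕ
width []      tt      = 2
width (τ ∷ Γ) (x , ρ) = size τ x + width Γ ρ

2≤width : ∀ Γ (ρ : Env Γ) → 2 ≤ width Γ ρ
2≤width []      tt      = ≤-refl
2≤width (τ ∷ Γ) (x , ρ) = ≤-trans (2≤width Γ ρ) (m≤n+m _ (size τ x))

-- `size-small` does not follow from `time-small`: repeating `cons x x` doubles the unfolded tree in
-- every step. Without a bound on the result, polynomial time would not be preserved by composition.
record Comp (Γ : Ctx) (τ : Ty) (f : Env Γ → El τ) : Set where
  field
    prog       : Program (length Γ)
    time       : Env Γ → ℕ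
    runs       : ∀ ρ → encodeEnv Γ ρ ⊢ prog ⇓ encode τ (f ρ) after time ρ
    time-small : time ≼ width Γ
    size-small : (size τ ∘ f) ≼ width Γ

open Comp public

module _ {Γ : Ctx} where

  const≼ : ∀ c → (λ _ → c) ≼ width Γ
  const≼ = ≼-const (2≤width Γ)

  infixl 5 _+≼_
  _+≼_ : ∀ {g h} → g ≼ width Γ → h ≼ width Γ → (λ ρ → g ρ + h ρ) ≼ width Γ
  _+≼_ = ≼-+ (2≤width Γ)

  suc≼ : ∀ {g} → g ≼ width Γ → (suc ∘ g) ≼ width Γ
  suc≼ = ≼-suc (2≤width Γ)

-- Equality of encodings is enough, so that a tree can be reread at another type for free: a number
-- is also a list of `false`.
recast : ∀ {Γ σ τ} {f : Env Γ → El σ} {g : Env Γ → El τ} →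
         (∀ ρ → encode σ (f ρ) ≡ encode τ (g ρ)) → Comp Γ σ f → Comp Γ τ g
recast g≡ a = record
  { prog       = prog a
  ; time       = time a
  ; runs       = λ ρ → subst (λ v → _ ⊢ _ ⇓ v after _) (g≡ ρ) (runs a ρ)
  ; time-small = time-small a
  ; size-small = ≼-below (λ ρ → ≤-reflexive (cong treeSize (sym (g≡ ρ)))) (size-small a)
  }

subst-comp : ∀ {Γ τ f g} → (∀ ρ → f ρ ≡ g ρ) → Comp Γ τ f → Comp Γ τ g
subst-comp {τ = τ} f≗g = recast (λ ρ → cong (encode τ) (f≗g ρ))

-- Renaming of variables, for using a program in a larger environment

lift : ∀ {m n} → (Fin m → Fin n) → Fin (suc m) → Fin (suc n)
lift r zero    = zero
lift r (suc i) = suc (r i)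

rename : ∀ {m n} → (Fin m → Fin n) → Program m → Program n
rename r (var i)       = var (r i)
rename r nil           = nil
rename r (cons p q)    = cons (rename r p) (rename r q)
rename r (hd p)        = hd (rename r p)
rename r (tl p)        = tl (rename r p)
rename r (if c p q)    = if (rename r c) (rename r p) (rename r q)
rename r (let′ p q)    = let′ (rename r p) (rename (lift r) q)
rename r (while g b p) = while (rename (lift r) g) (rename (lift r) b) (rename r p)

Along : ∀ {m n} → (Fin m → Fin n) → Vec Tree m → Vec Tree n → Set
Along r ρ ρ′ = ∀ i → lookup ρ′ (r i) ≡ lookup ρ i

along-lift : ∀ {m n} {r : Fin m → Fin n} {ρ ρ′} {v} → Along r ρ ρ′ → Along (lift r) (v ∷ ρ) (v ∷ ρ′)
along-lift a zero    = refl
along-lift a (suc i) = a i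

mutual
  rename-runs : ∀ {m n} {r : Fin m → Fin n} {ρ ρ′ p v t} → Along r ρ ρ′ →
                ρ ⊢ p ⇓ v after t → ρ′ ⊢ rename r p ⇓ v after t
  rename-runs {r = r} a (var i) = subst (λ v → _ ⊢ _ ⇓ v after _) (a i) (var (r i))
  rename-runs a nil           = nil
  rename-runs a (cons d e)    = cons (rename-runs a d) (rename-runs a e)
  rename-runs a (hd d)        = hd (rename-runs a d)
  rename-runs a (tl d)        = tl (rename-runs a d)
  rename-runs a (if-cons c d) = if-cons (rename-runs a c) (rename-runs a d)
  rename-runs a (if-nil c d)  = if-nil (rename-runs a c) (rename-runs a d)
  rename-runs a (let′ d e)    = let′ (rename-runs a d) (rename-runs (along-lift a) e)
  rename-runs a (while d l)   = while (rename-runs a d) (rename-loop a l)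

  rename-loop : ∀ {m n} {r : Fin m → Fin n} {ρ ρ′ g b v w t} → Along r ρ ρ′ →
                Loop ρ g b v w t → Loop ρ′ (rename (lift r) g) (rename (lift r) b) v w t
  rename-loop a (stop d)     = stop (rename-runs (along-lift a) d)
  rename-loop a (step d e l) =
    step (rename-runs (along-lift a) d) (rename-runs (along-lift a) e) (rename-loop a l)

↑_ : ∀ {Γ σ τ f} → Comp Γ τ f → Comp (σ ∷ Γ) τ (f ∘ proj₂)
↑_ {Γ} {σ} {τ} {f} c = record
  { prog       = rename suc (prog c)
  ; time       = time c ∘ proj₂
  ; runs       = λ ρ → rename-runs (λ _ → refl) (runs c (proj₂ ρ))
  ; time-small = ≼-trans-∘ proj₂ (time-small c) drop≼
  ; size-small = ≼-trans-∘ proj₂ (size-small c) drop≼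
  }
  where
  drop≼ : (width Γ ∘ proj₂) ≼ width (σ ∷ Γ)
  drop≼ = ≼-below (λ (x , ρ) → m≤n+m (width Γ ρ) (size σ x)) ≼-refl

infix 8 ↑_

-- For the body of a fold that looks at the current item only, the skipped variable 1 being the
-- accumulator.
↑₁_ : ∀ {Γ κ σ τ g} → Comp (σ ∷ Γ) τ g → Comp (σ ∷ κ ∷ Γ) τ (λ (x , _ , ρ) → g (x , ρ))
↑₁_ {Γ} {κ} {σ} {τ} {g} c = record
  { prog       = rename (lift suc) (prog c)
  ; time       = λ (x , _ , ρ) → time c (x , ρ)
  ; runs       = λ (x , _ , ρ) → rename-runs (λ { zero → refl ; (suc i) → refl }) (runs c (x , ρ))
  ; time-small = ≼-trans-∘ (λ (x , _ , ρ) → x , ρ) (time-small c) drop≼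
  ; size-small = ≼-trans-∘ (λ (x , _ , ρ) → x , ρ) (size-small c) drop≼
  }
  where
  drop≼ : (λ (x , y , ρ) → width (σ ∷ Γ) (x , ρ)) ≼ width (σ ∷ κ ∷ Γ)
  drop≼ = ≼-below (λ (x , y , ρ) → +-monoʳ-≤ (size σ x) (m≤n+m (width Γ ρ) (size κ y))) ≼-refl

infix 8 ↑₁_

v0 : ∀ {Γ τ} → Comp (τ ∷ Γ) τ proj₁
v0 {Γ} {τ} = record
  { prog       = var zero
  ; time       = λ _ → 1
  ; runs       = λ _ → var zero
  ; time-small = const≼ 1
  ; size-small = ≼-below (λ (x , ρ) → m≤m+n (size τ x) (width Γ ρ)) ≼-refl
  }

v1 : ∀ {Γ τ₀ τ} → Comp (τ₀ ∷ τ ∷ Γ) τ (proj₁ ∘ proj₂)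
v1 = ↑ v0

v2 : ∀ {Γ τ₀ τ₁ τ} → Comp (τ₀ ∷ τ₁ ∷ τ ∷ Γ) τ (λ ρ → proj₁ (proj₂ (proj₂ ρ)))
v2 = ↑ v1

module _ {Γ : Ctx} where

  nil-comp : ∀ {τ} (x : El τ) → encode τ x ≡ nil → Comp Γ τ (λ _ → x)
  nil-comp {τ} x x≡nil = record
    { prog       = nil
    ; time       = λ _ → 1
    ; runs       = λ ρ → subst (λ v → encodeEnv Γ ρ ⊢ nil ⇓ v after 1) (sym x≡nil) nil
    ; time-small = const≼ 1
    ; size-small = const≼ (size τ x)
    }

  cons-comp : ∀ {ρ₁ ρ₂ τ} {f : Env Γ → El ρ₁} {g : Env Γ → El ρ₂} {h : Env Γ → El τ} →
              (∀ ρ → encode τ (h ρ) ≡ encode ρ₁ (f ρ) ∙ encode ρ₂ (g ρ)) →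
              Comp Γ ρ₁ f → Comp Γ ρ₂ g → Comp Γ τ h
  cons-comp {h = h} h≡ a b = record
    { prog       = cons (prog a) (prog b)
    ; time       = λ ρ → suc (time a ρ + time b ρ)
    ; runs       = λ ρ → subst (λ v → _ ⊢ _ ⇓ v after _) (sym (h≡ ρ)) (cons (runs a ρ) (runs b ρ))
    ; time-small = suc≼ (time-small a +≼ time-small b)
    ; size-small = ≼-below (λ ρ → ≤-reflexive (cong treeSize (h≡ ρ))) (suc≼ (size-small a +≼ size-small b))
    }

  hd-comp : ∀ {σ τ} {f : Env Γ → El σ} {g : Env Γ → El τ} →
            (∀ ρ → head (encode σ (f ρ)) ≡ encode τ (g ρ)) → Comp Γ σ f → Comp Γ τ g
  hd-comp {σ} {τ} {f} g≡ a = record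
    { prog       = hd (prog a)
    ; time       = λ ρ → suc (time a ρ)
    ; runs       = λ ρ → subst (λ v → _ ⊢ _ ⇓ v after _) (g≡ ρ) (hd (runs a ρ))
    ; time-small = suc≼ (time-small a)
    ; size-small = ≼-below (λ ρ → subst (λ v → treeSize v ≤ size σ (f ρ)) (g≡ ρ) (head-size (encode σ (f ρ))))
                           (size-small a)
    }
    where
    head-size : ∀ t → treeSize (head t) ≤ treeSize t
    head-size nil     = z≤n
    head-size (s ∙ t) = m≤n⇒m≤1+n (m≤m+n _ _)

  tl-comp : ∀ {σ τ} {f : Env Γ → El σ} {g : Env Γ → El τ} →
            (∀ ρ → tail (encode σ (f ρ)) ≡ encode τ (g ρ)) → Comp Γ σ f → Comp Γ τ g
  tl-comp {σ} {τ} {f} g≡ a = record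
    { prog       = tl (prog a)
    ; time       = λ ρ → suc (time a ρ)
    ; runs       = λ ρ → subst (λ v → _ ⊢ _ ⇓ v after _) (g≡ ρ) (tl (runs a ρ))
    ; time-small = suc≼ (time-small a)
    ; size-small = ≼-below (λ ρ → subst (λ v → treeSize v ≤ size σ (f ρ)) (g≡ ρ) (tail-size (encode σ (f ρ))))
                           (size-small a)
    }
    where
    tail-size : ∀ t → treeSize (tail t) ≤ treeSize t
    tail-size nil     = z≤n
    tail-size (s ∙ t) = m≤n⇒m≤1+n (m≤n+m _ _)

  ifC : ∀ {τ c f g} → Comp Γ bool c → Comp Γ τ f → Comp Γ τ g →
        Comp Γ τ (λ ρ → if c ρ then f ρ else g ρ)
  ifC {τ} {c} {f} {g} k a b = record
    { prog       = if (prog k) (prog a) (prog b)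
    ; time       = λ ρ → suc (time k ρ + (if c ρ then time a ρ else time b ρ))
    ; runs       = λ ρ → go ρ (c ρ) (runs k ρ)
    ; time-small = suc≼ (time-small k +≼ ≼-below (λ ρ → if-≤ (c ρ)) (time-small a +≼ time-small b))
    ; size-small = ≼-below (λ ρ → size-if (c ρ)) (size-small a +≼ size-small b)
    }
    where
    go : ∀ ρ b₀ {s} → encodeEnv Γ ρ ⊢ prog k ⇓ encodeBool b₀ after s →
         encodeEnv Γ ρ ⊢ if (prog k) (prog a) (prog b) ⇓ encode τ (if b₀ then f ρ else g ρ)
           after suc (s + (if b₀ then time a ρ else time b ρ))
    go ρ true  d = if-cons d (runs a ρ)
    go ρ false d = if-nil d (runs b ρ)
    if-≤ : ∀ b₀ {m n} → (if b₀ then m else n) ≤ m + n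
    if-≤ true  = m≤m+n _ _
    if-≤ false = m≤n+m _ _
    size-if : ∀ b₀ {x y} → size τ (if b₀ then x else y) ≤ size τ x + size τ y
    size-if true  = m≤m+n _ _
    size-if false = m≤n+m _ _

-- Iteration over lists

size-++ : ∀ τ (xs ys : List (El τ)) → size (list τ) (xs ++ ys) ≡ size (list τ) xs + size (list τ) ys
size-++ τ []       ys = refl
size-++ τ (x ∷ xs) ys = cong suc (trans (cong (size τ x +_) (size-++ τ xs ys)) (sym (+-assoc (size τ x) _ _)))

length≤size : ∀ τ (xs : List (El τ)) → length xs ≤ size (list τ) xs
length≤size τ []       = z≤n
length≤size τ (x ∷ xs) = s≤s (≤-trans (length≤size τ xs) (m≤n+m _ (size τ x)))

module _ {Γ : Ctx} {σ τ : Ty} {l : Env Γ → List (El σ)} {i : Env Γ → El τ} {g : Env (σ ∷ τ ∷ Γ) → El τ} where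

  iterate : Env Γ → El τ → List (El σ) → El τ
  iterate ρ = foldl (λ acc x → g (x , acc , ρ))

  -- Iterating a polynomial-time body need not be polynomial, since the accumulator could double in
  -- each round. Hence the hypothesis `acc-small`, which bounds the accumulator after every prefix
  -- of the list.
  module FoldL
    (lC : Comp Γ (list σ) l) (iC : Comp Γ τ i) (gC : Comp (σ ∷ τ ∷ Γ) τ g)
    {b : Env Γ → ℕ} (b≼ : b ≼ width Γ)
    (acc-small : ∀ ρ ys zs → l ρ ≡ ys ++ zs → size τ (iterate ρ (i ρ) ys) ≤ b ρ)
    where

    skip : Fin (2 + length Γ) → Fin (3 + length Γ)
    skip = lift (lift suc)

    -- The loop state is the pair of the remaining list and the accumulator. The body binds the
    -- accumulator and then the first item, so that `gC` finds them as variables 1 and 0; `skip`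
    -- passes over the state, which is variable 2.
    guard body : Program (suc (length Γ))
    guard = hd (var zero)
    body  = let′ (tl (var zero)) (let′ (hd (hd (var (suc zero))))
              (cons (tl (hd (var (suc (suc zero))))) (rename skip (prog gC))))

    loopTime : Env Γ → El τ → List (El σ) → ℕ
    loopTime ρ acc []       = 3
    loopTime ρ acc (x ∷ xs) = suc (2 + suc (2 + suc (3 + suc (3 + time gC (x , acc , ρ)))) +
                                   loopTime ρ (g (x , acc , ρ)) xs)

    loop : ∀ ρ acc xs → Loop (encodeEnv Γ ρ) guard body
             (encode (list σ) xs ∙ encode τ acc) (nil ∙ encode τ (iterate ρ acc xs)) (loopTime ρ acc xs)
    loop ρ acc []       = stop (hd (var zero))
    loop ρ acc (x ∷ xs) = step (hd (var zero))
      (let′ (tl (var zero)) (let′ (hd (hd (var (suc zero))))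
        (cons (tl (hd (var (suc (suc zero))))) (rename-runs along (runs gC (x , acc , ρ))))))
      (loop ρ (g (x , acc , ρ)) xs)
      where
      along : ∀ {u v w} → Along skip (u ∷ v ∷ encodeEnv Γ ρ) (u ∷ v ∷ w ∷ encodeEnv Γ ρ)
      along zero          = refl
      along (suc zero)    = refl
      along (suc (suc i)) = refl

    loopTime≤ : ∀ ρ B acc xs →
                (∀ ys x zs → xs ≡ ys ++ x ∷ zs → time gC (x , iterate ρ acc ys , ρ) ≤ B) →
                loopTime ρ acc xs ≤ suc (length xs) * (20 + B)
    loopTime≤ ρ B acc [] small = s≤s (s≤s (s≤s z≤n))
    loopTime≤ ρ B acc (x ∷ xs) small = begin
      -- A round takes 14 steps outside `gC`. The constant 20 covers this as well as the 3 steps of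
      -- the final test.
      14 + time gC (x , acc , ρ) + loopTime ρ (g (x , acc , ρ)) xs
        ≤⟨ +-mono-≤ (+-mono-≤ (m≤m+n 14 6) (small [] x xs refl))
                    (loopTime≤ ρ B _ xs λ ys y zs eq → small (x ∷ ys) y zs (cong (x ∷_) eq)) ⟩
      (20 + B) + suc (length xs) * (20 + B)  ∎
      where open ≤-Reasoning

    bodyTime≼ : ∃[ d ] (∀ ρ ys x zs → l ρ ≡ ys ++ x ∷ zs →
                  time gC (x , iterate ρ (i ρ) ys , ρ) ≤ (size (list σ) (l ρ) + (b ρ + width Γ ρ)) ^ d)
    bodyTime≼ with time-small gC
    ... | d , t≤ = d , λ ρ ys x zs eq → ≤-trans (t≤ _) (^-monoˡ-≤ d
          (+-mono-≤ (item-small ρ ys x zs eq) (+-monoˡ-≤ (width Γ ρ) (acc-small ρ ys (x ∷ zs) eq))))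
      where
      item-small : ∀ ρ ys x zs → l ρ ≡ ys ++ x ∷ zs → size σ x ≤ size (list σ) (l ρ)
      item-small ρ ys x zs eq rewrite eq | size-++ σ ys (x ∷ zs) =
        ≤-trans (m≤n⇒m≤1+n (m≤m+n (size σ x) _)) (m≤n+m _ (size (list σ) ys))

    bodyBound : Env Γ → ℕ
    bodyBound ρ = (size (list σ) (l ρ) + (b ρ + width Γ ρ)) ^ proj₁ bodyTime≼

    bodyBound≼ : bodyBound ≼ width Γ
    bodyBound≼ = ≼-trans-∘ {v = λ ρ → size (list σ) (l ρ) + (b ρ + width Γ ρ)} id
      (proj₁ bodyTime≼ , λ _ → ≤-refl) (size-small lC +≼ (b≼ +≼ ≼-refl))

    foldlC : Comp Γ τ (λ ρ → iterate ρ (i ρ) (l ρ))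
    foldlC = record
      { prog       = tl (while guard body (cons (prog lC) (prog iC)))
      ; time       = λ ρ → suc (suc (suc (time lC ρ + time iC ρ) + loopTime ρ (i ρ) (l ρ)))
      ; runs       = λ ρ → tl (while (cons (runs lC ρ) (runs iC ρ)) (loop ρ (i ρ) (l ρ)))
      ; time-small = suc≼ (suc≼ (suc≼ (time-small lC +≼ time-small iC) +≼ ≼-below
          (λ ρ → loopTime≤ ρ (bodyBound ρ) (i ρ) (l ρ) (λ ys x zs eq → proj₂ bodyTime≼ ρ ys x zs eq))
          (≼-* (suc≼ (≼-below (λ ρ → length≤size σ (l ρ)) (size-small lC))) (const≼ 20 +≼ bodyBound≼))))
      ; size-small = ≼-below (λ ρ → acc-small ρ (l ρ) [] (sym (List.++-identityʳ (l ρ)))) b≼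
      }

open FoldL public using (foldlC)

module _ {Γ : Ctx} where

  reverseC : ∀ {σ l} → Comp Γ (list σ) l → Comp Γ (list σ) (reverse ∘ l)
  reverseC {σ} {l} lC = foldlC {g = λ (x , acc , ρ) → x ∷ acc} lC
    (nil-comp [] refl) (cons-comp (λ _ → refl) v0 v1) (size-small lC) λ ρ ys zs eq → begin
      size (list σ) (reverse ys)             ≡⟨ size-reverse ys ⟩
      size (list σ) ys                       ≤⟨ m≤m+n _ _ ⟩
      size (list σ) ys + size (list σ) zs    ≡⟨ size-++ σ ys zs ⟨
      size (list σ) (ys ++ zs)               ≡⟨ cong (size (list σ)) eq ⟨
      size (list σ) (l ρ)                    ∎
    where
    open ≤-Reasoning
    size-reverse : ∀ ys → size (list σ) (reverse ys) ≡ size (list σ) ys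
    size-reverse []       = refl
    size-reverse (y ∷ ys) rewrite List.unfold-reverse y ys | size-++ σ (reverse ys) (y ∷ [])
                                | size-reverse ys | +-identityʳ (size σ y) =
      trans (+-suc (size (list σ) ys) (size σ y)) (cong suc (+-comm (size (list σ) ys) (size σ y)))

  -- The loop consumes lists from the front, so this is a left fold over the reversed list; its
  -- prefixes are the reversed suffixes of the original.
  foldrC : ∀ {σ τ l i g b} → Comp Γ (list σ) l → Comp Γ τ i → Comp (σ ∷ τ ∷ Γ) τ g → b ≼ width Γ →
           (∀ ρ ys zs → l ρ ≡ ys ++ zs → size τ (foldr (λ x acc → g (x , acc , ρ)) (i ρ) zs) ≤ b ρ) →
           Comp Γ τ (λ ρ → foldr (λ x acc → g (x , acc , ρ)) (i ρ) (l ρ))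
  foldrC {σ} {τ} {l} {i} {g} {b} lC iC gC b≼ acc-small =
    subst-comp foldl-reverse (foldlC {g = g} (reverseC lC) iC gC b≼ λ ρ ys zs eq →
      subst (λ v → size τ v ≤ b ρ)
        (trans (sym (List.reverse-foldl (flip (push ρ)) (i ρ) (reverse ys)))
               (cong (foldl (flip (push ρ)) (i ρ)) (List.reverse-involutive ys)))
        (acc-small ρ (reverse zs) (reverse ys) (split ρ ys zs eq)))
    where
    push : ∀ ρ → El σ → El τ → El τ
    push ρ x acc = g (x , acc , ρ)
    split : ∀ ρ ys zs → reverse (l ρ) ≡ ys ++ zs → l ρ ≡ reverse zs ++ reverse ys
    split ρ ys zs eq = trans (sym (List.reverse-involutive (l ρ)))
                             (trans (cong reverse eq) (List.reverse-++ ys zs))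
    foldl-reverse : ∀ ρ → foldl (flip (push ρ)) (i ρ) (reverse (l ρ)) ≡ foldr (push ρ) (i ρ) (l ρ)
    foldl-reverse ρ = List.reverse-foldl (flip (push ρ)) (i ρ) (l ρ)

  -- Additive growth of the accumulator keeps it polynomial.
  foldr⁺C : ∀ {σ τ l i g h} → Comp Γ (list σ) l → Comp Γ τ i → Comp (σ ∷ τ ∷ Γ) τ g → h ≼ width (σ ∷ Γ) →
            (∀ x acc ρ → size τ (g (x , acc , ρ)) ≤ size τ acc + h (x , ρ)) →
            Comp Γ τ (λ ρ → foldr (λ x acc → g (x , acc , ρ)) (i ρ) (l ρ))
  foldr⁺C {σ} {τ} {l} {i} {g} {h} lC iC gC (d , h≤) grows =
    -- Each item adds at most `(size (l ρ) + width ρ) ^ d`, and there are at most `size (l ρ)`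
    -- items.
    foldrC {g = g} {b = λ ρ → size τ (i ρ) + size (list σ) (l ρ) * (size (list σ) (l ρ) + width Γ ρ) ^ d}
      lC iC gC
      (size-small iC +≼ ≼-* (size-small lC)
        (≼-trans-∘ {v = λ ρ → size (list σ) (l ρ) + width Γ ρ} id (d , λ _ → ≤-refl) (size-small lC +≼ ≼-refl)))
      λ ρ ys zs eq → ≤-trans (bound ρ zs) (+-monoʳ-≤ (size τ (i ρ)) (mono ρ (suffix ρ ys zs eq)))
    where
    mono : ∀ ρ {m n} → m ≤ n → m * (m + width Γ ρ) ^ d ≤ n * (n + width Γ ρ) ^ d
    mono ρ m≤n = *-mono-≤ m≤n (^-monoˡ-≤ d (+-monoˡ-≤ (width Γ ρ) m≤n))
    suffix : ∀ ρ ys zs → l ρ ≡ ys ++ zs → size (list σ) zs ≤ size (list σ) (l ρ)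
    suffix ρ ys zs eq rewrite eq | size-++ σ ys zs = m≤n+m _ (size (list σ) ys)
    bound : ∀ ρ zs → size τ (foldr (λ x acc → g (x , acc , ρ)) (i ρ) zs) ≤
                     size τ (i ρ) + size (list σ) zs * (size (list σ) zs + width Γ ρ) ^ d
    bound ρ []       = ≤-reflexive (sym (+-identityʳ _))
    bound ρ (z ∷ zs) = begin
      size τ (g (z , acc , ρ))                            ≤⟨ grows z acc ρ ⟩
      size τ acc + h (z , ρ)                              ≤⟨ +-mono-≤ (bound ρ zs) (h≤ (z , ρ)) ⟩
      size τ (i ρ) + s * (s + w) ^ d + (size σ z + w) ^ d
        ≤⟨ +-mono-≤ (+-monoʳ-≤ (size τ (i ρ)) (*-monoʳ-≤ s (^-monoˡ-≤ d (+-monoˡ-≤ w s≤))))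
                    (^-monoˡ-≤ d (+-monoˡ-≤ w (m≤n⇒m≤1+n (m≤m+n (size σ z) s)))) ⟩
      size τ (i ρ) + s * (S + w) ^ d + (S + w) ^ d        ≡⟨ +-assoc (size τ (i ρ)) _ _ ⟩
      size τ (i ρ) + (s * (S + w) ^ d + (S + w) ^ d)
        ≤⟨ +-monoʳ-≤ (size τ (i ρ)) (begin
             s * (S + w) ^ d + (S + w) ^ d  ≡⟨ +-comm (s * (S + w) ^ d) _ ⟩
             suc s * (S + w) ^ d            ≤⟨ *-monoˡ-≤ ((S + w) ^ d) (s≤s (m≤n+m s (size σ z))) ⟩
             S * (S + w) ^ d                ∎) ⟩
      size τ (i ρ) + S * (S + w) ^ d                      ∎
      where
      open ≤-Reasoning
      acc = foldr (λ x acc → g (x , acc , ρ)) (i ρ) zs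
      s = size (list σ) zs
      S = size (list σ) (z ∷ zs)
      w = width Γ ρ
      s≤ : s ≤ S
      s≤ = m≤n⇒m≤1+n (m≤n+m s (size σ z))

-- Programs for Booleans, lists and numbers

module _ {Γ : Ctx} where

  falseC : Comp Γ bool (λ _ → false)
  falseC = nil-comp false refl

  []C : ∀ {σ} → Comp Γ (list σ) (λ _ → [])
  []C = nil-comp [] refl

  0C : Comp Γ nat (λ _ → 0)
  0C = nil-comp 0 refl

  trueC : Comp Γ bool (λ _ → true)
  trueC = cons-comp (λ _ → refl) falseC falseC

  notC : ∀ {f} → Comp Γ bool f → Comp Γ bool (not ∘ f)
  notC {f} a = subst-comp (λ ρ → lemma (f ρ)) (ifC a falseC trueC)
    where
    lemma : ∀ b → (if b then false else true) ≡ not b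
    lemma true  = refl
    lemma false = refl

  infixr 5 _∧C_
  infixr 4 _∨C_ _xorC_

  _∧C_ : ∀ {f g} → Comp Γ bool f → Comp Γ bool g → Comp Γ bool (λ ρ → f ρ ∧ g ρ)
  _∧C_ {f} {g} a b = subst-comp (λ ρ → lemma (f ρ)) (ifC a b falseC)
    where
    lemma : ∀ b {c} → (if b then c else false) ≡ b ∧ c
    lemma true  = refl
    lemma false = refl

  _∨C_ : ∀ {f g} → Comp Γ bool f → Comp Γ bool g → Comp Γ bool (λ ρ → f ρ ∨ g ρ)
  _∨C_ {f} {g} a b = subst-comp (λ ρ → lemma (f ρ)) (ifC a trueC b)
    where
    lemma : ∀ b {c} → (if b then true else c) ≡ b ∨ c
    lemma true  = refl
    lemma false = refl

  _xorC_ : ∀ {f g} → Comp Γ bool f → Comp Γ bool g → Comp Γ bool (λ ρ → f ρ xor g ρ)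
  _xorC_ {f} {g} a b = subst-comp (λ ρ → lemma (f ρ)) (ifC a (notC b) b)
    where
    lemma : ∀ b {c} → (if b then not c else c) ≡ b xor c
    lemma true  = refl
    lemma false = refl

nonNil : Tree → Bool
nonNil nil     = false
nonNil (_ ∙ _) = true

module _ {Γ : Ctx} where

  nonNilC : ∀ {σ f} → Comp Γ σ f → Comp Γ bool (λ ρ → nonNil (encode σ (f ρ)))
  nonNilC {σ} {f} a = record
    { prog       = if (prog a) (cons nil nil) nil
    ; time       = λ ρ → suc (time a ρ + tm (encode σ (f ρ)))
    ; runs       = λ ρ → go ρ (encode σ (f ρ)) (runs a ρ)
    ; time-small = suc≼ (time-small a +≼ ≼-below (λ ρ → tm≤3 (encode σ (f ρ))) (const≼ 3))
    ; size-small = ≼-below (λ ρ → size≤1 (encode σ (f ρ))) (const≼ 1)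
    }
    where
    tm : Tree → ℕ
    tm nil     = 1
    tm (_ ∙ _) = 3
    tm≤3 : ∀ t → tm t ≤ 3
    tm≤3 nil     = s≤s z≤n
    tm≤3 (_ ∙ _) = ≤-refl
    size≤1 : ∀ t → size bool (nonNil t) ≤ 1
    size≤1 nil     = z≤n
    size≤1 (_ ∙ _) = ≤-refl
    go : ∀ ρ v {s} → encodeEnv Γ ρ ⊢ prog a ⇓ v after s →
         encodeEnv Γ ρ ⊢ if (prog a) (cons nil nil) nil ⇓ encodeBool (nonNil v) after suc (s + tm v)
    go ρ nil     d = if-nil d nil
    go ρ (_ ∙ _) d = if-cons d (cons nil nil)

  nullC : ∀ {σ l} → Comp Γ (list σ) l → Comp Γ bool (null ∘ l)
  nullC {l = l} lC = subst-comp (λ ρ → lemma (l ρ)) (notC (nonNilC lC))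
    where
    lemma : ∀ xs → not (nonNil (encode (list _) xs)) ≡ null xs
    lemma []      = refl
    lemma (_ ∷ _) = refl

module _ {Γ : Ctx} where

  infixr 3 _,C_
  infixr 6 _∷C_

  _,C_ : ∀ {σ τ f g} → Comp Γ σ f → Comp Γ τ g → Comp Γ (σ ⊗ τ) (λ ρ → f ρ , g ρ)
  _,C_ = cons-comp (λ _ → refl)

  fstC : ∀ {σ τ f} → Comp Γ (σ ⊗ τ) f → Comp Γ σ (proj₁ ∘ f)
  fstC = hd-comp (λ _ → refl)

  sndC : ∀ {σ τ f} → Comp Γ (σ ⊗ τ) f → Comp Γ τ (proj₂ ∘ f)
  sndC = tl-comp (λ _ → refl)

  _∷C_ : ∀ {σ f g} → Comp Γ σ f → Comp Γ (list σ) g → Comp Γ (list σ) (λ ρ → f ρ ∷ g ρ)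
  _∷C_ = cons-comp (λ _ → refl)

  tailC : ∀ {σ l} → Comp Γ (list σ) l → Comp Γ (list σ) (drop 1 ∘ l)
  tailC {l = l} = tl-comp (λ ρ → lemma (l ρ))
    where
    lemma : ∀ xs → tail (encode (list _) xs) ≡ encode (list _) (drop 1 xs)
    lemma []      = refl
    lemma (_ ∷ _) = refl

  -- Case distinction on a list: a right fold that ignores its accumulator returns the value at the
  -- first item, or the default for the empty list.
  whenConsC : ∀ {σ τ l d g} → Comp Γ (list σ) l → Comp Γ τ d → Comp (σ ∷ Γ) τ g →
              Comp Γ τ (λ ρ → foldr (λ x _ → g (x , ρ)) (d ρ) (l ρ))
  whenConsC {g = g} lC dC gC = foldr⁺C {g = λ (x , _ , ρ) → g (x , ρ)} lC dC
    (↑₁ gC) (size-small gC) λ x acc ρ → m≤n+m _ _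

module _ {Γ : Ctx} where

  infixr 6 _++C_

  _++C_ : ∀ {σ f g} → Comp Γ (list σ) f → Comp Γ (list σ) g → Comp Γ (list σ) (λ ρ → f ρ ++ g ρ)
  _++C_ {σ} {f} {g} a b = subst-comp (λ ρ → sym (List.++-is-foldr (f ρ) (g ρ)))
    (foldr⁺C {g = λ (x , acc , ρ) → x ∷ acc} a b (v0 ∷C v1) (suc≼ (size-small v0))
      λ x acc ρ → ≤-reflexive (trans (cong suc (+-comm (size σ x) _)) (sym (+-suc _ _))))

  mapC : ∀ {σ τ l g} → Comp Γ (list σ) l → Comp (σ ∷ Γ) τ g →
         Comp Γ (list τ) (λ ρ → map (λ x → g (x , ρ)) (l ρ))
  mapC {τ = τ} {l} {g} a c = subst-comp (λ ρ → sym (List.map-is-foldr (l ρ)))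
    (foldr⁺C {g = λ (x , acc , ρ) → g (x , ρ) ∷ acc} a []C (↑₁ c ∷C v1) (suc≼ (size-small c))
      λ x acc ρ → ≤-reflexive (trans (cong suc (+-comm (size τ (g (x , ρ))) _)) (sym (+-suc _ _))))

  filterC : ∀ {σ l p} → Comp Γ (list σ) l → Comp (σ ∷ Γ) bool p →
            Comp Γ (list σ) (λ ρ → filterᵇ (λ x → p (x , ρ)) (l ρ))
  filterC {σ} {l} {p} a c = subst-comp (λ ρ → sym (filter-is-foldr ρ (l ρ)))
    (foldr⁺C {g = λ (x , acc , ρ) → if p (x , ρ) then x ∷ acc else acc} a []C
      (ifC (↑₁ c) (v0 ∷C v1) v1) (suc≼ (size-small v0)) grows)
    where
    filter-is-foldr : ∀ ρ xs → filterᵇ (λ x → p (x , ρ)) xs ≡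
                      foldr (λ x acc → if p (x , ρ) then x ∷ acc else acc) [] xs
    filter-is-foldr ρ [] = refl
    filter-is-foldr ρ (x ∷ xs) with p (x , ρ)
    ... | true  = cong (x ∷_) (filter-is-foldr ρ xs)
    ... | false = filter-is-foldr ρ xs
    grows : ∀ x acc ρ → size (list σ) (if p (x , ρ) then x ∷ acc else acc) ≤
                        size (list σ) acc + suc (size σ x)
    grows x acc ρ with p (x , ρ)
    ... | true  = ≤-reflexive (trans (cong suc (+-comm (size σ x) _)) (sym (+-suc _ _)))
    ... | false = m≤m+n _ _

module _ {Γ : Ctx} where

  orC : ∀ {l} → Comp Γ (list bool) l → Comp Γ bool (or ∘ l)
  orC a = foldr⁺C {g = λ (x , acc , ρ) → x ∨ acc} a falseC (v0 ∨C v1) (size-small v0) grows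
    where
    grows : ∀ x acc (ρ : Env Γ) → size bool (x ∨ acc) ≤ size bool acc + size bool x
    grows true  acc ρ = m≤n+m 1 _
    grows false acc ρ = m≤m+n _ _

  andC : ∀ {l} → Comp Γ (list bool) l → Comp Γ bool (and ∘ l)
  andC a = foldr⁺C {g = λ (x , acc , ρ) → x ∧ acc} a trueC (v0 ∧C v1) (size-small v0) grows
    where
    grows : ∀ x acc (ρ : Env Γ) → size bool (x ∧ acc) ≤ size bool acc + size bool x
    grows true  acc ρ = m≤m+n _ _
    grows false acc ρ = z≤n

  anyC : ∀ {σ l p} → Comp Γ (list σ) l → Comp (σ ∷ Γ) bool p →
         Comp Γ bool (λ ρ → any (λ x → p (x , ρ)) (l ρ))
  anyC a c = orC (mapC a c)

  allC : ∀ {σ l p} → Comp Γ (list σ) l → Comp (σ ∷ Γ) bool p →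
         Comp Γ bool (λ ρ → all (λ x → p (x , ρ)) (l ρ))
  allC a c = andC (mapC a c)

  concatC : ∀ {σ l} → Comp Γ (list (list σ)) l → Comp Γ (list σ) (concat ∘ l)
  concatC {σ} a = foldr⁺C {g = λ (x , acc , ρ) → x ++ acc} a []C (v0 ++C v1) (size-small v0)
    λ x acc ρ → ≤-reflexive (trans (size-++ σ x acc) (+-comm (size (list σ) x) _))

  sucC : ∀ {f} → Comp Γ nat f → Comp Γ nat (suc ∘ f)
  sucC = cons-comp (λ _ → refl) falseC

  predC : ∀ {f} → Comp Γ nat f → Comp Γ nat (pred ∘ f)
  predC {f} = tl-comp (λ ρ → lemma (f ρ))
    where
    lemma : ∀ n → tail (encodeℕ n) ≡ encodeℕ (pred n)
    lemma zero    = refl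
    lemma (suc n) = refl

module _ {Γ : Ctx} where

  lengthC : ∀ {σ l} → Comp Γ (list σ) l → Comp Γ nat (length ∘ l)
  lengthC a = foldr⁺C {g = λ (x , acc , ρ) → suc acc} a 0C (sucC v1) (const≼ 1)
    λ x acc ρ → ≤-reflexive (+-comm 1 (size nat acc))

  unaryC : ∀ {f} → Comp Γ nat f → Comp Γ (list bool) (λ ρ → replicate (f ρ) false)
  unaryC {f} = recast (λ ρ → lemma (f ρ))
    where
    lemma : ∀ n → encodeℕ n ≡ encode (list bool) (replicate n false)
    lemma zero    = refl
    lemma (suc n) = cong (nil ∙_) (lemma n)

size-nat : ∀ n → size nat n ≡ n
size-nat zero    = refl
size-nat (suc n) = cong suc (size-nat n)

foldr-replicate : ∀ {A B : Set} (s : B → B) z n (x : A) →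
                  foldr (λ _ → s) z (replicate n x) ≡ fold z s n
foldr-replicate s z zero    x = refl
foldr-replicate s z (suc n) x = cong s (foldr-replicate s z n x)

module _ {Γ : Ctx} where

  foldC : ∀ {τ n i g h} → Comp Γ nat n → Comp Γ τ i → Comp (τ ∷ Γ) τ g → h ≼ width Γ →
          (∀ acc ρ → size τ (g (acc , ρ)) ≤ size τ acc + h ρ) →
          Comp Γ τ (λ ρ → fold (i ρ) (λ acc → g (acc , ρ)) (n ρ))
  foldC {τ} {n} {i} {g} {h} nC iC gC h≼ grows =
    subst-comp (λ ρ → foldr-replicate (λ acc → g (acc , ρ)) (i ρ) (n ρ) false)
      (foldr⁺C {h = λ (_ , ρ) → h ρ} (unaryC nC) iC (↑ gC)
        (≼-trans-∘ proj₂ h≼ (≼-below (λ (x , ρ) → m≤n+m (width Γ ρ) (size bool x)) ≼-refl))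
        λ _ acc ρ → grows acc ρ)

  infixl 7 _+C_ _∸C_

  _+C_ : ∀ {m n} → Comp Γ nat m → Comp Γ nat n → Comp Γ nat (λ ρ → m ρ + n ρ)
  _+C_ {m} {n} a b = subst-comp (λ ρ → lemma (m ρ) (n ρ))
    (foldC a b (sucC v0) (const≼ 1) λ acc ρ → ≤-reflexive (+-comm 1 (size nat acc)))
    where
    lemma : ∀ m n → fold n suc m ≡ m + n
    lemma zero    n = refl
    lemma (suc m) n = cong suc (lemma m n)

  _∸C_ : ∀ {m n} → Comp Γ nat m → Comp Γ nat n → Comp Γ nat (λ ρ → m ρ ∸ n ρ)
  _∸C_ {m} {n} a b = subst-comp (λ ρ → lemma (m ρ) (n ρ))
    (foldC b a (predC v0) (const≼ 0) λ acc ρ → pred-small acc)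
    where
    lemma : ∀ m n → fold m pred n ≡ m ∸ n
    lemma m zero    = refl
    lemma m (suc n) = trans (cong pred (lemma m n)) (pred[m∸n]≡m∸[1+n] m n)
    pred-small : ∀ n → size nat (pred n) ≤ size nat n + 0
    pred-small n rewrite size-nat (pred n) | size-nat n | +-identityʳ n = pred[n]≤n

  infix 6 _≤ᵇC_ _≡ᵇC_

  _≤ᵇC_ : ∀ {m n} → Comp Γ nat m → Comp Γ nat n → Comp Γ bool (λ ρ → m ρ ≤ᵇ n ρ)
  _≤ᵇC_ {m} {n} a b = subst-comp (λ ρ → lemma (m ρ) (n ρ)) (notC (nonNilC (a ∸C b)))
    where
    lemma : ∀ m n → not (nonNil (encodeℕ (m ∸ n))) ≡ (m ≤ᵇ n)
    lemma zero          zero    = refl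
    lemma zero          (suc n) = refl
    lemma (suc m)       zero    = refl
    lemma (suc zero)    (suc n) = lemma zero n
    lemma (suc (suc m)) (suc n) = lemma (suc m) n

  _≡ᵇC_ : ∀ {m n} → Comp Γ nat m → Comp Γ nat n → Comp Γ bool (λ ρ → m ρ ≡ᵇ n ρ)
  _≡ᵇC_ {m} {n} a b = subst-comp (λ ρ → lemma (m ρ) (n ρ)) ((a ≤ᵇC b) ∧C (b ≤ᵇC a))
    where
    lemma : ∀ m n → (m ≤ᵇ n) ∧ (n ≤ᵇ m) ≡ (m ≡ᵇ n)
    lemma zero          zero          = refl
    lemma zero          (suc n)       = refl
    lemma (suc m)       zero          = refl
    lemma (suc zero)    (suc zero)    = refl
    lemma (suc zero)    (suc (suc n)) = refl
    lemma (suc (suc m)) (suc zero)    = refl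
    lemma (suc (suc m)) (suc (suc n)) = lemma (suc m) (suc n)

  dropC : ∀ {σ n l} → Comp Γ nat n → Comp Γ (list σ) l → Comp Γ (list σ) (λ ρ → drop (n ρ) (l ρ))
  dropC {σ} {n} {l} a b = subst-comp (λ ρ → lemma (n ρ) (l ρ))
    (foldC a b (tailC v0) (const≼ 0) λ acc ρ → drop-small acc)
    where
    drop-1 : ∀ n (xs : List (El σ)) → drop 1 (drop n xs) ≡ drop (suc n) xs
    drop-1 zero    xs       = refl
    drop-1 (suc n) []       = refl
    drop-1 (suc n) (x ∷ xs) = drop-1 n xs
    lemma : ∀ n (xs : List (El σ)) → fold xs (drop 1) n ≡ drop n xs
    lemma zero    xs = refl
    lemma (suc n) xs = trans (cong (drop 1) (lemma n xs)) (drop-1 n xs)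
    drop-small : ∀ (xs : List (El σ)) → size (list σ) (drop 1 xs) ≤ size (list σ) xs + 0
    drop-small []       = z≤n
    drop-small (x ∷ xs) = ≤-trans (m≤n⇒m≤1+n (m≤n+m _ (size σ x))) (m≤m+n _ 0)

module _ {Γ : Ctx} where

  takeC : ∀ {σ n l} → Comp Γ nat n → Comp Γ (list σ) l → Comp Γ (list σ) (λ ρ → take (n ρ) (l ρ))
  takeC {σ} {n} {l} a b = subst-comp (λ ρ → cong proj₁ (lemma (n ρ) (l ρ)))
    (fstC (foldC a ([]C ,C b)
      ((fstC v0 ++C whenConsC (sndC v0) []C (v0 ∷C []C)) ,C tailC (sndC v0))
      (const≼ 0) λ acc ρ → small acc))
    where
    first : List (El σ) → List (El σ)
    first = foldr (λ x _ → x ∷ []) []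
    advance : List (El σ) × List (El σ) → List (El σ) × List (El σ)
    advance (ys , zs) = ys ++ first zs , drop 1 zs
    take-drop : ∀ n (xs : List (El σ)) → advance (take n xs , drop n xs) ≡ (take (suc n) xs , drop (suc n) xs)
    take-drop zero    []       = refl
    take-drop zero    (x ∷ xs) = refl
    take-drop (suc n) []       = refl
    take-drop (suc n) (x ∷ xs) = cong (λ (ys , zs) → x ∷ ys , zs) (take-drop n xs)
    lemma : ∀ n (xs : List (El σ)) → fold ([] , xs) advance n ≡ (take n xs , drop n xs)
    lemma zero    xs = refl
    lemma (suc n) xs = trans (cong advance (lemma n xs)) (take-drop n xs)
    small : ∀ acc → size (list σ ⊗ list σ) (advance acc) ≤ size (list σ ⊗ list σ) acc + 0
    small (ys , [])     rewrite size-++ σ ys [] = ≤-refl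
    small (ys , z ∷ zs) rewrite size-++ σ ys (z ∷ []) = s≤s (≤-reflexive (begin
      size (list σ) ys + suc (size σ z + 0) + size (list σ) zs
        ≡⟨ +-assoc (size (list σ) ys) _ _ ⟩
      size (list σ) ys + suc (size σ z + 0 + size (list σ) zs)
        ≡⟨ cong (λ v → size (list σ) ys + suc (v + size (list σ) zs)) (+-identityʳ (size σ z)) ⟩
      size (list σ) ys + suc (size σ z + size (list σ) zs)
        ≡⟨ +-identityʳ _ ⟨
      size (list σ) ys + suc (size σ z + size (list σ) zs) + 0 ∎))
      where open ≡-Reasoning

  -- The next number is the length of the list built so far. The growth thus depends on the
  -- accumulator and is not of the additive kind, which is why a quadratic bound is supplied by
  -- hand.
  downFromC : ∀ {n} → Comp Γ nat n → Comp Γ (list nat) (downFrom ∘ n)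
  downFromC {n} a = subst-comp (λ ρ → trans (lemma (replicate (n ρ) false))
                                            (cong downFrom (List.length-replicate (n ρ))))
    (foldrC {g = λ (_ , acc , _) → length acc ∷ acc} (unaryC a) []C (lengthC v1 ∷C v1)
      (≼-* (size-small a) (suc≼ (size-small a))) small)
    where
    lemma : ∀ (zs : List Bool) → foldr (λ _ acc → length acc ∷ acc) [] zs ≡ downFrom (length zs)
    lemma []       = refl
    lemma (z ∷ zs) rewrite lemma zs = cong (_∷ downFrom (length zs)) (List.length-downFrom (length zs))
    size-downFrom : ∀ m → size (list nat) (downFrom m) ≤ m * suc m
    size-downFrom zero    = z≤n
    size-downFrom (suc m) rewrite size-nat m =
      s≤s (+-mono-≤ (n≤1+n m) (≤-trans (size-downFrom m) (*-monoʳ-≤ m (n≤1+n (suc m)))))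
    small : ∀ ρ ys zs → replicate (n ρ) false ≡ ys ++ zs →
            size (list nat) (foldr (λ _ acc → length acc ∷ acc) [] zs) ≤ size nat (n ρ) * suc (size nat (n ρ))
    small ρ ys zs eq rewrite lemma zs | size-nat (n ρ) = ≤-trans (size-downFrom (length zs)) (*-mono-≤ zs≤n (s≤s zs≤n))
      where
      zs≤n : length zs ≤ n ρ
      zs≤n = subst (length zs ≤_) (trans (sym (List.length-++ ys)) (trans (cong length (sym eq)) (List.length-replicate (n ρ))))
                   (m≤n+m (length zs) (length ys))

member : ℕ → List ℕ → Bool
member x = any (x ≡ᵇ_)

memberC : ∀ {Γ x l} → Comp Γ nat x → Comp Γ (list nat) l → Comp Γ bool (λ ρ → member (x ρ) (l ρ))
memberC a b = anyC b (↑ a ≡ᵇC v0)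

-- Lists

Disjoint : {A : Set} → List A → List A → Set
Disjoint xs ys = ∀ {x} → x ∈ xs → x ∉ ys

any-sound : {A : Set} (p : A → Bool) (xs : List A) → T (any p xs) → ∃[ x ] x ∈ xs × T (p x)
any-sound p xs = find ∘ Any.any⁻ p xs

any-complete : {A : Set} (p : A → Bool) {xs : List A} {x : A} → x ∈ xs → T (p x) → T (any p xs)
any-complete p x∈xs px = Any.any⁺ p (lose x∈xs px)

¬all⇒∃ : {A : Set} (p : A → Bool) (xs : List A) → ¬ T (all p xs) → ∃[ x ] x ∈ xs × ¬ T (p x)
¬all⇒∃ p []       ¬all = contradiction _ ¬all
¬all⇒∃ p (x ∷ xs) ¬all with p x in eq
... | false = x , here refl , subst T eq
... | true  with y , y∈xs , ¬py ← ¬all⇒∃ p xs ¬all = y , there y∈xs , ¬py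

T-not : ∀ {b} → ¬ T b → T (not b)
T-not {true}  ¬b = ¬b _
T-not {false} ¬b = _

T-not⁻ : ∀ {b} → T (not b) → ¬ T b
T-not⁻ {false} _ ()

∈-filterᵇ⁺ : {A : Set} {p : A → Bool} {xs : List A} {x : A} → x ∈ xs → T (p x) → x ∈ filterᵇ p xs
∈-filterᵇ⁺ {p = p} = ∈-filter⁺ (T? ∘ p)

∈-filterᵇ⁻ : {A : Set} (p : A → Bool) (xs : List A) {x : A} → x ∈ filterᵇ p xs → x ∈ xs × T (p x)
∈-filterᵇ⁻ p xs = ∈-filter⁻ (T? ∘ p) {xs = xs}

member-sound : ∀ {x} xs → T (member x xs) → x ∈ xs
member-sound {x} xs m with y , y∈xs , eq ← any-sound (x ≡ᵇ_) xs m rewrite ≡ᵇ⇒≡ x y eq = y∈xs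

member-complete : ∀ {x xs} → x ∈ xs → T (member x xs)
member-complete {x} x∈xs = any-complete (x ≡ᵇ_) x∈xs (≡⇒≡ᵇ x x refl)

infixl 6 _∖_

_∖_ : List ℕ → List ℕ → List ℕ
xs ∖ ys = filterᵇ (λ x → not (member x ys)) xs

∈-∖⁺ : ∀ {x xs} ys → x ∈ xs → x ∉ ys → x ∈ xs ∖ ys
∈-∖⁺ ys x∈ x∉ = ∈-filterᵇ⁺ x∈ (T-not (x∉ ∘ member-sound ys))

∈-∖⁻ : ∀ {x} xs ys → x ∈ xs ∖ ys → x ∈ xs × x ∉ ys
∈-∖⁻ xs ys x∈ with x∈xs , x∉ys ← ∈-filterᵇ⁻ (λ x → not (member x ys)) xs x∈ = x∈xs , T-not⁻ x∉ys ∘ member-complete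

∈-dec : ∀ (x : ℕ) xs → Dec (x ∈ xs)
∈-dec x xs = map′ (member-sound xs) member-complete (T? (member x xs))

-- The pigeonhole principle, with a relation in place of an injection: no `y` serves two entries of
-- `xs`, so the partner of the first entry can be removed from `ys` before the others are matched.
allPairs-length : {A B : Set} (R : A → B → Set) {xs : List A} (ys : List B) →
                  AllPairs (λ x x′ → ∀ y → R x y → R x′ y → ⊥) xs →
                  (∀ {x} → x ∈ xs → ∃[ y ] y ∈ ys × R x y) → length xs ≤ length ys
allPairs-length R ys [] f = z≤n
allPairs-length R ys (x# ∷ xs#) f with y , y∈ys , xRy ← f (here refl)
  with as , bs , refl ← ∈-∃++ y∈ys =
  subst (suc _ ≤_) (sym (trans (List.length-++ as) (trans (+-suc _ _) (cong suc (sym (List.length-++ as))))))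
        (s≤s (allPairs-length R (as ++ bs) xs# f′))
  where
  f′ : ∀ {x′} → x′ ∈ _ → ∃[ y′ ] y′ ∈ as ++ bs × R x′ y′
  f′ x′∈ with y′ , y′∈ , x′Ry′ ← f (there x′∈) with ∈-++⁻ as y′∈
  ... | inj₁ y′∈as           = y′ , ∈-++⁺ˡ y′∈as , x′Ry′
  ... | inj₂ (here refl)     = ⊥-elim (All.lookup x# x′∈ y xRy x′Ry′)
  ... | inj₂ (there y′∈bs)   = y′ , ∈-++⁺ʳ as y′∈bs , x′Ry′

unique-length : {A : Set} {xs : List A} (ys : List A) → Unique xs → (∀ {x} → x ∈ xs → x ∈ ys) →
                length xs ≤ length ys
unique-length ys u xs⊆ys =
  allPairs-length _≡_ ys (AllPairs.map (λ { x≢y _ refl refl → x≢y refl }) u) λ x∈ → _ , xs⊆ys x∈ , refl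

allPairs-lookup : {A : Set} {R : A → A → Set} → (∀ {x y} → R x y → R y x) →
                  ∀ {xs} → AllPairs R xs → ∀ {x y} → x ∈ xs → y ∈ xs → x ≡ y ⊎ R x y
allPairs-lookup R-sym (px ∷ pxs) (here refl) (here refl) = inj₁ refl
allPairs-lookup R-sym (px ∷ pxs) (here refl) (there y∈)  = inj₂ (All.lookup px y∈)
allPairs-lookup R-sym (px ∷ pxs) (there x∈)  (here refl) = inj₂ (R-sym (All.lookup px x∈))
allPairs-lookup R-sym (px ∷ pxs) (there x∈)  (there y∈)  = allPairs-lookup R-sym pxs x∈ y∈

unique⇒allPairs : {A : Set} {R : A → A → Set} {xs : List A} → Unique xs →
                  (∀ {x y} → x ∈ xs → y ∈ xs → x ≢ y → R x y) → AllPairs R xs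
unique⇒allPairs []        r = []
unique⇒allPairs (x# ∷ u)  r = All.tabulate (λ y∈ → r (here refl) (there y∈) (All.lookup x# y∈)) ∷
                              unique⇒allPairs u λ x∈ y∈ → r (there x∈) (there y∈)

∈-take : {A : Set} {x : A} (n : ℕ) (xs : List A) → x ∈ take n xs → x ∈ xs
∈-take n xs x∈ = subst (_ ∈_) (List.take++drop≡id n xs) (∈-++⁺ˡ x∈)

unique-resp-↭ : {xs ys : List ℕ} → xs ↭ ys → Unique xs → Unique ys
unique-resp-↭ p = Unique-resp-↭ (setoid ℕ) (↭⇒↭ₛ p)

-- c x = just true demands that x be a landmark, c x = just false that it not be one.
demands : {A : Set} → (A → Maybe Bool) → List A → List (A × Bool)
demands c []       = []
demands c (x ∷ xs) with c x
... | just β  = (x , β) ∷ demands c xs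
... | nothing = demands c xs

demands-⁻ : {A : Set} (c : A → Maybe Bool) (xs : List A) → ∀ {x β} → (x , β) ∈ demands c xs → x ∈ xs × c x ≡ just β
demands-⁻ c (x ∷ xs) d with c x in eq
demands-⁻ c (x ∷ xs) (here refl) | just β  = here refl , eq
demands-⁻ c (x ∷ xs) (there d)   | just β  with y∈ , eq′ ← demands-⁻ c xs d = there y∈ , eq′
demands-⁻ c (x ∷ xs) d           | nothing with y∈ , eq′ ← demands-⁻ c xs d = there y∈ , eq′

demands-⁺ : {A : Set} (c : A → Maybe Bool) {xs : List A} → ∀ {x β} → x ∈ xs → c x ≡ just β → (x , β) ∈ demands c xs
demands-⁺ c {x ∷ xs} x∈ eq with c x in eq′
demands-⁺ c {x ∷ xs} (here refl) eq | just β  with refl ← trans (sym eq′) eq = here refl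
demands-⁺ c {x ∷ xs} (there x∈)  eq | just β  = there (demands-⁺ c x∈ eq)
demands-⁺ c {x ∷ xs} (here refl) eq | nothing with () ← trans (sym eq′) eq
demands-⁺ c {x ∷ xs} (there x∈)  eq | nothing = demands-⁺ c x∈ eq

demands-length : {A : Set} (c : A → Maybe Bool) {xs : List A} (ys : List A) → Unique xs →
                 (∀ {x β} → c x ≡ just β → x ∈ ys) → length (demands c xs) ≤ length ys
demands-length c {xs} ys u c⊆ys = allPairs-length (λ (x , _) y → x ≡ y) ys (keys xs u)
  λ {(x , β)} d → x , c⊆ys (proj₂ (demands-⁻ c xs d)) , refl
  where
  keys : ∀ xs → Unique xs → AllPairs (λ (x , _) (x′ , _) → ∀ y → x ≡ y → x′ ≡ y → ⊥) (demands c xs)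
  keys [] [] = []
  keys (x ∷ xs) (x# ∷ u) with c x
  ... | just β  = All.tabulate (λ { d _ refl refl → All.lookup x# (proj₁ (demands-⁻ c xs d)) refl }) ∷ keys xs u
  ... | nothing = keys xs u

demands-++ : {A : Set} (c : A → Maybe Bool) (xs ys : List A) → demands c (xs ++ ys) ≡ demands c xs ++ demands c ys
demands-++ c []       ys = refl
demands-++ c (x ∷ xs) ys with c x
... | just β  = cong ((x , β) ∷_) (demands-++ c xs ys)
... | nothing = demands-++ c xs ys

demands-≤ : {A : Set} (c : A → Maybe Bool) (xs : List A) → length (demands c xs) ≤ length xs
demands-≤ c []       = z≤n
demands-≤ c (x ∷ xs) with c x
... | just β  = s≤s (demands-≤ c xs)
... | nothing = m≤n⇒m≤1+n (demands-≤ c xs)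

-- The greedy kernel

-- same z x y tests whether z has the same distance to x as to y, and vs lists the vertices.

module Separation (same : ℕ → ℕ → ℕ → Bool) where

  separates : List ℕ → ℕ → ℕ → Bool
  separates B x y = any (λ z → not (same z x y)) B

  -- One element for each class of vertices in the list that have the same distances to all of `B`.
  representatives : List ℕ → List ℕ → List ℕ
  representatives B = foldr (λ x acc → if all (separates B x) acc then x ∷ acc else acc) []

module Greedy (same : ℕ → ℕ → ℕ → Bool) (vs : List ℕ) where

  open Separation same

  Parts : Set
  Parts = List ℕ × List ℕ

  -- A move by which `u` joins `P` and `z` joins `W`. Both must be new and distinct to keep the
  -- parts disjoint. Only pairs with `u` are tested, since growing `W` keeps the old pairs
  -- separated.
  extends : Parts → ℕ × ℕ → Bool
  extends (P , W) (z , u) =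
    not (member u (P ++ W)) ∧ not (member z (P ++ W)) ∧ not (z ≡ᵇ u) ∧ all (separates (z ∷ W) u) P

  pairs : List (ℕ × ℕ)
  pairs = concatMap (λ u → map (λ z → z , u) vs) vs

  extend : Parts → Parts
  extend st = foldr (λ (z , u) _ → u ∷ proj₁ st , z ∷ proj₂ st) st (filterᵇ (extends st) pairs)

  greedy : ℕ → Parts
  greedy = fold ([] , []) extend

  core : ℕ → List ℕ
  core k = proj₁ (greedy k) ++ proj₂ (greedy k)

  twinRepresentatives : ℕ → List ℕ
  twinRepresentatives k = representatives (core k) (vs ∖ core k)

  -- Something is cut off only if `twinRepresentatives k` has more than `k` elements, and then
  -- `accepts` holds for every `B`. In return the length bound `3k` is unconditional.
  kernel : ℕ → List ℕ
  kernel k = take (k + k + k) (core k ++ twinRepresentatives k)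

  candidates : ℕ → List ℕ → List ℕ
  candidates k B = kernel k ∖ B

  -- Vertices outside the kernel are landmarks for every `B`; the guess matters only inside the
  -- kernel.
  landmarks : ℕ → List ℕ → List ℕ
  landmarks k B = vs ∖ candidates k B

  -- The first two alternatives are solutions that do not depend on `B`. In the third, the
  -- representatives are as numerous as any separated set, so it suffices that the landmarks include
  -- enough separating vertices and the candidates include a solution.
  accepts : ℕ → List ℕ → Bool
  accepts k B = (k ≤ᵇ length (proj₁ (greedy k))) ∨ (k ≤ᵇ length (twinRepresentatives k)) ∨
                (k ≤ᵇ length (representatives (landmarks k B) (candidates k B)))

module Correctness
  {Δ : Set} (D : ℕ → ℕ → Δ) (same : ℕ → ℕ → ℕ → Bool) (vs : List ℕ)
  (same-sound : ∀ z x y → T (same z x y) → D z x ≡ D z y)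
  (same-complete : ∀ z x y → D z x ≡ D z y → T (same z x y))
  (D-sym : ∀ {x y} → x ∈ vs → y ∈ vs → D x y ≡ D y x)
  (vs-unique : Unique vs)
  where

  open Separation same
  open Greedy same vs

  Separates : List ℕ → ℕ → ℕ → Set
  Separates B x y = ∃[ z ] z ∈ B × D z x ≢ D z y

  separates-sound : ∀ B {x y} → T (separates B x y) → Separates B x y
  separates-sound B s with z , z∈B , d ← any-sound _ B s = z , z∈B , λ eq → T-not⁻ d (same-complete _ _ _ eq)

  separates-complete : ∀ {B x y} → Separates B x y → T (separates B x y)
  separates-complete (z , z∈B , d) = any-complete _ z∈B (T-not (d ∘ same-sound _ _ _))

  Separates-sym : ∀ {B x y} → Separates B x y → Separates B y x
  Separates-sym (z , z∈B , d) = z , z∈B , d ∘ sym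

  Separates-mono : ∀ {B C x y} → (∀ {z} → z ∈ B → z ∈ C) → Separates B x y → Separates C x y
  Separates-mono B⊆C (z , z∈B , d) = z , B⊆C z∈B , d

  separates? : ∀ B x y → Dec (Separates B x y)
  separates? B x y = map′ (separates-sound B) separates-complete (T? (separates B x y))

  agree : ∀ {B x y} → ¬ Separates B x y → ∀ {z} → z ∈ B → D z x ≡ D z y
  agree {B} {x} {y} ¬s {z} z∈B with T? (same z x y)
  ... | yes s = same-sound z x y s
  ... | no ¬e = contradiction (z , z∈B , λ eq → ¬e (same-complete _ _ _ eq)) ¬s

  representatives-⊆ : ∀ B xs {x} → x ∈ representatives B xs → x ∈ xs
  representatives-⊆ B (x ∷ xs) y∈ with all (separates B x) (representatives B xs)
  representatives-⊆ B (x ∷ xs) (here refl) | true  = here refl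
  representatives-⊆ B (x ∷ xs) (there y∈)  | true  = there (representatives-⊆ B xs y∈)
  representatives-⊆ B (x ∷ xs) y∈          | false = there (representatives-⊆ B xs y∈)

  representatives-separated : ∀ B xs → AllPairs (Separates B) (representatives B xs)
  representatives-separated B [] = []
  representatives-separated B (x ∷ xs) with all (separates B x) (representatives B xs) in eq
  ... | true  = All.map (separates-sound B) (All.all⁺ _ _ (Equivalence.from T-≡ eq)) ∷ representatives-separated B xs
  ... | false = representatives-separated B xs

  represented : ∀ B xs {x} → x ∈ xs → ∃[ y ] y ∈ representatives B xs × ¬ Separates B x y
  represented B (x ∷ xs) x∈ with all (separates B x) (representatives B xs) in eq
  represented B (x ∷ xs) (here refl) | true  = x , here refl , λ (_ , _ , d) → d refl
  represented B (x ∷ xs) (here refl) | false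
    with y , y∈ , ¬s ← ¬all⇒∃ _ (representatives B xs) (subst T eq) = y , y∈ , ¬s ∘ separates-complete
  represented B (x ∷ xs) (there x∈)  | true  with y , y∈ , ¬s ← represented B xs x∈ = y , there y∈ , ¬s
  represented B (x ∷ xs) (there x∈)  | false = represented B xs x∈

  -- Having equal distances to all of `B` is an equivalence relation. A separated list meets each
  -- class at most once, and the greedy list meets every class.
  representatives-longest : ∀ B xs {S} → AllPairs (Separates B) S → (∀ {x} → x ∈ S → x ∈ xs) →
                            length S ≤ length (representatives B xs)
  representatives-longest B xs {S} sep S⊆xs =
    allPairs-length (λ x y → ¬ Separates B x y) (representatives B xs)
      (AllPairs.map (λ (z , z∈B , d) y ¬s ¬s′ → d (trans (agree ¬s z∈B) (sym (agree ¬s′ z∈B)))) sep)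
      (λ x∈ → represented B xs (S⊆xs x∈))

  Savable : List ℕ → Set
  Savable S = (∀ {x} → x ∈ S → x ∈ vs) × Unique S ×
              (∀ {x y} → x ∈ S → y ∈ S → x ≢ y → ∃[ z ] z ∈ vs × z ∉ S × D z x ≢ D z y)

  savable : ∀ {B S} → AllPairs (Separates B) S → Disjoint S B →
            (∀ {x} → x ∈ S → x ∈ vs) → (∀ {x} → x ∈ B → x ∈ vs) → Savable S
  savable {B} {S} sep disjoint S⊆vs B⊆vs =
    S⊆vs , AllPairs.map (λ (_ , _ , d) → λ { refl → d refl }) sep , λ x∈ y∈ x≢y → pick x∈ y∈ x≢y
    where
    pick : ∀ {x y} → x ∈ S → y ∈ S → x ≢ y → ∃[ z ] z ∈ vs × z ∉ S × D z x ≢ D z y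
    pick x∈ y∈ x≢y with allPairs-lookup Separates-sym sep x∈ y∈
    ... | inj₁ x≡y            = contradiction x≡y x≢y
    ... | inj₂ (z , z∈B , d)  = z , B⊆vs z∈B , (λ z∈S → disjoint z∈S z∈B) , d

  savable-take : ∀ m {S} → Savable S → Savable (take m S)
  savable-take m {S} (S⊆vs , u , sep) = S⊆vs ∘ ∈-take m S , Unique.take⁺ m u , λ x∈ y∈ x≢y →
    let z , z∈vs , z∉S , d = sep (∈-take m S x∈) (∈-take m S y∈) x≢y in z , z∈vs , z∉S ∘ ∈-take m S , d

  -- Adding the elements of S one by one, each new element needs at most one
  -- new landmark, since it can only be confused with one previous element.
  few-landmarks : {P : ℕ → Set} → ∀ {S} → AllPairs (λ x y → ∃[ z ] P z × D z x ≢ D z y) S →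
                  ∃[ B ] All P B × length B ≤ length S × AllPairs (Separates B) S
  few-landmarks [] = [] , [] , z≤n , []
  few-landmarks {P} {x ∷ S} (x# ∷ S#) with B , pB , B≤S , sep ← few-landmarks S#
    with All.all? (separates? B x) S
  ... | yes all-sep = B , pB , m≤n⇒m≤1+n B≤S , all-sep ∷ sep
  ... | no ¬all-sep with y , y∈S , ¬s ← find (All.¬All⇒Any¬ (separates? B x) S ¬all-sep)
    with z , pz , d ← All.lookup x# y∈S =
    z ∷ B , pz ∷ pB , s≤s B≤S , All.tabulate new ∷ AllPairs.map (Separates-mono there) sep
    where
    new : ∀ {w} → w ∈ S → Separates (z ∷ B) x w
    new {w} w∈S with separates? B x w
    ... | yes s  = Separates-mono there s
    ... | no ¬s′ with allPairs-lookup Separates-sym sep y∈S w∈S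
    ...   | inj₁ refl           = z , here refl , d
    -- Both `y` and `w` agree with `x` on `B`, hence with each other, while `B` separates them by
    -- induction.
    ...   | inj₂ (b , b∈B , d′) = contradiction (trans (sym (agree ¬s b∈B)) (agree ¬s′ b∈B)) d′

  -- In the role of a landmark, y replaces its twin x.
  exchange : ∀ {x y S} → Savable (y ∷ S) → x ∈ vs → x ≢ y →
             (∀ {z} → z ∈ vs → z ≢ x → z ≢ y → D z x ≡ D z y) → Savable (x ∷ S)
  exchange {x} {y} {S} (S⊆vs , y# ∷ u , sep) x∈vs x≢y twin =
    S′⊆vs , All.tabulate (λ { a∈S refl → x∉S a∈S }) ∷ u , sep′
    where
    y∈vs : y ∈ vs
    y∈vs = S⊆vs (here refl)
    -- A landmark different from two twins cannot tell them apart, so they are not both in `y ∷ S`.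
    -- This is what keeps the size unchanged under the exchange.
    x∉S : x ∉ S
    x∉S x∈S with z , z∈ , z∉ , d ← sep (there x∈S) (here refl) x≢y =
      d (twin z∈ (λ { refl → z∉ (there x∈S) }) (λ { refl → z∉ (here refl) }))
    y∉S : y ∉ S
    y∉S y∈S = All.lookup y# y∈S refl
    S′⊆vs : ∀ {a} → a ∈ x ∷ S → a ∈ vs
    S′⊆vs (here refl) = x∈vs
    S′⊆vs (there a∈)  = S⊆vs (there a∈)
    y∉S′ : y ∉ x ∷ S
    y∉S′ (here y≡x)  = x≢y (sym y≡x)
    y∉S′ (there y∈S) = y∉S y∈S
    other : ∀ {a} → a ∈ S → D y a ≡ D x a
    other a∈ = trans (D-sym y∈vs (S⊆vs (there a∈))) (trans
      (sym (twin (S⊆vs (there a∈)) (λ { refl → x∉S a∈ }) (λ { refl → y∉S a∈ })))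
      (D-sym (S⊆vs (there a∈)) x∈vs))
    ∉S′ : ∀ {z} → z ≢ x → z ∉ y ∷ S → z ∉ x ∷ S
    ∉S′ z≢x z∉ (here z≡x)  = z≢x z≡x
    ∉S′ z≢x z∉ (there z∈S) = z∉ (there z∈S)
    sep-x : ∀ {b} → b ∈ S → ∃[ z ] z ∈ vs × z ∉ x ∷ S × D z x ≢ D z b
    sep-x {b} b∈ with z , z∈ , z∉ , d ← sep (here refl) (there b∈) (λ { refl → y∉S b∈ }) with z ≟ x
    -- The separator of `y` and `b` was `x` itself, which is now spared. It is replaced by `y`, as
    -- `D y x = D x y` and `D y b = D x b`.
    ... | yes refl = y , y∈vs , y∉S′ , λ eq → d (trans (D-sym x∈vs y∈vs) (trans eq (other b∈)))
    ... | no z≢x   = z , z∈ , ∉S′ z≢x z∉ , λ eq → d (trans (sym (twin z∈ z≢x (λ { refl → z∉ (here refl) }))) eq)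
    sep′ : ∀ {a b} → a ∈ x ∷ S → b ∈ x ∷ S → a ≢ b → ∃[ z ] z ∈ vs × z ∉ x ∷ S × D z a ≢ D z b
    sep′ (here refl) (here refl) a≢b = contradiction refl a≢b
    sep′ (here refl) (there b∈)  a≢b = sep-x b∈
    sep′ (there a∈)  (here refl) a≢b with z , z∈ , z∉ , d ← sep-x a∈ = z , z∈ , z∉ , d ∘ sym
    sep′ (there a∈)  (there b∈)  a≢b with z , z∈ , z∉ , d ← sep (there a∈) (there b∈) a≢b with z ≟ x
    ... | yes refl = y , y∈vs , y∉S′ , λ eq → d (trans (sym (other a∈)) (trans eq (other b∈)))
    ... | no z≢x   = z , z∈ , ∉S′ z≢x z∉ , d

  savable-resp-↭ : ∀ {S S′} → S ↭ S′ → Savable S → Savable S′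
  savable-resp-↭ {S} {S′} p (S⊆vs , u , sep) = (λ x∈ → S⊆vs (back x∈)) , unique-resp-↭ p u , λ x∈ y∈ x≢y →
    let z , z∈ , z∉ , d = sep (back x∈) (back y∈) x≢y in z , z∈ , (λ z∈S′ → z∉ (back z∈S′)) , d
    where
    back : ∀ {x} → x ∈ S′ → x ∈ S
    back = ∈-resp-↭ (↭-sym p)

  Stuck : Parts → Set
  Stuck st = ∀ {z u} → z ∈ vs → u ∈ vs → ¬ T (extends st (z , u))

  data Extension (st : Parts) : Parts → Set where
    stuck : Stuck st → Extension st st
    grow  : ∀ {z u} → z ∈ vs → u ∈ vs → T (extends st (z , u)) →
            Extension st (u ∷ proj₁ st , z ∷ proj₂ st)

  ∈-pairs⁺ : ∀ {z u} → z ∈ vs → u ∈ vs → (z , u) ∈ pairs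
  ∈-pairs⁺ {z} {u} z∈ u∈ = ∈-concat⁺′ (∈-map⁺ (_, u) z∈) (∈-map⁺ (λ u → map (_, u) vs) u∈)

  ∈-pairs⁻ : ∀ {z u} → (z , u) ∈ pairs → z ∈ vs × u ∈ vs
  ∈-pairs⁻ zu∈ with _ , zu∈xs , xs∈ ← ∈-concat⁻′ (map (λ u → map (_, u) vs) vs) zu∈
               with _ , u∈ , refl ← ∈-map⁻ _ xs∈
               with _ , z∈ , refl ← ∈-map⁻ _ zu∈xs = z∈ , u∈

  extension : ∀ st → Extension st (extend st)
  extension st with filterᵇ (extends st) pairs in eq
  ... | []     = stuck λ z∈ u∈ e →
        ∉[] (subst (_ ∈_) eq (∈-filterᵇ⁺ (∈-pairs⁺ z∈ u∈) e))
  ... | (z , u) ∷ _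
        with zu∈ , e ← ∈-filterᵇ⁻ (extends st) pairs (subst ((z , u) ∈_) (sym eq) (here refl))
        with z∈ , u∈ ← ∈-pairs⁻ zu∈ = grow z∈ u∈ e

  record Invariant (st : Parts) : Set where
    private
      P = proj₁ st
      W = proj₂ st
    field
      separated : AllPairs (Separates W) P
      disjoint  : Disjoint P W
      W-unique  : Unique W
      P⊆vs      : ∀ {x} → x ∈ P → x ∈ vs
      W⊆vs      : ∀ {x} → x ∈ W → x ∈ vs
      balanced  : length W ≡ length P

  extends-sound : ∀ {P W z u} → T (extends (P , W) (z , u)) →
                  u ∉ P ++ W × z ∉ P ++ W × z ≢ u × (∀ {p} → p ∈ P → Separates (z ∷ W) u p)
  extends-sound {P} {W} {z} {u} e
    with u∉ , e ← Equivalence.to T-∧ e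
    with z∉ , e ← Equivalence.to T-∧ e
    with z≢u , e ← Equivalence.to T-∧ e =
      T-not⁻ u∉ ∘ member-complete , T-not⁻ z∉ ∘ member-complete ,
      (λ { refl → T-not⁻ z≢u (≡⇒≡ᵇ z z refl) }) ,
      λ p∈ → separates-sound (z ∷ W) (All.lookup (All.all⁺ _ P e) p∈)

  extends-complete : ∀ {P W z u} → u ∉ P ++ W → z ∉ P ++ W → z ≢ u →
                     ¬ T (extends (P , W) (z , u)) → ∃[ p ] p ∈ P × ¬ Separates (z ∷ W) u p
  extends-complete {P} {W} {z} {u} u∉ z∉ z≢u ¬e
    with p , p∈ , ¬s ← ¬all⇒∃ (separates (z ∷ W) u) P (λ all-sep → ¬e
      (Equivalence.from T-∧ (T-not (u∉ ∘ member-sound (P ++ W)) ,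
       Equivalence.from T-∧ (T-not (z∉ ∘ member-sound (P ++ W)) ,
       Equivalence.from T-∧ (T-not (z≢u ∘ ≡ᵇ⇒≡ z u) , all-sep)))))
    = p , p∈ , ¬s ∘ separates-complete

  extension-invariant : ∀ {st st′} → Extension st st′ → Invariant st → Invariant st′
  extension-invariant (stuck _) inv = inv
  extension-invariant {P , W} (grow {z} {u} z∈ u∈ e) inv
    with u∉ , z∉ , z≢u , sep ← extends-sound {P} {W} e = record
    { separated = All.tabulate sep ∷ AllPairs.map (Separates-mono there) separated
    ; disjoint  = λ { (here refl) (here refl) → z≢u refl
                    ; (here refl) (there x∈W) → u∉ (∈-++⁺ʳ P x∈W)
                    ; (there x∈P) (here refl) → z∉ (∈-++⁺ˡ x∈P)
                    ; (there x∈P) (there x∈W) → disjoint x∈P x∈W }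
    ; W-unique  = All.tabulate (λ x∈W → λ { refl → z∉ (∈-++⁺ʳ P x∈W) }) ∷ W-unique
    ; P⊆vs      = λ { (here refl) → u∈ ; (there x∈) → P⊆vs x∈ }
    ; W⊆vs      = λ { (here refl) → z∈ ; (there x∈) → W⊆vs x∈ }
    ; balanced  = cong suc balanced
    }
    where open Invariant inv

  invariant : ∀ k → Invariant (greedy k)
  invariant zero    = record { separated = [] ; disjoint = λ () ; W-unique = [] ; P⊆vs = λ () ; W⊆vs = λ () ; balanced = refl }
  invariant (suc k) = extension-invariant (extension (greedy k)) (invariant k)

  -- A round without a move returns its state unchanged. So after `k` rounds either each of them has
  -- enlarged `P`, or the state is stuck for good.
  progress : ∀ k → length (proj₁ (greedy k)) ≡ k ⊎ Stuck (greedy k)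
  progress zero    = inj₁ refl
  progress (suc k) = go (extension (greedy k)) (progress k)
    where
    go : ∀ {st} → Extension (greedy k) st → length (proj₁ (greedy k)) ≡ k ⊎ Stuck (greedy k) →
         length (proj₁ st) ≡ suc k ⊎ Stuck st
    go (stuck s)       _           = inj₂ s
    go (grow _ _ _)    (inj₁ len)  = inj₁ (cong suc len)
    go (grow z∈ u∈ e)  (inj₂ s)    = contradiction e (s z∈ u∈)

  module _ (k : ℕ) where

    open Invariant (invariant k)

    private
      P = proj₁ (greedy k)
      W = proj₂ (greedy k)
      X = core k
      Q = twinRepresentatives k
      outside = vs ∖ X

    core-⊆ : ∀ {x} → x ∈ X → x ∈ vs
    core-⊆ x∈ = [ P⊆vs , W⊆vs ]′ (∈-++⁻ P x∈)

    Q-⊆ : ∀ {x} → x ∈ Q → x ∈ vs × x ∉ X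
    Q-⊆ x∈ = ∈-∖⁻ vs X (representatives-⊆ X outside x∈)

    kernel-⊆ : ∀ {x} → x ∈ kernel k → x ∈ vs
    kernel-⊆ x∈ = [ core-⊆ , proj₁ ∘ Q-⊆ ]′ (∈-++⁻ X (∈-take (k + k + k) (X ++ Q) x∈))

    kernel-unique : Unique (kernel k)
    kernel-unique = Unique.take⁺ (k + k + k)
      (Unique.++⁺ (Unique.++⁺ (proj₁ (proj₂ P-savable)) W-unique λ (x∈P , x∈W) → disjoint x∈P x∈W)
                  (AllPairs.map (λ (_ , _ , d) → λ { refl → d refl }) (representatives-separated X outside))
                  λ (x∈X , x∈Q) → proj₂ (Q-⊆ x∈Q) x∈X)
      where
      P-savable : Savable P
      P-savable = savable separated disjoint P⊆vs W⊆vs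

    accepts-sound : ∀ B → T (accepts k B) → ∃[ S ] Savable S × k ≤ length S
    accepts-sound B a =
      [ (λ k≤P → P , savable separated disjoint P⊆vs W⊆vs , ≤ᵇ⇒≤ k (length P) k≤P)
      , [ (λ k≤Q → Q , savable (representatives-separated X outside) (λ x∈Q → proj₂ (Q-⊆ x∈Q)) (proj₁ ∘ Q-⊆) core-⊆ ,
                   ≤ᵇ⇒≤ k (length Q) k≤Q)
        , (λ k≤ → representatives L C ,
                  savable (representatives-separated L C)
                    (λ x∈S x∈L → proj₂ (∈-∖⁻ vs C x∈L) (representatives-⊆ L C x∈S))
                    (λ x∈S → kernel-⊆ (proj₁ (∈-∖⁻ (kernel k) B (representatives-⊆ L C x∈S))))
                    (proj₁ ∘ ∈-∖⁻ vs C) ,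
                  ≤ᵇ⇒≤ k (length (representatives L C)) k≤)
        ]′ ∘ Equivalence.to (T-∨ {k ≤ᵇ length Q}) ]′ (Equivalence.to (T-∨ {k ≤ᵇ length P}) a)
      where
      C = candidates k B
      L = landmarks k B

    -- For `z` outside the core, being stuck yields `p` and `q` in `P` that `z ∷ W` fails to
    -- separate from `x` and from `y`. If `p = q`, then `z` has the same distance to `x`, to `p` and
    -- to `y`. Otherwise some `w` in `W` separates `p` from `q`; but `w` belongs to the core and so
    -- agrees on `x` and `y`, hence on `p` and `q`, a contradiction.
    twins : Stuck (greedy k) → ∀ {x y} → x ∈ vs → x ∉ X → y ∈ vs → y ∉ X → ¬ Separates X x y →
            ∀ {z} → z ∈ vs → z ≢ x → z ≢ y → D z x ≡ D z y
    twins s {x} {y} x∈ x∉ y∈ y∉ ¬sep {z} z∈ z≢x z≢y with ∈-dec z X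
    ... | yes z∈X = agree ¬sep z∈X
    ... | no z∉X
      with p , p∈ , ¬s ← extends-complete {P} {W} x∉ z∉X z≢x (s z∈ x∈)
      with q , q∈ , ¬t ← extends-complete {P} {W} y∉ z∉X z≢y (s z∈ y∈)
      with allPairs-lookup Separates-sym separated p∈ q∈
    ...   | inj₁ refl           = trans (agree ¬s (here refl)) (sym (agree ¬t (here refl)))
    ...   | inj₂ (w , w∈W , d)  = contradiction
            (trans (sym (agree ¬s (there w∈W))) (trans (agree ¬sep (∈-++⁺ʳ P w∈W)) (agree ¬t (there w∈W)))) d

    swap : Stuck (greedy k) → ∀ {y S} → Savable (y ∷ S) → y ∉ X → ∃[ x ] x ∈ Q × Savable (x ∷ S)
    swap s {y} sv y∉X
      with y∈vs ← proj₁ sv (here refl)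
      with x , x∈Q , ¬sep ← represented X outside (∈-∖⁺ X y∈vs y∉X)
      with x ≟ y
    ... | yes refl = x , x∈Q , sv
    ... | no x≢y   = x , x∈Q , exchange sv (proj₁ (Q-⊆ x∈Q)) x≢y
      (twins s (proj₁ (Q-⊆ x∈Q)) (proj₂ (Q-⊆ x∈Q)) y∈vs y∉X (λ sep → ¬sep (Separates-sym sep)))

    -- `S₀` collects the elements that are already in place. A permutation moves each treated
    -- element there, because the exchange acts on the first element of a list.
    swap-all : Stuck (greedy k) → ∀ S S₀ → (∀ {x} → x ∈ S₀ → x ∈ X ++ Q) → Savable (S ++ S₀) →
               ∃[ S′ ] (∀ {x} → x ∈ S′ → x ∈ X ++ Q) × Savable S′ × length S′ ≡ length S + length S₀
    swap-all s []      S₀ S₀⊆ sv = S₀ , S₀⊆ , sv , refl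
    swap-all s (y ∷ S) S₀ S₀⊆ sv with ∈-dec y X
    ... | yes y∈X with S′ , S′⊆ , sv′ , len ← swap-all s S (y ∷ S₀)
                         (λ { (here refl) → ∈-++⁺ˡ y∈X ; (there x∈) → S₀⊆ x∈ })
                         (savable-resp-↭ (↭-sym (shift y S S₀)) sv) =
          S′ , S′⊆ , sv′ , trans len (+-suc (length S) (length S₀))
    ... | no y∉X with x , x∈Q , sv₁ ← swap s sv y∉X
                 with S′ , S′⊆ , sv′ , len ← swap-all s S (x ∷ S₀)
                        (λ { (here refl) → ∈-++⁺ʳ X x∈Q ; (there x∈) → S₀⊆ x∈ })
                        (savable-resp-↭ (↭-sym (shift x S S₀)) sv₁) =
          S′ , S′⊆ , sv′ , trans len (+-suc (length S) (length S₀))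

    savable-in-kernel : ¬ k ≤ length P → ¬ k ≤ length Q → ∀ {S} → Savable S →
                        ∃[ S′ ] (∀ {x} → x ∈ S′ → x ∈ kernel k) × Savable S′ × length S′ ≡ length S
    savable-in-kernel ¬P ¬Q {S} sv with progress k
    ... | inj₁ len = contradiction (≤-reflexive (sym len)) ¬P
    ... | inj₂ s   with S′ , S′⊆ , sv′ , len ← swap-all s S [] (λ ())
                          (subst Savable (sym (List.++-identityʳ S)) sv) =
      S′ , (λ x∈ → subst (_ ∈_) (sym (List.take-all (k + k + k) (X ++ Q) short)) (S′⊆ x∈)) ,
      sv′ , trans len (+-identityʳ _)
      where
      short : length (X ++ Q) ≤ k + k + k
      short = begin
        length (X ++ Q)                 ≡⟨ List.length-++ X ⟩
        length X + length Q             ≡⟨ cong (_+ length Q) (List.length-++ P) ⟩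
        length P + length W + length Q  ≡⟨ cong (λ w → length P + w + length Q) balanced ⟩
        length P + length P + length Q  ≤⟨ +-mono-≤ (+-mono-≤ (≰⇒≥ ¬P) (≰⇒≥ ¬P)) (≰⇒≥ ¬Q) ⟩
        k + k + k                       ∎
        where open ≤-Reasoning

    Meets : (ℕ → Maybe Bool) → List ℕ → Set
    Meets c B = ∀ {x β} → (x , β) ∈ demands c (kernel k) → member x B ≡ β

    -- The demands are `false` on the `k` elements of `S` and `true` on the at most `k` landmarks
    -- that separate `S`. Those of the latter that lie outside the kernel are in `landmarks k B`
    -- anyway, so only the demands inside the kernel have to be met.
    accepts-kernel : ∀ S → (∀ {x} → x ∈ S → x ∈ kernel k) → Savable S → length S ≡ k →
                     ∃[ c ] length (demands c (kernel k)) ≤ k + k ×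
                            (∀ B → Meets c B → k ≤ length (representatives (landmarks k B) (candidates k B)))
    accepts-kernel S S⊆ (S⊆vs , u , sep) len
      with B₀ , pB₀ , B₀≤S , sepB₀ ← few-landmarks
             (unique⇒allPairs {R = λ x y → ∃[ z ] (z ∈ vs × z ∉ S) × D z x ≢ D z y} u
               λ x∈ y∈ x≢y → let z , z∈ , z∉ , d = sep x∈ y∈ x≢y in z , (z∈ , z∉) , d)
      = c , few , enough
      where
      c : ℕ → Maybe Bool
      c x = if member x S then just false else if member x B₀ then just true else nothing
      c-S : ∀ {x} → x ∈ S → c x ≡ just false
      c-S {x} x∈ with member x S in eq
      ... | true  = refl
      ... | false = ⊥-elim (subst T eq (member-complete x∈))
      c-B₀ : ∀ {x} → x ∈ B₀ → c x ≡ just true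
      c-B₀ {x} x∈ with member x S in eq
      ... | true  = contradiction (member-sound S (Equivalence.from T-≡ eq)) (proj₂ (All.lookup pB₀ x∈))
      ... | false with member x B₀ in eq′
      ...   | true  = refl
      ...   | false = ⊥-elim (subst T eq′ (member-complete x∈))
      c⊆ : ∀ {x β} → c x ≡ just β → x ∈ S ++ B₀
      c⊆ {x} eq with member x S in eq₁
      ... | true  = ∈-++⁺ˡ (member-sound S (Equivalence.from T-≡ eq₁))
      ... | false with member x B₀ in eq₂
      ...   | true  = ∈-++⁺ʳ S (member-sound B₀ (Equivalence.from T-≡ eq₂))
      c⊆ {x} () | false | false
      few : length (demands c (kernel k)) ≤ k + k
      few = begin
        length (demands c (kernel k))  ≤⟨ demands-length c (S ++ B₀) kernel-unique c⊆ ⟩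
        length (S ++ B₀)               ≡⟨ List.length-++ S ⟩
        length S + length B₀           ≤⟨ +-monoʳ-≤ (length S) B₀≤S ⟩
        length S + length S            ≡⟨ cong₂ _+_ len len ⟩
        k + k                          ∎
        where open ≤-Reasoning
      enough : ∀ B → Meets c B → k ≤ length (representatives (landmarks k B) (candidates k B))
      enough B meets = ≤-trans (≤-reflexive (sym len))
        (representatives-longest (landmarks k B) (candidates k B) (AllPairs.map (Separates-mono B₀⊆) sepB₀) S⊆C)
        where
        S⊆C : ∀ {x} → x ∈ S → x ∈ candidates k B
        S⊆C x∈ = ∈-∖⁺ B (S⊆ x∈) λ x∈B → subst T (meets (demands-⁺ c (S⊆ x∈) (c-S x∈))) (member-complete x∈B)
        B₀⊆ : ∀ {z} → z ∈ B₀ → z ∈ landmarks k B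
        B₀⊆ z∈ = ∈-∖⁺ (candidates k B) (proj₁ (All.lookup pB₀ z∈)) λ z∈C →
          let z∈R , z∉B = ∈-∖⁻ (kernel k) B z∈C in
          z∉B (member-sound B (Equivalence.from T-≡ (meets (demands-⁺ c z∈R (c-B₀ z∈)))))

    accepts-complete : ∀ S → Savable S → k ≤ length S →
                       ∃[ c ] length (demands c (kernel k)) ≤ k + k × (∀ B → Meets c B → T (accepts k B))
    accepts-complete S sv k≤S = go (k ≤? length P) (k ≤? length Q)
      where
      accept₁ : ∀ {b} → T (k ≤ᵇ length P) ⊎ T b → T ((k ≤ᵇ length P) ∨ b)
      accept₁ = Equivalence.from (T-∨ {k ≤ᵇ length P})
      accept₂ : ∀ {b} → T (k ≤ᵇ length Q) ⊎ T b → T ((k ≤ᵇ length Q) ∨ b)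
      accept₂ = Equivalence.from (T-∨ {k ≤ᵇ length Q})
      none : length (demands (λ _ → nothing) (kernel k)) ≤ k + k
      none = ≤-trans (demands-length (λ _ → nothing) [] kernel-unique λ ()) z≤n
      go : Dec (k ≤ length P) → Dec (k ≤ length Q) →
           ∃[ c ] length (demands c (kernel k)) ≤ k + k × (∀ B → Meets c B → T (accepts k B))
      -- Acceptance does not depend on `B` in the first two cases, so nothing is demanded of it.
      go (yes k≤P) _         = (λ _ → nothing) , none , λ _ _ → accept₁ (inj₁ (≤⇒≤ᵇ k≤P))
      go (no _)    (yes k≤Q) = (λ _ → nothing) , none , λ _ _ →
        accept₁ (inj₂ (accept₂ (inj₁ (≤⇒≤ᵇ k≤Q))))
      go (no k≰P)  (no k≰Q) =
        let S′ , S′⊆ , sv′ , len = savable-in-kernel k≰P k≰Q (savable-take k sv)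
            c , few , enough = accepts-kernel S′ S′⊆ sv′ (trans len (trans (List.length-take k S) (m≤n⇒m⊓n≡m k≤S)))
        in c , few , λ B meets → accept₁ (inj₂ (accept₂ (inj₂ (≤⇒≤ᵇ (enough B meets)))))

-- Universal families

count : {A : Set} → (A → Bool) → List A → ℕ
count p xs = length (filterᵇ p xs)

bit : Bool → ℕ
bit b = if b then 1 else 0

count-∷ : {A : Set} (p : A → Bool) (x : A) (xs : List A) → count p (x ∷ xs) ≡ bit (p x) + count p xs
count-∷ p x xs with p x
... | true  = refl
... | false = refl

count-++ : {A : Set} (p : A → Bool) (xs ys : List A) → count p (xs ++ ys) ≡ count p xs + count p ys
count-++ p []       ys = refl
count-++ p (x ∷ xs) ys rewrite count-∷ p x (xs ++ ys) | count-∷ p x xs | count-++ p xs ys =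
  sym (+-assoc (bit (p x)) _ _)

count-map : {A B : Set} (p : B → Bool) (f : A → B) (xs : List A) → count p (map f xs) ≡ count (p ∘ f) xs
count-map p f []       = refl
count-map p f (x ∷ xs) rewrite count-∷ p (f x) (map f xs) | count-∷ (p ∘ f) x xs = cong (_ +_) (count-map p f xs)

count-cong : {A : Set} {p q : A → Bool} (xs : List A) → (∀ {x} → x ∈ xs → p x ≡ q x) → count p xs ≡ count q xs
count-cong []       p≗q = refl
count-cong {p = p} {q} (x ∷ xs) p≗q rewrite count-∷ p x xs | count-∷ q x xs =
  cong₂ (λ b n → bit b + n) (p≗q (here refl)) (count-cong xs (p≗q ∘ there))

count-none : {A : Set} (xs : List A) → count (λ _ → false) xs ≡ 0
count-none []       = refl
count-none (x ∷ xs) = count-none xs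

count-not : {A : Set} (p : A → Bool) (xs : List A) → count (not ∘ p) xs + count p xs ≡ length xs
count-not p [] = refl
count-not p (x ∷ xs) with p x
... | true  = trans (+-suc _ _) (cong suc (count-not p xs))
... | false = cong suc (count-not p xs)

total : {A : Set} → (A → ℕ) → List A → ℕ
total f []       = 0
total f (x ∷ xs) = f x + total f xs

total-+ : {A : Set} (f g : A → ℕ) (xs : List A) → total (λ x → f x + g x) xs ≡ total f xs + total g xs
total-+ f g []       = refl
total-+ f g (x ∷ xs) rewrite total-+ f g xs = lemma (f x) (g x) (total f xs) (total g xs)
  where
  lemma : ∀ a b c d → a + b + (c + d) ≡ a + c + (b + d)
  lemma = solve-∀

total-cong : {A : Set} {f g : A → ℕ} (xs : List A) → (∀ x → f x ≡ g x) → total f xs ≡ total g xs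
total-cong []       f≗g = refl
total-cong (x ∷ xs) f≗g = cong₂ _+_ (f≗g x) (total-cong xs f≗g)

total-bit : {A : Set} (p : A → Bool) (xs : List A) → total (bit ∘ p) xs ≡ count p xs
total-bit p []       = refl
total-bit p (x ∷ xs) = trans (cong (bit (p x) +_) (total-bit p xs)) (sym (count-∷ p x xs))

total-≤ : {A : Set} (f : A → ℕ) (xs : List A) {m : ℕ} → (∀ {x} → x ∈ xs → f x ≤ m) → total f xs ≤ length xs * m
total-≤ f []       f≤ = z≤n
total-≤ f (x ∷ xs) f≤ = +-mono-≤ (f≤ (here refl)) (total-≤ f xs (f≤ ∘ there))

total-≥ : {A : Set} (f : A → ℕ) (xs : List A) {m : ℕ} → (∀ {x} → x ∈ xs → m ≤ f x) → length xs * m ≤ total f xs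
total-≥ f []       f≥ = z≤n
total-≥ f (x ∷ xs) f≥ = +-mono-≤ (f≥ (here refl)) (total-≥ f xs (f≥ ∘ there))

total-*ˡ : {A : Set} (c : ℕ) (f : A → ℕ) (xs : List A) → total (λ x → c * f x) xs ≡ c * total f xs
total-*ˡ c f []       = sym (*-zeroʳ c)
total-*ˡ c f (x ∷ xs) = trans (cong (c * f x +_) (total-*ˡ c f xs)) (sym (*-distribˡ-+ c (f x) _))

total-++ : {A : Set} (f : A → ℕ) (xs ys : List A) → total f (xs ++ ys) ≡ total f xs + total f ys
total-++ f []       ys = refl
total-++ f (x ∷ xs) ys = trans (cong (f x +_) (total-++ f xs ys)) (sym (+-assoc (f x) _ _))

total-concat : {A : Set} (f : A → ℕ) (xss : List (List A)) → total f (concat xss) ≡ total (total f) xss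
total-concat f []         = refl
total-concat f (xs ∷ xss) = trans (total-++ f xs (concat xss)) (cong (total f xs +_) (total-concat f xss))

total-map : {A B : Set} (f : B → ℕ) (g : A → B) (xs : List A) → total f (map g xs) ≡ total (f ∘ g) xs
total-map f g []       = refl
total-map f g (x ∷ xs) = cong (f (g x) +_) (total-map f g xs)

double-counting : {A B : Set} (r : A → B → Bool) (xs : List A) (ys : List B) →
                  total (λ x → count (r x) ys) xs ≡ total (λ y → count (λ x → r x y) xs) ys
double-counting r [] ys = sym (zeros ys)
  where
  zeros : ∀ ys → total (λ _ → 0) ys ≡ 0
  zeros []       = refl
  zeros (y ∷ ys) = zeros ys
double-counting r (x ∷ xs) ys = begin
  count (r x) ys + total (λ x → count (r x) ys) xs
    ≡⟨ cong₂ _+_ (sym (total-bit (r x) ys)) (double-counting r xs ys) ⟩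
  total (λ y → bit (r x y)) ys + total (λ y → count (λ x → r x y) xs) ys
    ≡⟨ total-+ _ _ ys ⟨
  total (λ y → bit (r x y) + count (λ x → r x y) xs) ys
    ≡⟨ total-cong ys (λ y → count-∷ (λ x → r x y) x xs) ⟨
  total (λ y → count (λ x → r x y) (x ∷ xs)) ys ∎
  where open ≡-Reasoning

Assignment : Set
Assignment = List (ℕ × Bool)

sublists : List ℕ → List (List ℕ)
sublists = foldr (λ x acc → acc ++ map (x ∷_) acc) ([] ∷ [])

assignments : List ℕ → List Assignment
assignments = foldr (λ x acc → acc ++ (map ((x , true) ∷_) acc ++ map ((x , false) ∷_) acc)) ([] ∷ [])

compatible : List ℕ → Assignment → Bool
compatible v = all (λ (x , β) → not (member x v xor β))

-- Greedily chosen subsets of blk, such that each partial assignment of size at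
-- most b is compatible with one of them.

module Family (blk : List ℕ) (b : ℕ) where

  constraints : List Assignment
  constraints = filterᵇ (λ τ → length τ ≤ᵇ b) (assignments blk)

  hits : List Assignment → List ℕ → ℕ
  hits τs v = count (compatible v) τs

  best : List Assignment → List ℕ
  best τs = foldr (λ v w → if hits τs w ≤ᵇ hits τs v then v else w) [] (sublists blk)

  best-∈ : ∀ τs ws → foldr (λ v w → if hits τs w ≤ᵇ hits τs v then v else w) [] ws ∈ [] ∷ ws
  best-∈ τs []       = here refl
  best-∈ τs (w ∷ ws) with hits τs (foldr (λ v w → if hits τs w ≤ᵇ hits τs v then v else w) [] ws) ≤ᵇ hits τs w
  ... | true  = there (here refl)
  ... | false with best-∈ τs ws
  ...   | here eq = here eq
  ...   | there m = there (there m)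

  -- Nothing is added once all constraints are met, so the family stays short however many rounds
  -- are run.
  choose : List Assignment × List (List ℕ) → List Assignment × List (List ℕ)
  choose (τs , vs) = if null τs then (τs , vs)
                     else (filterᵇ (λ τ → not (compatible (best τs) τ)) τs , best τs ∷ vs)

  chosen : ℕ → List Assignment × List (List ℕ)
  chosen = fold (constraints , []) choose

  -- Each round disposes of at least one remaining constraint, hence this many rounds leave none.
  -- The sharper bound on the length of the family is a matter of the analysis only.
  family : List (List ℕ)
  family = proj₂ (chosen (length constraints))

length-sublists : ∀ xs → length (sublists xs) ≡ 2 ^ length xs
length-sublists []       = refl
length-sublists (x ∷ xs) = trans (List.length-++ (sublists xs)) (cong₂ _+_ (length-sublists xs)
  (trans (List.length-map (x ∷_) (sublists xs)) (trans (length-sublists xs) (sym (+-identityʳ _)))))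

length-assignments : ∀ xs → length (assignments xs) ≤ 2 ^ (length xs + length xs)
length-assignments []       = ≤-refl
length-assignments (x ∷ xs) = begin
  length (a ++ (t ++ f))           ≡⟨ List.length-++ a ⟩
  length a + length (t ++ f)       ≡⟨ cong (length a +_) (List.length-++ t) ⟩
  length a + (length t + length f) ≡⟨ cong₂ (λ m n → length a + (m + n)) (List.length-map _ a) (List.length-map _ a) ⟩
  length a + (length a + length a) ≤⟨ m≤n+m _ (length a) ⟩
  length a + (length a + (length a + length a)) ≡⟨ lemma (length a) ⟩
  4 * length a                     ≤⟨ *-monoʳ-≤ 4 (length-assignments xs) ⟩
  4 * 2 ^ (ℓ + ℓ)                  ≡⟨ *-assoc 2 2 (2 ^ (ℓ + ℓ)) ⟩
  2 ^ suc (suc ℓ + ℓ)              ≡⟨ cong (λ m → 2 ^ suc m) (+-suc ℓ ℓ) ⟨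
  2 ^ (suc ℓ + suc ℓ)              ∎
  where
  open ≤-Reasoning
  ℓ = length xs
  a = assignments xs
  t = map ((x , true) ∷_) a
  f = map ((x , false) ∷_) a
  lemma : ∀ m → m + (m + (m + m)) ≡ 4 * m
  lemma = solve-∀

∈-sublists : ∀ xs {v y} → v ∈ sublists xs → y ∈ v → y ∈ xs
∈-sublists []       (here refl) ()
∈-sublists (x ∷ xs) v∈ y∈ with ∈-++⁻ (sublists xs) v∈
... | inj₁ v∈ˡ = there (∈-sublists xs v∈ˡ y∈)
... | inj₂ v∈ʳ with w , w∈ , refl ← ∈-map⁻ (x ∷_) v∈ʳ with y∈
...   | here refl = here refl
...   | there y∈w = there (∈-sublists xs w∈ y∈w)

-- Keeps the demands in the order of the block with at most one for each position, which allows
-- induction along the block.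
data AssignmentOf : List ℕ → Assignment → Set where
  []   : AssignmentOf [] []
  skip : ∀ {x xs τ} → AssignmentOf xs τ → AssignmentOf (x ∷ xs) τ
  _∷_  : ∀ {x xs τ} β → AssignmentOf xs τ → AssignmentOf (x ∷ xs) ((x , β) ∷ τ)

assignment-of : ∀ xs {τ} → τ ∈ assignments xs → AssignmentOf xs τ
assignment-of []       (here refl) = []
assignment-of (x ∷ xs) τ∈ with ∈-++⁻ (assignments xs) τ∈
... | inj₁ τ∈₁ = skip (assignment-of xs τ∈₁)
... | inj₂ τ∈₂ with ∈-++⁻ (map ((x , true) ∷_) (assignments xs)) τ∈₂
...   | inj₁ τ∈₃ with σ , σ∈ , refl ← ∈-map⁻ _ τ∈₃ = true ∷ assignment-of xs σ∈
...   | inj₂ τ∈₃ with σ , σ∈ , refl ← ∈-map⁻ _ τ∈₃ = false ∷ assignment-of xs σ∈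

demands-assignment : (c : ℕ → Maybe Bool) (xs : List ℕ) → demands c xs ∈ assignments xs
demands-assignment c []       = here refl
demands-assignment c (x ∷ xs) with c x
... | nothing    = ∈-++⁺ˡ (demands-assignment c xs)
... | just true  = ∈-++⁺ʳ (assignments xs) (∈-++⁺ˡ (∈-map⁺ _ (demands-assignment c xs)))
... | just false = ∈-++⁺ʳ (assignments xs)
                     (∈-++⁺ʳ (map ((x , true) ∷_) (assignments xs)) (∈-map⁺ _ (demands-assignment c xs)))

compatible-sound : ∀ {v τ x β} → T (compatible v τ) → (x , β) ∈ τ → member x v ≡ β
compatible-sound {v} {τ} {x} {β} c x∈ = xnor (member x v) β (All.lookup (All.all⁺ _ τ c) x∈)
  where
  xnor : ∀ a b → T (not (a xor b)) → a ≡ b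
  xnor true  true  _ = refl
  xnor false false _ = refl

∉⇒¬member : ∀ {x v} → x ∉ v → member x v ≡ false
∉⇒¬member {x} {v} x∉v with member x v in eq
... | true  = contradiction (member-sound v (Equivalence.from T-≡ eq)) x∉v
... | false = refl

member-here : ∀ x v → member x (x ∷ v) ≡ true
member-here x v = Equivalence.to T-≡ (member-complete {x} {x ∷ v} (here refl))

member-there : ∀ {x y} v → y ≢ x → member y (x ∷ v) ≡ member y v
member-there {x} {y} v y≢x with y ≡ᵇ x in eq
... | true  = contradiction (≡ᵇ⇒≡ y x (Equivalence.from T-≡ eq)) y≢x
... | false = refl

compatible-∷ : ∀ {x xs} v {τ} → x ∉ xs → AssignmentOf xs τ → compatible (x ∷ v) τ ≡ compatible v τ
compatible-∷ v x∉xs []       = refl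
compatible-∷ v x∉xs (skip a) = compatible-∷ v (x∉xs ∘ there) a
compatible-∷ {x} v {(y , _) ∷ _} x∉xs (β ∷ a) = cong₂ (λ m c → not (m xor β) ∧ c)
  (member-there {x} {y} v (λ { refl → x∉xs (here refl) })) (compatible-∷ v (x∉xs ∘ there) a)

-- A random subset is compatible with τ with probability 2^-|τ|.
compatible-count : ∀ {xs τ} → Unique xs → AssignmentOf xs τ →
                   2 ^ length τ * count (λ v → compatible v τ) (sublists xs) ≡ 2 ^ length xs
compatible-count [] [] = refl
compatible-count {x ∷ xs} {τ} (x# ∷ u) (skip a) = begin
  2 ^ length τ * count p (sublists (x ∷ xs))
    ≡⟨ cong (2 ^ length τ *_) (trans (count-++ p (sublists xs) _) (cong (count p (sublists xs) +_) (trans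
         (count-map p (x ∷_) (sublists xs))
         (count-cong (sublists xs) λ {v} _ → compatible-∷ v (λ x∈ → All.lookup x# x∈ refl) a)))) ⟩
  2 ^ length τ * (count p (sublists xs) + count p (sublists xs))
    ≡⟨ lemma (2 ^ length τ) (count p (sublists xs)) ⟩
  2 * (2 ^ length τ * count p (sublists xs))
    ≡⟨ cong (2 *_) (compatible-count u a) ⟩
  2 ^ suc (length xs) ∎
  where
  open ≡-Reasoning
  p : List ℕ → Bool
  p v = compatible v τ
  lemma : ∀ m n → m * (n + n) ≡ 2 * (m * n)
  lemma = solve-∀
compatible-count {x ∷ xs} {(x , β) ∷ τ} (x# ∷ u) (β ∷ a) = begin
  2 * 2 ^ length τ * count p (sublists (x ∷ xs))
    ≡⟨ cong (2 * 2 ^ length τ *_) (trans (count-++ p (sublists xs) _) (cong₂ _+_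
         (count-cong (sublists xs) λ {v} v∈ → cong (λ m → not (m xor β) ∧ compatible v τ)
            (∉⇒¬member (λ x∈v → All.lookup x# (∈-sublists xs v∈ x∈v) refl)))
         (trans (count-map p (x ∷_) (sublists xs))
                (count-cong (sublists xs) λ {v} _ → cong₂ (λ m c → not (m xor β) ∧ c) (member-here x v)
                   (compatible-∷ v (λ x∈ → All.lookup x# x∈ refl) a))))) ⟩
  2 * 2 ^ length τ * (count (λ v → not (false xor β) ∧ q v) (sublists xs) +
                      count (λ v → not (true xor β) ∧ q v) (sublists xs))
    -- The demand on `x` is met by the sublists with `x` or by those without it, never by both. So
    -- one of the two counts vanishes, which is the factor 2.
    ≡⟨ cong (2 * 2 ^ length τ *_) (one-sided β) ⟩
  2 * 2 ^ length τ * count q (sublists xs)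
    ≡⟨ *-assoc 2 (2 ^ length τ) _ ⟩
  2 * (2 ^ length τ * count q (sublists xs))
    ≡⟨ cong (2 *_) (compatible-count u a) ⟩
  2 ^ suc (length xs) ∎
  where
  open ≡-Reasoning
  p : List ℕ → Bool
  p v = compatible v ((x , β) ∷ τ)
  q : List ℕ → Bool
  q v = compatible v τ
  one-sided : ∀ β → count (λ v → not (false xor β) ∧ q v) (sublists xs) +
                    count (λ v → not (true xor β) ∧ q v) (sublists xs) ≡ count q (sublists xs)
  one-sided true  = cong (_+ count q (sublists xs)) (count-none (sublists xs))
  one-sided false = trans (cong (count q (sublists xs) +_) (count-none (sublists xs))) (+-identityʳ _)

module FamilyProperties (blk : List ℕ) (b : ℕ) (blk-unique : Unique blk) where

  open Family blk b

  argmax : ∀ (τs : List Assignment) ws {v} → v ∈ ws →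
           hits τs v ≤ hits τs (foldr (λ v w → if hits τs w ≤ᵇ hits τs v then v else w) [] ws)
  argmax τs (w ∷ ws) v∈ with hits τs (foldr (λ v w → if hits τs w ≤ᵇ hits τs v then v else w) [] ws) ≤ᵇ hits τs w in eq
  argmax τs (w ∷ ws) (here refl) | true  = ≤-refl
  argmax τs (w ∷ ws) (there v∈)  | true  = ≤-trans (argmax τs ws v∈) (≤ᵇ⇒≤ _ _ (Equivalence.from T-≡ eq))
  argmax τs (w ∷ ws) (here refl) | false = ≰⇒≥ λ le → subst T eq (≤⇒≤ᵇ le)
  argmax τs (w ∷ ws) (there v∈)  | false = argmax τs ws v∈

  -- Averaging: every constraint is compatible with at least a fraction `2^-b` of all sublists. By
  -- double counting an average sublist is compatible with at least this fraction of `τs`, and the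
  -- best one is no worse than average. The number of sublists cancels.
  best-hits : ∀ τs → (∀ {τ} → τ ∈ τs → τ ∈ constraints) → length τs ≤ 2 ^ b * hits τs (best τs)
  best-hits τs τs⊆ = *-cancelˡ-≤ (2 ^ length blk) (begin
    2 ^ length blk * length τs
      ≡⟨ *-comm (2 ^ length blk) _ ⟩
    length τs * 2 ^ length blk
      ≤⟨ total-≥ (λ τ → 2 ^ b * count (λ v → compatible v τ) V) τs many ⟩
    total (λ τ → 2 ^ b * count (λ v → compatible v τ) V) τs
      ≡⟨ total-*ˡ (2 ^ b) _ τs ⟩
    2 ^ b * total (λ τ → count (λ v → compatible v τ) V) τs
      ≡⟨ cong (2 ^ b *_) (double-counting compatible V τs) ⟨
    2 ^ b * total (hits τs) V
      ≤⟨ *-monoʳ-≤ (2 ^ b) (total-≤ (hits τs) V (argmax τs V)) ⟩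
    2 ^ b * (length V * hits τs (best τs))
      ≡⟨ cong (λ m → 2 ^ b * (m * hits τs (best τs))) (length-sublists blk) ⟩
    2 ^ b * (2 ^ length blk * hits τs (best τs))
      ≡⟨ lemma (2 ^ b) (2 ^ length blk) _ ⟩
    2 ^ length blk * (2 ^ b * hits τs (best τs)) ∎)
    where
    open ≤-Reasoning
    V = sublists blk
    instance
      2^≢0 : NonZero (2 ^ length blk)
      2^≢0 = m^n≢0 2 (length blk)
    lemma : ∀ x y z → x * (y * z) ≡ y * (x * z)
    lemma = solve-∀
    many : ∀ {τ} → τ ∈ τs → 2 ^ length blk ≤ 2 ^ b * count (λ v → compatible v τ) V
    many {τ} τ∈ with τ∈a , τ≤b ← ∈-filterᵇ⁻ (λ τ → length τ ≤ᵇ b) (assignments blk) (τs⊆ τ∈) =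
      subst (_≤ 2 ^ b * count (λ v → compatible v τ) V) (compatible-count blk-unique (assignment-of blk τ∈a))
            (*-monoˡ-≤ (count (λ v → compatible v τ) V) (^-monoʳ-≤ 2 (≤ᵇ⇒≤ (length τ) b τ≤b)))

  private
    left : ℕ → List Assignment
    left i = proj₁ (chosen i)

    picked : ℕ → List (List ℕ)
    picked i = proj₂ (chosen i)

  choose-⊆ : ∀ st {τ} → τ ∈ proj₁ (choose st) → τ ∈ proj₁ st
  choose-⊆ ([] , vs)           τ∈ = τ∈
  choose-⊆ (τs@(_ ∷ _) , vs) τ∈ = proj₁ (∈-filterᵇ⁻ (λ τ → not (compatible (best τs) τ)) τs τ∈)

  left-⊆ : ∀ i {τ} → τ ∈ left i → τ ∈ constraints
  left-⊆ zero    τ∈ = τ∈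
  left-⊆ (suc i) τ∈ = left-⊆ i (choose-⊆ (chosen i) τ∈)

  -- The number of unmet constraints shrinks by the factor `1 - 2^-b`, written without subtraction
  -- and multiplied by `2 ^ b`.
  choose-shrinks : ∀ st → (∀ {τ} → τ ∈ proj₁ st → τ ∈ constraints) →
                   2 ^ b * length (proj₁ (choose st)) + length (proj₁ st) ≤ 2 ^ b * length (proj₁ st)
  choose-shrinks ([] , vs)           _   = ≤-reflexive (+-identityʳ _)
  choose-shrinks (τs@(_ ∷ _) , vs) τs⊆ = begin
    2 ^ b * m + length τs                  ≤⟨ +-monoʳ-≤ (2 ^ b * m) (best-hits τs τs⊆) ⟩
    2 ^ b * m + 2 ^ b * hits τs (best τs)  ≡⟨ *-distribˡ-+ (2 ^ b) m _ ⟨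
    2 ^ b * (m + hits τs (best τs))        ≡⟨ cong (2 ^ b *_) (count-not (compatible (best τs)) τs) ⟩
    2 ^ b * length τs                      ∎
    where
    open ≤-Reasoning
    m = count (λ τ → not (compatible (best τs) τ)) τs

  left-shrinks : ∀ i → 2 ^ b * length (left (suc i)) + length (left i) ≤ 2 ^ b * length (left i)
  left-shrinks i = choose-shrinks (chosen i) (left-⊆ i)

  private
    instance
      2^b≢0 : NonZero (2 ^ b)
      2^b≢0 = m^n≢0 2 b

  left-decreases : ∀ i → length (left (suc i)) ≤ length (left i)
  left-decreases i = *-cancelˡ-≤ (2 ^ b) (≤-trans (m≤m+n _ _) (left-shrinks i))

  left-+ : ∀ i j → length (left (j + i)) ≤ length (left i)
  left-+ i zero    = ≤-refl
  left-+ i (suc j) = ≤-trans (left-decreases (j + i)) (left-+ i j)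

  -- Summing the inequalities left-shrinks for the j steps after step i.
  left-sum : ∀ i j → 2 ^ b * length (left (j + i)) + j * length (left (j + i)) ≤ 2 ^ b * length (left i)
  left-sum i zero    = ≤-reflexive (+-identityʳ _)
  left-sum i (suc j) = begin
    2 ^ b * y + suc j * y    ≤⟨ +-monoʳ-≤ (2 ^ b * y) (*-monoʳ-≤ (suc j) (left-decreases (j + i))) ⟩
    2 ^ b * y + suc j * x    ≡⟨ +-assoc (2 ^ b * y) x (j * x) ⟨
    2 ^ b * y + x + j * x    ≤⟨ +-monoˡ-≤ (j * x) (left-shrinks (j + i)) ⟩
    2 ^ b * x + j * x        ≤⟨ left-sum i j ⟩
    2 ^ b * length (left i)  ∎
    where
    open ≤-Reasoning
    x = length (left (j + i))
    y = length (left (suc j + i))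

  -- The integer counterpart of `(1 - 1/m)^m ≤ 1/2` for `m = 2 ^ b`, obtained from `left-sum` with
  -- as many steps as `2 ^ b`.
  left-halves : ∀ i → 2 * length (left (2 ^ b + i)) ≤ length (left i)
  left-halves i = *-cancelˡ-≤ (2 ^ b) (≤-trans (≤-reflexive (lemma (2 ^ b) _)) (left-sum i (2 ^ b)))
    where
    lemma : ∀ m n → m * (2 * n) ≡ m * n + m * n
    lemma = solve-∀

  left-halves-^ : ∀ h → 2 ^ h * length (left (h * 2 ^ b)) ≤ length constraints
  left-halves-^ zero    = ≤-reflexive (+-identityʳ _)
  left-halves-^ (suc h) = begin
    2 * 2 ^ h * length (left (2 ^ b + h * 2 ^ b))    ≡⟨ lemma (2 ^ h) _ ⟩
    2 ^ h * (2 * length (left (2 ^ b + h * 2 ^ b)))  ≤⟨ *-monoʳ-≤ (2 ^ h) (left-halves (h * 2 ^ b)) ⟩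
    2 ^ h * length (left (h * 2 ^ b))                ≤⟨ left-halves-^ h ⟩
    length constraints                               ∎
    where
    open ≤-Reasoning
    lemma : ∀ m n → 2 * m * n ≡ m * (2 * n)
    lemma = solve-∀

  -- At most `2 ^ (2 |blk|)` assignments exist, so `2 |blk| + 1` halvings, of `2 ^ b` rounds each,
  -- leave less than one.
  left-empty : length (left (suc (length blk + length blk) * 2 ^ b)) ≡ 0
  left-empty = n<1⇒n≡0 (*-cancelˡ-< (2 ^ h) _ 1 (begin-strict
    2 ^ h * length (left (h * 2 ^ b))  ≤⟨ left-halves-^ h ⟩
    length constraints                 ≤⟨ List.length-filter _ (assignments blk) ⟩
    length (assignments blk)           ≤⟨ length-assignments blk ⟩
    2 ^ (length blk + length blk)      <⟨ ^-monoʳ-< 2 ≤-refl (n<1+n (length blk + length blk)) ⟩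
    2 ^ h                              ≡⟨ *-identityʳ _ ⟨
    2 ^ h * 1                          ∎))
    where
    open ≤-Reasoning
    h = suc (length blk + length blk)

  choose-done : ∀ st → length (proj₁ st) ≡ 0 → choose st ≡ st
  choose-done ([] , vs) _ = refl

  picked-done : ∀ i j → length (left i) ≡ 0 → chosen (j + i) ≡ chosen i
  picked-done i zero    done = refl
  picked-done i (suc j) done rewrite picked-done i j done = choose-done (chosen i) done

  picked-≤ : ∀ i → length (picked i) ≤ i
  picked-≤ zero    = z≤n
  picked-≤ (suc i) = ≤-trans (choose-≤ (chosen i)) (s≤s (picked-≤ i))
    where
    choose-≤ : ∀ st → length (proj₂ (choose st)) ≤ suc (length (proj₂ st))
    choose-≤ ([] , vs)    = n≤1+n _
    choose-≤ (_ ∷ _ , vs) = ≤-refl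

  -- Each round adds at most one subset. If `family` runs fewer rounds than the bound, this is
  -- enough; otherwise all constraints are met by then and the remaining rounds change nothing.
  length-family : length family ≤ suc (length blk + length blk) * 2 ^ b
  length-family with ≤-total (length constraints) (suc (length blk + length blk) * 2 ^ b)
  ... | inj₁ F≤ = ≤-trans (picked-≤ (length constraints)) F≤
  ... | inj₂ ≤F = subst (λ st → length (proj₂ st) ≤ i)
      (trans (sym (picked-done i (length constraints ∸ i) left-empty)) (cong chosen (m∸n+n≡m ≤F))) (picked-≤ i)
    where i = suc (length blk + length blk) * 2 ^ b

  -- A positive fraction of a nonempty list is at least one constraint. This shows that the rounds
  -- run by `family` suffice for universality.
  left-exhausted : ∀ i → length (left i) ≤ length constraints ∸ i
  left-exhausted zero    = ≤-refl
  left-exhausted (suc i) = ≤-trans (strict (length (left i)) (left-shrinks i))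
    (≤-trans (∸-monoˡ-≤ 1 (left-exhausted i)) (≤-reflexive (∸-+-assoc-1 (length constraints) i)))
    where
    ∸-+-assoc-1 : ∀ m n → m ∸ n ∸ 1 ≡ m ∸ suc n
    ∸-+-assoc-1 m n = trans (∸-+-assoc m n 1) (cong (m ∸_) (+-comm n 1))
    strict : ∀ x {y} → 2 ^ b * y + x ≤ 2 ^ b * x → y ≤ x ∸ 1
    strict zero    le = ≤-trans (*-cancelˡ-≤ (2 ^ b) (≤-trans (m≤m+n _ 0) le)) z≤n
    strict (suc x) {y} le = s≤s⁻¹ (*-cancelˡ-< (2 ^ b) y (suc x) (<-≤-trans (m<m+n (2 ^ b * y) z<s) le))

  covered : ∀ i {τ} → τ ∈ constraints → τ ∈ left i ⊎ ∃[ v ] v ∈ picked i × T (compatible v τ)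
  covered zero    τ∈ = inj₁ τ∈
  covered (suc i) τ∈ = go (chosen i) (covered i τ∈)
    where
    go : ∀ st {τ} → τ ∈ proj₁ st ⊎ (∃[ v ] v ∈ proj₂ st × T (compatible v τ)) →
         τ ∈ proj₁ (choose st) ⊎ (∃[ v ] v ∈ proj₂ (choose st) × T (compatible v τ))
    go ([] , vs)           c                   = c
    go (τs@(_ ∷ _) , vs)   (inj₂ (v , v∈ , c)) = inj₂ (v , there v∈ , c)
    go (τs@(_ ∷ _) , vs) {τ} (inj₁ τ∈) with compatible (best τs) τ in eq
    ... | true  = inj₂ (best τs , here refl , Equivalence.from T-≡ eq)
    ... | false = inj₁ (∈-filterᵇ⁺ {p = λ τ → not (compatible (best τs) τ)} τ∈ (subst (T ∘ not) (sym eq) _))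

  family-universal : ∀ {τ} → τ ∈ assignments blk → length τ ≤ b → ∃[ v ] v ∈ family × T (compatible v τ)
  family-universal τ∈ τ≤b with covered (length constraints) (∈-filterᵇ⁺ τ∈ (≤⇒≤ᵇ τ≤b))
  ... | inj₂ c  = c
  ... | inj₁ τ∈left = contradiction (∈-length τ∈left)
      (<⇒≱ (s≤s (≤-trans (left-exhausted (length constraints)) (≤-reflexive (n∸n≡0 (length constraints))))))

  family-∈ : ∀ {v} → v ∈ family → v ∈ [] ∷ sublists blk
  family-∈ = go (length constraints)
    where
    choose-∈ : ∀ st → (∀ {v} → v ∈ proj₂ st → v ∈ [] ∷ sublists blk) →
               ∀ {v} → v ∈ proj₂ (choose st) → v ∈ [] ∷ sublists blk
    choose-∈ ([] , vs)         vs⊆ v∈          = vs⊆ v∈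
    choose-∈ (τs@(_ ∷ _) , vs) vs⊆ (here refl) = best-∈ τs (sublists blk)
    choose-∈ (τs@(_ ∷ _) , vs) vs⊆ (there v∈)  = vs⊆ v∈
    go : ∀ i {v} → v ∈ picked i → v ∈ [] ∷ sublists blk
    go (suc i) v∈ = choose-∈ (chosen i) (go i) v∈

-- Distances

Matrix : Set
Matrix = List (List Bool)

-- Each fold returns the first item of what is left after dropping; the defaults make indices out of
-- range non-adjacent.
edge : Matrix → ℕ → ℕ → Bool
edge M u v = foldr (λ b _ → b) false (drop v (foldr (λ r _ → r) [] (drop u M)))

vertexList : Matrix → List ℕ
vertexList M = downFrom (length M)

ball : Matrix → ℕ → ℕ → List ℕ
ball M u = fold (u ∷ []) λ b → filterᵇ (λ v → member v b ∨ any (λ w → edge M w v) b) (vertexList M)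

-- The distance is represented by the bits that tell whether it is at most `ℓ`, for all `ℓ < n`.
-- Paths are shorter than `n`, so infinite distance gives only `false`, and equality of these lists
-- is equality of distances, including infinity.
distance : Matrix → ℕ → ℕ → List Bool
distance M u v = map (λ ℓ → member v (ball M u ℓ)) (downFrom (length M))

sameDistance : Matrix → ℕ → ℕ → ℕ → Bool
sameDistance M z x y = all (λ ℓ → not (member x (ball M z ℓ) xor member y (ball M z ℓ))) (downFrom (length M))

T⇔⇒≡ : ∀ {a b} → (T a → T b) → (T b → T a) → a ≡ b
T⇔⇒≡ {true}  {true}  f g = refl
T⇔⇒≡ {true}  {false} f g = ⊥-elim (f _)
T⇔⇒≡ {false} {true}  f g = ⊥-elim (g _)
T⇔⇒≡ {false} {false} f g = refl

sameDistance-sound : ∀ M z x y → T (sameDistance M z x y) → distance M z x ≡ distance M z y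
sameDistance-sound M z x y s = go (downFrom (length M)) s
  where
  go : ∀ ℓs → T (all (λ ℓ → not (member x (ball M z ℓ) xor member y (ball M z ℓ))) ℓs) →
       map (λ ℓ → member x (ball M z ℓ)) ℓs ≡ map (λ ℓ → member y (ball M z ℓ)) ℓs
  go []       _ = refl
  go (ℓ ∷ ℓs) s with member x (ball M z ℓ) | member y (ball M z ℓ)
  ... | true  | true  = cong (true ∷_) (go ℓs s)
  ... | false | false = cong (false ∷_) (go ℓs s)

sameDistance-complete : ∀ M z x y → distance M z x ≡ distance M z y → T (sameDistance M z x y)
sameDistance-complete M z x y s = go (downFrom (length M)) s
  where
  go : ∀ ℓs → map (λ ℓ → member x (ball M z ℓ)) ℓs ≡ map (λ ℓ → member y (ball M z ℓ)) ℓs →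
       T (all (λ ℓ → not (member x (ball M z ℓ) xor member y (ball M z ℓ))) ℓs)
  go []       _ = _
  go (ℓ ∷ ℓs) s with member x (ball M z ℓ) | member y (ball M z ℓ)
  ... | true  | true  = go ℓs (List.∷-injectiveʳ s)
  ... | false | false = go ℓs (List.∷-injectiveʳ s)
  ... | true  | false with () ← List.∷-injectiveˡ s
  ... | false | true  with () ← List.∷-injectiveˡ s

least : (p : ℕ → Bool) (n : ℕ) →
        (∀ m → m < n → ¬ T (p m)) ⊎ ∃[ m ] m < n × T (p m) × (∀ i → T (p i) → m ≤ i)
least p zero = inj₁ λ _ ()
least p (suc n) with least p n
... | inj₂ (m , m<n , pm , min) = inj₂ (m , m<n⇒m<1+n m<n , pm , min)
... | inj₁ none with T? (p n)
...   | yes pn = inj₂ (n , ≤-refl , pn , λ i pi → ≮⇒≥ λ i<n → none i i<n pi)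
...   | no ¬pn = inj₁ λ m m<1+n → λ pm → [m<n∨m≡n] m m<1+n pm
  where
  [m<n∨m≡n] : ∀ m → m < suc n → ¬ T (p m)
  [m<n∨m≡n] m m<1+n pm with m≤n⇒m<n∨m≡n (s≤s⁻¹ m<1+n)
  ... | inj₁ m<n  = none m m<n pm
  ... | inj₂ refl = ¬pn pm

module _ {n : ℕ} (G : Graph n) where

  open Graph G using (adj) renaming (sym to adj-sym)

  rows : Matrix
  rows = tabulate λ u → tabulate λ v → adj u v

  private
    nth-tabulate : ∀ {A : Set} {m} (d : A) (f : Fin m → A) i →
                   foldr (λ x _ → x) d (drop (toℕ i) (tabulate f)) ≡ f i
    nth-tabulate d f Fin.zero    = refl
    nth-tabulate d f (Fin.suc i) = nth-tabulate d (f ∘ Fin.suc) i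

  edge-rows : ∀ u v → edge rows (toℕ u) (toℕ v) ≡ adj u v
  edge-rows u v rewrite nth-tabulate [] (λ u → tabulate (adj u)) u = nth-tabulate false (adj u) v

  length-rows : length rows ≡ n
  length-rows = List.length-tabulate _

  toℕ∈ : ∀ (v : Fin n) → toℕ v ∈ vertexList rows
  toℕ∈ v = ∈-downFrom⁺ (subst (toℕ v <_) (sym length-rows) (Fin.toℕ<n v))

  ∈⇒toℕ : ∀ {x} → x ∈ vertexList rows → ∃[ v ] toℕ v ≡ x
  ∈⇒toℕ x∈ = fromℕ< x<n , Fin.toℕ-fromℕ< x<n
    where x<n = subst (_ <_) length-rows (∈-downFrom⁻ x∈)

  snoc : ∀ {u v w ℓ} → Walk G u v ℓ → adj v w ≡ true → Walk G u w (suc ℓ)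
  snoc []      a = a ∷ []
  snoc (b ∷ p) a = b ∷ snoc p a

  unsnoc : ∀ {u w ℓ} → Walk G u w (suc ℓ) → ∃[ v ] Walk G u v ℓ × adj v w ≡ true
  unsnoc (a ∷ [])      = _ , [] , a
  unsnoc (a ∷ b ∷ p) with v , q , c ← unsnoc (b ∷ p) = v , a ∷ q , c

  reverseWalk : ∀ {u v ℓ} → Walk G u v ℓ → Walk G v u ℓ
  reverseWalk []      = []
  reverseWalk (a ∷ p) = snoc (reverseWalk p) (trans (adj-sym _ _) a)

  -- The step of loop erasure: when an edge from `x` is put in front of a path that already visits
  -- `x`, the part of the path from `x` on is used instead.
  suffix : ∀ {u v ℓ} (x : Fin n) ((p , _) : Path G u v ℓ) →
           (∃[ m ] m ≤ ℓ × Path G x v m) ⊎ Vec.All (x ≢_) (vertices G p)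
  suffix {u} x (p , _) with x Fin.≟ u
  suffix x (p , uniq) | yes refl = inj₁ (_ , ≤-refl , p , uniq)
  suffix x ([] , uniq)          | no x≢u = inj₂ (x≢u ∷ [])
  suffix x (a ∷ p , _ ∷ uniq)   | no x≢u with suffix x (p , uniq)
  ... | inj₁ (m , m≤ℓ , q) = inj₁ (m , m≤n⇒m≤1+n m≤ℓ , q)
  ... | inj₂ x∉p           = inj₂ (x≢u ∷ x∉p)

  walk⇒path : ∀ {u v ℓ} → Walk G u v ℓ → ∃[ m ] m ≤ ℓ × Path G u v m
  walk⇒path [] = 0 , z≤n , [] , [] ∷ []
  walk⇒path {u} (a ∷ w) with m , m≤ℓ , p , uniq ← walk⇒path w with suffix u (p , uniq)
  ... | inj₁ (i , i≤m , q) = i , ≤-trans i≤m (m≤n⇒m≤1+n m≤ℓ) , q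
  ... | inj₂ u∉p           = suc m , s≤s m≤ℓ , a ∷ p , u∉p ∷ uniq

  path-short : ∀ {u v ℓ} → Path G u v ℓ → ℓ < n
  path-short (p , uniq) = Fin.injective⇒≤ {f = lookup (vertices G p)} λ {i} {j} → lookup-injective uniq i j

  reach : Fin n → ℕ → Fin n → Bool
  reach u ℓ v = member (toℕ v) (ball rows (toℕ u) ℓ)

  ball-sound : ∀ u ℓ {x} → x ∈ ball rows (toℕ u) ℓ → ∃[ v ] toℕ v ≡ x × ∃[ m ] m ≤ ℓ × Walk G u v m
  ball-sound u zero    (here refl) = u , refl , 0 , z≤n , []
  ball-sound u (suc ℓ) {x} x∈
    with x∈vs , t ← ∈-filterᵇ⁻ (λ v → member v (ball rows (toℕ u) ℓ) ∨ any (λ w → edge rows w v) (ball rows (toℕ u) ℓ))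
                               (vertexList rows) x∈
    with Equivalence.to (T-∨ {member x (ball rows (toℕ u) ℓ)}) t
  ... | inj₁ x∈b with v , eq , m , m≤ℓ , p ← ball-sound u ℓ (member-sound (ball rows (toℕ u) ℓ) x∈b) =
        v , eq , m , m≤n⇒m≤1+n m≤ℓ , p
  ... | inj₂ e with w , w∈ , a ← any-sound (λ w → edge rows w x) (ball rows (toℕ u) ℓ) e
               with w′ , refl , m , m≤ℓ , p ← ball-sound u ℓ w∈
               with v , refl ← ∈⇒toℕ x∈vs =
        v , refl , suc m , s≤s m≤ℓ , snoc p (trans (sym (edge-rows w′ v)) (Equivalence.to T-≡ a))

  ball-complete : ∀ {u v m} ℓ → m ≤ ℓ → Walk G u v m → toℕ v ∈ ball rows (toℕ u) ℓ
  ball-complete {m = zero} zero    m≤ℓ [] = here refl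
  ball-complete {u} {v} {m} (suc ℓ) m≤ℓ p = ∈-filterᵇ⁺ (toℕ∈ v) (Equivalence.from T-∨ (near m≤ℓ p))
    where
    b = ball rows (toℕ u) ℓ
    near : ∀ {m} → m ≤ suc ℓ → Walk G u v m → T (member (toℕ v) b) ⊎ T (any (λ w → edge rows w (toℕ v)) b)
    near {zero}  _         p = inj₁ (member-complete (ball-complete ℓ z≤n p))
    near {suc m} (s≤s m≤ℓ) p with w , q , a ← unsnoc p =
      inj₂ (any-complete _ (ball-complete ℓ m≤ℓ q) (Equivalence.from T-≡ (trans (edge-rows w v) a)))

  -- Balls are built from walks, whereas `Distance` speaks of paths. Erasing loops may shorten the
  -- walk, which does no harm because a ball comprises all lengths up to its radius.
  reach-sound : ∀ u ℓ v → T (reach u ℓ v) → ∃[ m ] m ≤ ℓ × Path G u v m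
  reach-sound u ℓ v r with v′ , eq , m , m≤ℓ , w ← ball-sound u ℓ (member-sound (ball rows (toℕ u) ℓ) r)
                      with refl ← Fin.toℕ-injective {i = v′} {v} eq
                      with i , i≤m , p ← walk⇒path w = i , ≤-trans i≤m m≤ℓ , p

  reach-complete : ∀ {u v m} ℓ → m ≤ ℓ → Walk G u v m → T (reach u ℓ v)
  reach-complete ℓ m≤ℓ w = member-complete (ball-complete ℓ m≤ℓ w)

  reach-sym : ∀ u ℓ v → reach u ℓ v ≡ reach v ℓ u
  reach-sym u ℓ v = T⇔⇒≡ (reversed u v) (reversed v u)
    where
    reversed : ∀ u v → T (reach u ℓ v) → T (reach v ℓ u)
    reversed u v r with m , m≤ℓ , p , _ ← reach-sound u ℓ v r = reach-complete ℓ m≤ℓ (reverseWalk p)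

  distance-sym : ∀ u v → distance rows (toℕ u) (toℕ v) ≡ distance rows (toℕ v) (toℕ u)
  distance-sym u v = List.map-cong (λ ℓ → reach-sym u ℓ v) (downFrom (length rows))

  distance-cong : ∀ v x y → (∀ ℓ → reach v ℓ x ≡ reach v ℓ y) →
                  distance rows (toℕ v) (toℕ x) ≡ distance rows (toℕ v) (toℕ y)
  distance-cong v x y eq = List.map-cong eq (downFrom (length rows))

  distance-reach : ∀ v x y → distance rows (toℕ v) (toℕ x) ≡ distance rows (toℕ v) (toℕ y) →
                   ∀ {ℓ} → ℓ < n → reach v ℓ x ≡ reach v ℓ y
  distance-reach v x y eq {ℓ} ℓ<n = go (downFrom (length rows)) eq (∈-downFrom⁺ (subst (ℓ <_) (sym length-rows) ℓ<n))
    where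
    go : ∀ ℓs → map (λ ℓ → reach v ℓ x) ℓs ≡ map (λ ℓ → reach v ℓ y) ℓs → ∀ {ℓ} → ℓ ∈ ℓs → reach v ℓ x ≡ reach v ℓ y
    go (ℓ ∷ ℓs) eq (here refl) = List.∷-injectiveˡ eq
    go (ℓ ∷ ℓs) eq (there ℓ∈)  = go ℓs (List.∷-injectiveʳ eq) ℓ∈

  transfer : ∀ {u v x ℓ} → distance rows (toℕ u) (toℕ v) ≡ distance rows (toℕ u) (toℕ x) →
             Path G u v ℓ → ∃[ i ] i ≤ ℓ × Path G u x i
  transfer {u} {v} {x} {ℓ} eq p = reach-sound u ℓ x
    (subst T (distance-reach u v x eq (path-short p)) (reach-complete ℓ ≤-refl (proj₁ p)))

  -- If the lists of bits were equal, each path from `v` to `x` would give one to `y` that is no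
  -- longer, and conversely. So the minimal lengths, or their absence, would coincide.
  resolves⇒≢ : ∀ {v x y} → Resolves G v x y → distance rows (toℕ v) (toℕ x) ≢ distance rows (toℕ v) (toℕ y)
  resolves⇒≢ (_ , _ , finite p p-min , finite q q-min , d≢e) eq
    with i , i≤ , p′ ← transfer eq p with j , j≤ , q′ ← transfer (sym eq) q =
    d≢e (cong [_] (≤-antisym (≤-trans (p-min j q′) j≤) (≤-trans (q-min i p′) i≤)))
  resolves⇒≢ (_ , _ , finite p _ , infinite none , _) eq with i , _ , p′ ← transfer eq p = none i p′
  resolves⇒≢ (_ , _ , infinite none , finite q _ , _) eq with j , _ , q′ ← transfer (sym eq) q = none j q′
  resolves⇒≢ (_ , _ , infinite _ , infinite _ , d≢e) eq = d≢e refl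

  distance-exists : ∀ u v → ∃[ d ] Distance G u v d
  distance-exists u v with least (λ ℓ → reach u ℓ v) n
  ... | inj₁ none = ⊤⁺ , infinite λ m p → none m (path-short p) (reach-complete m ≤-refl (proj₁ p))
  ... | inj₂ (ℓ , _ , r , min) with m , m≤ℓ , p ← reach-sound u ℓ v r
                               with refl ← ≤-antisym m≤ℓ (min m (reach-complete m ≤-refl (proj₁ p))) =
        [ ℓ ] , finite p λ i q → min i (reach-complete i ≤-refl (proj₁ q))

  distance-determines : ∀ {v x y d} → Distance G v x d → Distance G v y d → ∀ ℓ → T (reach v ℓ x) → T (reach v ℓ y)
  distance-determines {v} {x} (finite p p-min) (finite q _) ℓ r with m , m≤ℓ , p′ ← reach-sound v ℓ x r =
    reach-complete ℓ (≤-trans (p-min m p′) m≤ℓ) (proj₁ q)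
  distance-determines {v} {x} (infinite none) _ ℓ r with m , _ , p ← reach-sound v ℓ x r = contradiction p (none m)

  ≢⇒resolves : ∀ {v x y} → distance rows (toℕ v) (toℕ x) ≢ distance rows (toℕ v) (toℕ y) → Resolves G v x y
  ≢⇒resolves {v} {x} {y} d≢ with d , dx ← distance-exists v x with e , dy ← distance-exists v y =
    d , e , dx , dy , λ { refl → d≢ (distance-cong v x y λ ℓ →
      T⇔⇒≡ (distance-determines dx dy ℓ) (distance-determines dy dx ℓ)) }

  self-distance : ∀ u x → u ≢ x → distance rows (toℕ u) (toℕ u) ≢ distance rows (toℕ u) (toℕ x)
  self-distance u x u≢x eq with transfer {u} {u} {x} eq ([] , [] ∷ [])
  ... | zero , z≤n , [] , _ = u≢x refl

-- Depth-first search

module _ {A : Set} (children : A → List A) (good : A → Bool) where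

  data Found : List A → Set where
    here  : ∀ {x xs} → x ∈ xs → T (good x) → Found xs
    below : ∀ {x xs} → x ∈ xs → Found (children x) → Found xs

module _ {A : Set} (children : A → List A) (good : A → Bool) (small : A → Set) where

  -- The index ℕ counts the rounds of the search loop: one for each node, and
  -- one for popping each exhausted list of children off the stack.
  data Explores : List A → Bool → ℕ → Set where
    []   : Explores [] false 1
    node : ∀ {x xs b c s t} → small x → Explores (children x) b s → Explores xs c t →
           Explores (x ∷ xs) (good x ∨ (b ∨ c)) (suc (s + t))

  private
    ∨-left : ∀ {a b} → T a → T (a ∨ b)
    ∨-left {true} _ = _
    ∨-right : ∀ a {b} → T b → T (a ∨ b)
    ∨-right true  _ = _
    ∨-right false t = t

  explores-complete : ∀ {xs b t} → Explores xs b t → Found children good xs → T b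
  explores-complete (node _ e f) (here (here refl) g)   = ∨-left g
  explores-complete (node {x} _ e f) (here (there x∈) g) = ∨-right (good x) (∨-right _ (explores-complete f (here x∈ g)))
  explores-complete (node {x} _ e f) (below (here refl) d) = ∨-right (good x) (∨-left (explores-complete e d))
  explores-complete (node {x} _ e f) (below (there x∈) d) =
    ∨-right (good x) (∨-right _ (explores-complete f (below x∈ d)))

  explores-sound : ∀ {xs b t} → Explores xs b t → T b → ∃[ x ] T (good x)
  explores-sound (node {x} {b = b} _ e f) t with good x in eq | b in eq′
  ... | true  | _     = x , subst T (sym eq) _
  ... | false | true  = explores-sound e _
  ... | false | false = explores-sound f t

module _ {Γ : Ctx} {ν : Ty} {i : Env Γ → List (El ν)}
         {c : Env (ν ∷ Γ) → List (El ν)} {g : Env (ν ∷ Γ) → Bool}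
         (iC : Comp Γ (list ν) i) (cC : Comp (ν ∷ Γ) (list ν) c) (gC : Comp (ν ∷ Γ) bool g) where

  private
    -- If the top list of the stack has a first node, the node is tested and removed, and the list
    -- of its children goes on top; an exhausted list is popped. The search does not stop at a good
    -- node, so the number of rounds depends on the tree alone.
    continue next : Program (suc (length Γ))
    continue = tl (var zero)
    next = if (hd (tl (var zero)))
      (let′ (hd (hd (tl (var zero))))
        (cons (if (rename (lift suc) (prog gC)) (cons nil nil) (hd (var (suc zero))))
              (cons (rename (lift suc) (prog cC))
                    (cons (tl (hd (tl (var (suc zero))))) (tl (tl (var (suc zero))))))))
      (cons (hd (var zero)) (tl (tl (var zero))))

  -- The state of the loop consists of a flag and a stack of lists of nodes.
  searchProgram : Program (length Γ)
  searchProgram = hd (while continue next (cons nil (cons (prog iC) nil)))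

  -- 40 is a generous bound for the steps of a round outside the two subprograms: popping takes 13,
  -- treating a node at most 28.
  roundTime : Env (ν ∷ Γ) → ℕ
  roundTime ρ = 40 + (time gC ρ + time cC ρ)

  module _ (ρ : Env Γ) (Z : ℕ) where

    private
      Small : El ν → Set
      Small x = roundTime (x , ρ) ≤ Z

      Explores′ : List (El ν) → Bool → ℕ → Set
      Explores′ = Explores (λ x → c (x , ρ)) (λ x → g (x , ρ)) Small

      Run : Tree → Tree → ℕ → Set
      Run = Loop (encodeEnv Γ ρ) continue next

      along : ∀ {u v} → Along (lift suc) (u ∷ encodeEnv Γ ρ) (u ∷ v ∷ encodeEnv Γ ρ)
      along zero    = refl
      along (suc i) = refl

      flag : ∀ x f {st} → ∃[ t ] t ≤ 6 + time gC (x , ρ) ×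
             encode ν x ∷ (encodeBool f ∙ st) ∷ encodeEnv Γ ρ ⊢
               if (rename (lift suc) (prog gC)) (cons nil nil) (hd (var (suc zero))) ⇓
               encodeBool (g (x , ρ) ∨ f) after t
      flag x f with g (x , ρ) | runs gC (x , ρ)
      ... | true  | d = _ , ≤-trans (≤-reflexive (cong suc (+-comm _ 3))) (+-monoˡ-≤ _ (m≤m+n 4 2)) ,
                        if-cons (rename-runs along d) (cons nil nil)
      ... | false | d = _ , ≤-trans (≤-reflexive (cong suc (+-comm _ 2))) (+-monoˡ-≤ _ (m≤m+n 3 3)) ,
                        if-nil (rename-runs along d) (hd (var _))

      -- The program joins results to its flag in the order of the visit: the node, its subtree, its
      -- later siblings. `Explores` nests them the other way.
      shuffle : ∀ a b d f → (a ∨ (b ∨ d)) ∨ f ≡ d ∨ (b ∨ (a ∨ f))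
      shuffle true  true  true  f = refl
      shuffle true  true  false f = refl
      shuffle true  false true  f = refl
      shuffle true  false false f = refl
      shuffle false true  true  f = refl
      shuffle false true  false f = refl
      shuffle false false d     f = refl

      -- `Loop` derivations grow at the front, hence the form of a continuation: a run from the
      -- state in which `xs` is explored and popped is extended to a run from the state with `xs` on
      -- top of the stack.
      explore : ∀ {xs b t} → Explores′ xs b t → 40 ≤ Z → ∀ f stack {w s} → Run (encodeBool (b ∨ f) ∙ stack) w s →
                ∃[ r ] r ≤ t * Z + s × Run (encodeBool f ∙ (encode (list ν) xs ∙ stack)) w r
      explore [] 40≤Z f stack {s = s} run =
        _ , ≤-trans (+-monoˡ-≤ s (m≤m+n 13 27)) (+-monoˡ-≤ s (≤-trans 40≤Z (m≤m+n Z 0))) ,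
        Loop.step (tl (var zero)) (if-nil (hd (tl (var zero))) (cons (hd (var zero)) (tl (tl (var zero))))) run
      explore (node {x} {xs} {b} {d} {s₁} {t₁} x≤Z e₁ e₂) 40≤Z f stack {w} {s} run
        with r₂ , r₂≤ , run₂ ← explore e₂ 40≤Z (b ∨ (g (x , ρ) ∨ f)) stack
               (subst (λ v → Run (encodeBool v ∙ stack) w s) (shuffle (g (x , ρ)) b d f) run)
        with r₁ , r₁≤ , run₁ ← explore e₁ 40≤Z (g (x , ρ) ∨ f) (encode (list ν) xs ∙ stack) run₂
        with tf , tf≤ , df ← flag x f {encode (list ν) (x ∷ xs) ∙ stack} =
        _ , bound , Loop.step (tl (var zero))
          (if-cons (hd (tl (var zero))) (let′ (hd (hd (tl (var zero))))
            (cons df (cons (rename-runs along (runs cC (x , ρ)))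
                           (cons (tl (hd (tl (var _)))) (tl (tl (var _)))))))) run₁
        where
        bound : suc (2 + suc (3 + suc (4 + suc (tf + suc (time cC (x , ρ) + 8)))) + r₁) ≤ suc (s₁ + t₁) * Z + s
        bound = begin
          suc (2 + suc (3 + suc (4 + suc (tf + suc (time cC (x , ρ) + 8)))) + r₁)
            ≡⟨ lemma₁ tf (time cC (x , ρ)) r₁ ⟩
          22 + (tf + time cC (x , ρ)) + r₁
            ≤⟨ +-mono-≤ (+-monoʳ-≤ 22 (+-monoˡ-≤ (time cC (x , ρ)) tf≤)) r₁≤ ⟩
          22 + (6 + time gC (x , ρ) + time cC (x , ρ)) + (s₁ * Z + r₂)
            ≤⟨ +-mono-≤ (≤-trans (+-monoˡ-≤ (time gC (x , ρ) + time cC (x , ρ)) (m≤m+n 28 12)) x≤Z)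
                        (+-monoʳ-≤ (s₁ * Z) r₂≤) ⟩
          Z + (s₁ * Z + (t₁ * Z + s))
            ≡⟨ lemma₂ Z s₁ t₁ s ⟩
          suc (s₁ + t₁) * Z + s ∎
          where
          open ≤-Reasoning
          lemma₁ : ∀ a b r → suc (2 + suc (3 + suc (4 + suc (a + suc (b + 8)))) + r) ≡ 22 + (a + b) + r
          lemma₁ = solve-∀
          lemma₂ : ∀ Z a b s → Z + (a * Z + (b * Z + s)) ≡ suc (a + b) * Z + s
          lemma₂ = solve-∀

    search-runs : ∀ {b t} → 40 ≤ Z → Explores′ (i ρ) b t →
                  ∃[ r ] r ≤ 9 + time iC ρ + t * Z ×
                         (encodeEnv Γ ρ ⊢ searchProgram ⇓ encodeBool b after r)
    search-runs {b} {t} 40≤Z e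
      with r , r≤ , run ← explore e 40≤Z false nil {w = encodeBool (b ∨ false) ∙ nil} (stop (tl (var zero))) =
      _ , ≤-trans (≤-reflexive (lemma (time iC ρ) r)) (≤-trans (+-monoʳ-≤ (6 + time iC ρ) r≤)
            (≤-reflexive (lemma′ (time iC ρ) (t * Z)))) ,
      subst (λ v → _ ⊢ _ ⇓ encodeBool v after _) (∨-identityʳ b) (hd (while (cons nil (cons (runs iC ρ) nil)) run))
      where
      lemma : ∀ a r → suc (suc (suc (1 + suc (a + 1)) + r)) ≡ 6 + a + r
      lemma = solve-∀
      lemma′ : ∀ a b → 6 + a + (b + 3) ≡ 9 + a + b
      lemma′ = solve-∀

  -- No node is larger than the initial list, so a single power of the width of the input bounds the
  -- cost of every round. Only the number `t` of rounds may be exponential.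
  search-polynomial :
    ∃[ d ] (∀ ρ {b t} → Explores (λ x → c (x , ρ)) (λ x → g (x , ρ)) (λ x → size ν x ≤ size (list ν) (i ρ)) (i ρ) b t →
            ∃[ r ] (encodeEnv Γ ρ ⊢ searchProgram ⇓ encodeBool b after r) × r ≤ t * width Γ ρ ^ d)
  search-polynomial = go (const≼ 40 +≼ (time-small gC +≼ time-small cC))
    where
    positive : ∀ {A : Set} {c : A → List A} {g : A → Bool} {small xs b t} → Explores c g small xs b t → 1 ≤ t
    positive []           = ≤-refl
    positive (node _ _ _) = s≤s z≤n
    relax : ∀ {A : Set} {c : A → List A} {g : A → Bool} {small small′ : A → Set} {xs b t} →
            (∀ {x} → small x → small′ x) → Explores c g small xs b t → Explores c g small′ xs b t
    relax f []           = []
    relax f (node s d e) = node (f s) (relax f d) (relax f e)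
    spread : ∀ t a z → 1 ≤ t → a + t * z ≤ t * (a + z)
    spread t a z 1≤t = ≤-trans (+-monoˡ-≤ (t * z) (≤-trans (≤-reflexive (sym (+-identityʳ a))) (*-monoˡ-≤ a 1≤t)))
      (≤-reflexive (sym (*-distribˡ-+ t a z)))
    go : roundTime ≼ width (ν ∷ Γ) → _
    go (e , round≤) = finish ((const≼ 9 +≼ time-small iC) +≼ (const≼ 40 +≼ Z≼))
      where
      Z : Env Γ → ℕ
      Z ρ = (size (list ν) (i ρ) + width Γ ρ) ^ e
      Z≼ : Z ≼ width Γ
      Z≼ = ≼-trans-∘ {v = λ ρ → size (list ν) (i ρ) + width Γ ρ} (λ ρ → ρ) (e , λ _ → ≤-refl) (size-small iC +≼ ≼-refl)
      finish : (λ ρ → (9 + time iC ρ) + (40 + Z ρ)) ≼ width Γ → _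
      finish (d , total≤) = d , λ ρ {b} {t} expl →
        let r , r≤ , run = search-runs ρ (40 + Z ρ) (m≤m+n 40 (Z ρ))
              (relax (λ {x} x≤ → ≤-trans (round≤ (x , ρ)) (≤-trans (^-monoˡ-≤ e (+-monoˡ-≤ (width Γ ρ) x≤)) (m≤n+m (Z ρ) 40))) expl)
        in r , run , ≤-trans r≤ (≤-trans (spread t (9 + time iC ρ) (40 + Z ρ) (positive expl)) (*-monoʳ-≤ t (total≤ ρ)))

-- Integer logarithms

n<2^n : ∀ n → n < 2 ^ n
n<2^n zero    = s≤s z≤n
n<2^n (suc n) = begin-strict
  suc n          <⟨ s≤s (n<2^n n) ⟩
  suc (2 ^ n)    ≤⟨ +-monoˡ-≤ (2 ^ n) (m^n>0 2 n) ⟩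
  2 ^ n + 2 ^ n  ≡⟨ cong (2 ^ n +_) (+-identityʳ (2 ^ n)) ⟨
  2 ^ suc n      ∎
  where open ≤-Reasoning

-- The pair is `2 ^ e` and `e`, doubled as long as the power stays at most `k + 1`. After `k` rounds
-- `e` is the integer part of the binary logarithm of `k + 1`, because `2 ^ (k + 1)` exceeds
-- `k + 1`. The shift by one makes this meaningful for `k = 0`.
doublings : ℕ → ℕ → ℕ × ℕ
doublings k = fold (1 , 0) λ (p , e) → if p + p ≤ᵇ suc k then (p + p , suc e) else (p , e)

lg : ℕ → ℕ
lg k = proj₂ (doublings k k)

private
  data Doublings (k : ℕ) : ℕ → ℕ × ℕ → Set where
    growing : ∀ {i} → 2 ^ i ≤ suc k → Doublings k i (2 ^ i , i)
    full    : ∀ {i e} → 2 ^ e ≤ suc k → suc k < 2 ^ suc e → Doublings k i (2 ^ e , e)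

  doublings-view : ∀ k i → Doublings k i (doublings k i)
  doublings-view k zero    = growing (s≤s z≤n)
  doublings-view k (suc i) with doublings k i | doublings-view k i
  ... | _ | growing {i} 2^i≤ with 2 ^ i + 2 ^ i ≤ᵇ suc k in eq
  ...   | true  = subst (λ p → Doublings k (suc i) (p , suc i)) (cong (2 ^ i +_) (+-identityʳ (2 ^ i)))
                    (growing (subst (_≤ suc k) (cong (2 ^ i +_) (sym (+-identityʳ (2 ^ i))))
                                    (≤ᵇ⇒≤ _ _ (Equivalence.from T-≡ eq))))
  ...   | false = full 2^i≤ (≰⇒> λ le → subst T eq (≤⇒≤ᵇ (subst (_≤ suc k) (cong (2 ^ i +_) (+-identityʳ (2 ^ i))) le)))
  doublings-view k (suc i) | _ | full {i} {e} 2^e≤ <2^1+e with 2 ^ e + 2 ^ e ≤ᵇ suc k in eq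
  ...   | true  = contradiction (subst (_≤ suc k) (cong (2 ^ e +_) (sym (+-identityʳ (2 ^ e))))
                    (≤ᵇ⇒≤ _ _ (Equivalence.from T-≡ eq))) (<⇒≱ <2^1+e)
  ...   | false = full 2^e≤ <2^1+e

2^lg≤ : ∀ k → 2 ^ lg k ≤ suc k
2^lg≤ k with doublings k k | doublings-view k k
... | _ | growing le = le
... | _ | full le _  = le

<2^1+lg : ∀ k → suc k < 2 ^ suc (lg k)
<2^1+lg k with doublings k k | doublings-view k k
... | _ | growing _  = n<2^n (suc k)
... | _ | full _ lt  = lt

-- The search tree

member-cong : ∀ {x} v B → (x ∈ v → x ∈ B) → (x ∈ B → x ∈ v) → member x v ≡ member x B
member-cong v B f g = T⇔⇒≡ (member-complete ∘ f ∘ member-sound v) (member-complete ∘ g ∘ member-sound B)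

size-sublist : ∀ xs {v} → v ∈ sublists xs → size (list nat) v ≤ size (list nat) xs
size-sublist []       (here refl) = z≤n
size-sublist (x ∷ xs) v∈ with ∈-++⁻ (sublists xs) v∈
... | inj₁ v∈ˡ = m≤n⇒m≤1+n (≤-trans (size-sublist xs v∈ˡ) (m≤n+m _ (size nat x)))
... | inj₂ v∈ʳ with w , w∈ , refl ← ∈-map⁻ (x ∷_) v∈ʳ = s≤s (+-monoʳ-≤ (size nat x) (size-sublist xs w∈))

NodeTy : Ty
NodeTy = list nat ⊗ nat ⊗ list nat

-- A node holds the vertices that are still undecided, the number of demands
-- on them that may still be met, and the landmarks chosen so far.
Node : Set
Node = El NodeTy

undecided : Node → List ℕ
undecided = proj₁

-- Positive, so that each level of the tree decides some vertex, and still `2 ^ blockLength k` is at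
-- most `2 * (k + 1)`, so that the subsets of a block can be listed.
blockLength : ℕ → ℕ
blockLength k = suc (lg k)

module SearchTree (k : ℕ) where

  private
    L = blockLength k

  child : Node → ℕ → List ℕ → Node
  child (R , r , B) b v = drop L R , r ∸ b , v ++ B

  family : Node → ℕ → List (List ℕ)
  family (R , _) = Family.family (take L R)

  children : Node → List Node
  children x = if null (undecided x) then []
               else concat (map (λ b → map (child x b) (family x b))
                                -- A block can carry any number of demands from 0 to `L` inclusive,
                                -- within the remaining budget.
                                (filterᵇ (λ b → b ≤ᵇ proj₁ (proj₂ x)) (downFrom (suc L))))

  children-⁻ : ∀ {R r B y} → y ∈ children (R , r , B) →
               ∃[ b ] b ≤ r × ∃[ v ] v ∈ family (R , r , B) b × y ≡ child (R , r , B) b v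
  children-⁻ {R@(_ ∷ _)} {r} {B} y∈
    with _ , y∈ys , ys∈ ← ∈-concat⁻′ (map (λ b → map (child (R , r , B) b) (family (R , r , B) b))
                                          (filterᵇ (λ b → b ≤ᵇ r) (downFrom (suc L)))) y∈
    with b , b∈ , refl ← ∈-map⁻ _ ys∈
    with v , v∈ , refl ← ∈-map⁻ _ y∈ys
    with _ , b≤r ← ∈-filterᵇ⁻ (λ b → b ≤ᵇ r) (downFrom (suc L)) b∈ = b , ≤ᵇ⇒≤ b r b≤r , v , v∈ , refl

  children-⁺ : ∀ {x R r B b v} → b ≤ r → b ≤ L → v ∈ family (x ∷ R , r , B) b →
               child (x ∷ R , r , B) b v ∈ children (x ∷ R , r , B)
  children-⁺ {x} {R} {r} {B} {b} b≤r b≤L v∈ = ∈-concat⁺′ (∈-map⁺ (child node₀ b) v∈)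
    (∈-map⁺ (λ b → map (child node₀ b) (family node₀ b))
      (∈-filterᵇ⁺ {p = λ b → b ≤ᵇ r} (∈-downFrom⁺ (s≤s b≤L)) (≤⇒≤ᵇ b≤r)))
    where
    node₀ : Node
    node₀ = x ∷ R , r , B

  family-⊆ : ∀ R r B {b v y} → Unique R → v ∈ family (R , r , B) b → y ∈ v → y ∈ take L R
  family-⊆ R r B {b} u v∈ y∈ with FamilyProperties.family-∈ (take L R) b (Unique.take⁺ L u) v∈
  ... | there v∈s = ∈-sublists (take L R) v∈s y∈
  ... | here refl with () ← y∈

  -- The chosen subset comes out of the undecided block and the unary budget does not increase, so
  -- no node outgrows the root. This is the smallness on which the time of a search round rests.
  child-size : ∀ {R r B b v} → Unique R → v ∈ family (R , r , B) b →
               size NodeTy (child (R , r , B) b v) ≤ size NodeTy (R , r , B)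
  child-size {R} {r} {B} {b} {v} u v∈ = s≤s (begin
    size (list nat) (drop L R) + suc (size nat (r ∸ b) + size (list nat) (v ++ B))
      ≤⟨ +-monoʳ-≤ d (s≤s (+-monoˡ-≤ _ (r∸b≤r r b))) ⟩
    d + suc (size nat r + size (list nat) (v ++ B))
      ≡⟨ cong (λ m → d + suc (size nat r + m)) (size-++ nat v B) ⟩
    d + suc (size nat r + (size (list nat) v + size (list nat) B))
      ≤⟨ +-monoʳ-≤ d (s≤s (+-monoʳ-≤ (size nat r) (+-monoˡ-≤ (size (list nat) B) v≤))) ⟩
    d + suc (size nat r + (t + size (list nat) B))
      ≡⟨ lemma d (size nat r) t (size (list nat) B) ⟩
    (t + d) + suc (size nat r + size (list nat) B)
      ≡⟨ cong (_+ suc (size nat r + size (list nat) B)) (trans (sym (size-++ nat (take L R) (drop L R)))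
           (cong (size (list nat)) (List.take++drop≡id L R))) ⟩
    size (list nat) R + suc (size nat r + size (list nat) B) ∎)
    where
    open ≤-Reasoning
    d = size (list nat) (drop L R)
    t = size (list nat) (take L R)
    r∸b≤r : ∀ r b → size nat (r ∸ b) ≤ size nat r
    r∸b≤r r       zero    = ≤-refl
    r∸b≤r zero    (suc b) = ≤-refl
    r∸b≤r (suc r) (suc b) = m≤n⇒m≤1+n (r∸b≤r r b)
    v≤ : size (list nat) v ≤ t
    v≤ with FamilyProperties.family-∈ (take L R) b (Unique.take⁺ L u) v∈
    ... | here refl = z≤n
    ... | there v∈s = size-sublist (take L R) v∈s
    lemma : ∀ d r t s → d + suc (r + (t + s)) ≡ t + d + suc (r + s)
    lemma = solve-∀

  -- `L + 1` values of `b` times the factor `2L + 1` of `length-family`, whose `2 ^ b` is charged to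
  -- the budget. The outer `suc` pays for the two additional rounds in `children-weight`.
  branching : ℕ
  branching = suc (suc L * suc (L + L))

  -- A potential that bounds the rounds caused by a node and everything below it, when at most `j`
  -- blocks are undecided.
  weight : ℕ → Node → ℕ
  weight j (_ , r , _) = 2 * 2 ^ r * branching ^ j

  1≤branching^ : ∀ j → 1 ≤ branching ^ j
  1≤branching^ j = m^n>0 branching j

  -- Spending `b` demands on a block reduces `2 ^ r` to `2 ^ (r - b)` in the children, which
  -- compensates the `2 ^ b` in the size of the family; every `b` thus contributes the same bound.
  -- The 2 stands for the round of the node and the round that pops its exhausted list of children.
  children-weight : ∀ j x → Unique (undecided x) → 2 + total (weight j) (children x) ≤ weight (suc j) x
  children-weight j ([] , r , B) u = begin
    2                                  ≤⟨ *-mono-≤ (*-monoʳ-≤ 2 (m^n>0 2 r)) (1≤branching^ (suc j)) ⟩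
    2 * 2 ^ r * branching ^ suc j      ∎
    where open ≤-Reasoning
  children-weight j x@(R@(_ ∷ _) , r , B) u = begin
    2 + total (weight j) (children x)
      ≡⟨ cong (2 +_) (trans (total-concat (weight j) (map (λ b → map (child x b) (family x b)) bs))
           (total-map (total (weight j)) (λ b → map (child x b) (family x b)) bs)) ⟩
    2 + total (λ b → total (weight j) (map (child x b) (family x b))) bs
      ≤⟨ +-monoʳ-≤ 2 (total-≤ _ bs λ {b} b∈ → per-size b (≤ᵇ⇒≤ b r (proj₂ (∈-filterᵇ⁻ (λ b → b ≤ᵇ r) (downFrom (suc L)) b∈)))) ⟩
    2 + length bs * m
      ≤⟨ +-mono-≤ (*-mono-≤ (*-monoʳ-≤ 2 (m^n>0 2 r)) (1≤branching^ j)) (*-monoˡ-≤ m bs≤) ⟩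
    2 * 2 ^ r * branching ^ j + suc L * m
      ≡⟨ lemma (suc L) (suc (L + L)) (2 * 2 ^ r) (branching ^ j) ⟩
    2 * 2 ^ r * branching ^ suc j ∎
    where
    open ≤-Reasoning
    bs = filterᵇ (λ b → b ≤ᵇ r) (downFrom (suc L))
    m = suc (L + L) * (2 * 2 ^ r * branching ^ j)
    bs≤ : length bs ≤ suc L
    bs≤ = ≤-trans (List.length-filter (λ b → T? (b ≤ᵇ r)) (downFrom (suc L))) (≤-reflexive (List.length-downFrom (suc L)))
    blk≤ : length (take L R) ≤ L
    blk≤ = ≤-trans (≤-reflexive (List.length-take L R)) (m⊓n≤m L (length R))
    lemma : ∀ a b c d → c * d + a * (b * (c * d)) ≡ c * (suc (a * b) * d)
    lemma = solve-∀
    lemma′ : ∀ a b c d → a * b * (2 * c * d) ≡ a * (2 * (b * c) * d)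
    lemma′ = solve-∀
    per-size : ∀ b → b ≤ r → total (weight j) (map (child x b) (family x b)) ≤ m
    per-size b b≤r = begin
      total (weight j) (map (child x b) (family x b))
        ≡⟨ total-map (weight j) (child x b) (family x b) ⟩
      total (λ _ → 2 * 2 ^ (r ∸ b) * branching ^ j) (family x b)
        ≤⟨ total-≤ _ (family x b) (λ _ → ≤-refl) ⟩
      length (family x b) * (2 * 2 ^ (r ∸ b) * branching ^ j)
        ≤⟨ *-monoˡ-≤ _ (FamilyProperties.length-family (take L R) b (Unique.take⁺ L u)) ⟩
      suc (length (take L R) + length (take L R)) * 2 ^ b * (2 * 2 ^ (r ∸ b) * branching ^ j)
        ≤⟨ *-monoˡ-≤ _ (*-monoˡ-≤ (2 ^ b) (s≤s (+-mono-≤ blk≤ blk≤))) ⟩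
      suc (L + L) * 2 ^ b * (2 * 2 ^ (r ∸ b) * branching ^ j)
        ≡⟨ lemma′ (suc (L + L)) (2 ^ b) (2 ^ (r ∸ b)) (branching ^ j) ⟩
      suc (L + L) * (2 * (2 ^ b * 2 ^ (r ∸ b)) * branching ^ j)
        ≡⟨ cong (λ p → suc (L + L) * (2 * p * branching ^ j))
             (trans (sym (^-distribˡ-+-* 2 b (r ∸ b))) (cong (2 ^_) (m+[n∸m]≡n b≤r))) ⟩
      m ∎

  module _ (good : Node → Bool) (small : Node → Set) (s : ℕ) (sized : ∀ x → size NodeTy x ≤ s → small x) where

    Bounded : ℕ → List Node → Set
    Bounded j xs = ∀ {x} → x ∈ xs → Unique (undecided x) × length (undecided x) ≤ j * L × size NodeTy x ≤ s

    private
      Outcome : List Node → ℕ → Set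
      Outcome xs m = ∃[ b ] ∃[ t ] Explores children good small xs b t × t ≤ m

      bounded-children : ∀ {j x} → Unique (undecided x) → length (undecided x) ≤ suc j * L → size NodeTy x ≤ s →
                         Bounded j (children x)
      bounded-children {j} {R , r , B} u R≤ x≤s y∈ with b , b≤r , v , v∈ , refl ← children-⁻ {R} {r} {B} y∈ =
        Unique.drop⁺ L u ,
        ≤-trans (≤-reflexive (List.length-drop L R)) (≤-trans (∸-monoˡ-≤ L R≤) (≤-reflexive (m+n∸m≡n L (j * L)))) ,
        ≤-trans (child-size {R} {r} {B} u v∈) x≤s

    mutual
      -- Recursion on the number of undecided blocks yields both the finite exploration and its
      -- length; at `j = 0` nothing is undecided and there are no children.
      explored : ∀ j xs → Bounded j xs → Outcome xs (1 + total (weight j) xs)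
      explored j []       bd = false , 1 , [] , ≤-refl
      explored j (x ∷ xs) bd
        with u , R≤ , x≤s ← bd (here refl)
        with b , t , e , t≤ ← explored-below j x u R≤ x≤s
        with c , t′ , f , t′≤ ← explored j xs (bd ∘ there) =
        _ , _ , node (sized x x≤s) e f , ≤-trans (+-mono-≤ t≤ t′≤) (≤-reflexive (+-suc _ _))

      explored-below : ∀ j x → Unique (undecided x) → length (undecided x) ≤ j * L → size NodeTy x ≤ s →
                       ∃[ b ] ∃[ t ] Explores children good small (children x) b t × suc t ≤ weight j x
      explored-below zero ([] , r , B) _ _ _ = false , 1 , [] ,
        ≤-trans (*-monoʳ-≤ 2 (m^n>0 2 r)) (≤-reflexive (sym (*-identityʳ (2 * 2 ^ r))))
      explored-below (suc j) x u R≤ x≤s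
        with b , t , e , t≤ ← explored j (children x) (bounded-children {j} {x} u R≤ x≤s) =
        b , t , e , ≤-trans (s≤s t≤) (children-weight j x u)

  module _ (c : ℕ → Maybe Bool) (good : Node → Bool) (accept : List ℕ → Set)
           (accept-good : ∀ {r B} → accept B → T (good ([] , r , B))) where

    -- The invariant of the descent: the landmarks chosen so far are right, in that any completion
    -- which meets the demands on the undecided vertices `R` is accepted.
    Accepting : List ℕ → List ℕ → Set
    Accepting R B = ∀ B′ → (∀ {x} → x ∉ R → member x B′ ≡ member x B) →
                    (∀ {x β} → (x , β) ∈ demands c R → member x B′ ≡ β) → accept B′

    -- In each block the descent takes for `b` the exact number of its demands and for `v` a member
    -- of the universal family that meets them. As `R` is disjoint from `B`, membership of block
    -- vertices in `v ++ B` is decided by `v`, and that of vertices outside `R` by `B`.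
    found : ∀ j {R r B} → length R ≤ j → Unique R → (∀ {x} → x ∈ R → x ∉ B) →
            length (demands c R) ≤ r → Accepting R B → Found children good ((R , r , B) ∷ [])
    found j {[]} {r} {B} _ _ _ _ acc = here (here refl) (accept-good (acc B (λ _ → refl) λ ()))
    found (suc j) {R@(x₀ ∷ R₀)} {r} {B} (s≤s R₀≤j) u R#B few acc
      with v , v∈ , compat ← FamilyProperties.family-universal (take L R) (length (demands c (take L R)))
             (Unique.take⁺ L u) (demands-assignment c (take L R)) ≤-refl =
      below (here refl) (found-child (children-⁺ b≤r b≤L v∈)
        -- Since `L` is the successor of `lg k`, dropping `L` vertices from `x₀ ∷ R₀` drops `lg k`
        -- from `R₀`, and the length decreases strictly.
        (found j (≤-trans (≤-reflexive (List.length-drop (lg k) R₀)) (≤-trans (m∸n≤m (length R₀) (lg k)) R₀≤j))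
               (Unique.drop⁺ L u) rest#B fewer acc′))
      where
      blk rest : List ℕ
      blk = take L R
      rest = drop L R
      R≡ : blk ++ rest ≡ R
      R≡ = List.take++drop≡id L R
      b = length (demands c blk)
      demands-R : demands c R ≡ demands c blk ++ demands c rest
      demands-R = trans (cong (demands c) (sym R≡)) (demands-++ c blk rest)
      b+≤ : b + length (demands c rest) ≤ r
      b+≤ = subst (_≤ r) (trans (cong length demands-R) (List.length-++ (demands c blk))) few
      b≤r : b ≤ r
      b≤r = ≤-trans (m≤m+n b _) b+≤
      b≤L : b ≤ L
      b≤L = ≤-trans (demands-≤ c blk) (≤-trans (≤-reflexive (List.length-take L R)) (m⊓n≤m L (length R)))
      fewer : length (demands c rest) ≤ r ∸ b
      fewer = m+n≤o⇒n≤o∸m b b+≤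
        where
        m+n≤o⇒n≤o∸m : ∀ m {n o} → m + n ≤ o → n ≤ o ∸ m
        m+n≤o⇒n≤o∸m m {n} {o} le = ≤-trans (≤-reflexive (sym (m+n∸m≡n m n))) (∸-monoˡ-≤ m le)
      v⊆blk : ∀ {y} → y ∈ v → y ∈ blk
      v⊆blk = family-⊆ R r B u v∈
      blk#rest : ∀ {y} → y ∈ blk → y ∉ rest
      blk#rest = disjoint blk (subst Unique (sym R≡) u)
        where
        disjoint : ∀ xs {ys : List ℕ} → Unique (xs ++ ys) → ∀ {y} → y ∈ xs → y ∉ ys
        disjoint (x ∷ xs) (x# ∷ u) (here refl) y∈ys = All.lookup x# (∈-++⁺ʳ xs y∈ys) refl
        disjoint (x ∷ xs) (x# ∷ u) (there y∈)  y∈ys = disjoint xs u y∈ y∈ys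
      blk⊆R : ∀ {y} → y ∈ blk → y ∈ R
      blk⊆R {y} y∈ = subst (y ∈_) R≡ (∈-++⁺ˡ y∈)
      rest⊆R : ∀ {y} → y ∈ rest → y ∈ R
      rest⊆R {y} y∈ = subst (y ∈_) R≡ (∈-++⁺ʳ blk y∈)
      rest#B : ∀ {y} → y ∈ rest → y ∉ v ++ B
      rest#B y∈ y∈vB with ∈-++⁻ v y∈vB
      ... | inj₁ y∈v = blk#rest (v⊆blk y∈v) y∈
      ... | inj₂ y∈B = R#B (rest⊆R y∈) y∈B
      acc′ : Accepting rest (v ++ B)
      acc′ B′ outside meets = acc B′
        (λ {x} x∉R → trans (outside (x∉R ∘ rest⊆R)) (member-cong (v ++ B) B (from-B x∉R) (∈-++⁺ʳ v)))
        meet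
        where
        from-B : ∀ {x} → x ∉ R → x ∈ v ++ B → x ∈ B
        from-B x∉R x∈ with ∈-++⁻ v x∈
        ... | inj₁ x∈v = contradiction (blk⊆R (v⊆blk x∈v)) x∉R
        ... | inj₂ x∈B = x∈B
        in-blk : ∀ {x} → x ∈ blk → x ∈ v ++ B → x ∈ v
        in-blk x∈ x∈vB with ∈-++⁻ v x∈vB
        ... | inj₁ x∈v = x∈v
        ... | inj₂ x∈B = contradiction x∈B (R#B (blk⊆R x∈))
        meet : ∀ {x β} → (x , β) ∈ demands c R → member x B′ ≡ β
        meet d with ∈-++⁻ (demands c blk) (subst (_ ∈_) demands-R d)
        ... | inj₂ d′ = meets d′
        ... | inj₁ d′ = trans (outside (blk#rest x∈blk))
                          (trans (member-cong (v ++ B) v (in-blk x∈blk) ∈-++⁺ˡ) (compatible-sound {v} compat d′))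
          where x∈blk = proj₁ (demands-⁻ c blk d′)
      found-child : ∀ {y ys} → y ∈ ys → Found children good (y ∷ []) → Found children good ys
      found-child y∈ (here (here refl) g)  = here y∈ g
      found-child y∈ (below (here refl) f) = below y∈ f

-- Programs for the parts of the algorithm

size-filter : ∀ {σ} (p : El σ → Bool) xs → size (list σ) (filterᵇ p xs) ≤ size (list σ) xs
size-filter p [] = z≤n
size-filter {σ} p (x ∷ xs) with p x
... | true  = s≤s (+-monoʳ-≤ (size σ x) (size-filter p xs))
... | false = m≤n⇒m≤1+n (≤-trans (size-filter p xs) (m≤n+m _ (size σ x)))

size-∈ : ∀ {σ} {x : El σ} {xs} → x ∈ xs → size σ x ≤ size (list σ) xs
size-∈ {σ} (here refl) = m≤n⇒m≤1+n (m≤m+n _ _)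
size-∈ {σ} (there {x = y} x∈) = m≤n⇒m≤1+n (≤-trans (size-∈ x∈) (m≤n+m _ (size σ y)))

size-bit : ∀ β → size bool β ≤ 1
size-bit true  = ≤-refl
size-bit false = z≤n

MatrixTy : Ty
MatrixTy = list (list bool)

module _ {Γ : Ctx} where

  edgeC : ∀ {M u v} → Comp Γ MatrixTy M → Comp Γ nat u → Comp Γ nat v →
          Comp Γ bool (λ ρ → edge (M ρ) (u ρ) (v ρ))
  edgeC M u v = whenConsC (dropC v (whenConsC (dropC u M) []C v0)) falseC v0

  vertexListC : ∀ {M} → Comp Γ MatrixTy M → Comp Γ (list nat) (vertexList ∘ M)
  vertexListC M = downFromC (lengthC M)

module _ {Γ : Ctx} where

  ballC : ∀ {M u ℓ} → Comp Γ MatrixTy M → Comp Γ nat u → Comp Γ nat ℓ →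
          Comp Γ (list nat) (λ ρ → ball (M ρ) (u ρ) (ℓ ρ))
  ballC {M} Mc u ℓ = foldC ℓ (u ∷C []C)
    (filterC (vertexListC (↑ Mc)) (memberC v0 v1 ∨C anyC v1 (edgeC (↑ ↑ ↑ Mc) v0 v1)))
    (size-small (vertexListC Mc))
    λ b ρ → ≤-trans (size-filter _ (vertexList (M ρ))) (m≤n+m _ (size (list nat) b))

module _ {Γ : Ctx} where

  sameDistanceC : ∀ {M z x y} → Comp Γ MatrixTy M → Comp Γ nat z → Comp Γ nat x → Comp Γ nat y →
                  Comp Γ bool (λ ρ → sameDistance (M ρ) (z ρ) (x ρ) (y ρ))
  sameDistanceC M z x y = allC (downFromC (lengthC M))
    (notC (memberC (↑ x) (ballC (↑ M) (↑ z) v0) xorC memberC (↑ y) (ballC (↑ M) (↑ z) v0)))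

module _ {Γ : Ctx} where

  separatesC : ∀ {M B x y} → Comp Γ MatrixTy M → Comp Γ (list nat) B → Comp Γ nat x → Comp Γ nat y →
               Comp Γ bool (λ ρ → Separation.separates (sameDistance (M ρ)) (B ρ) (x ρ) (y ρ))
  separatesC M B x y = anyC B (notC (sameDistanceC (↑ M) v0 (↑ x) (↑ y)))

module _ {Γ : Ctx} where

  representativesC : ∀ {M B xs} → Comp Γ MatrixTy M → Comp Γ (list nat) B → Comp Γ (list nat) xs →
                     Comp Γ (list nat) (λ ρ → Separation.representatives (sameDistance (M ρ)) (B ρ) (xs ρ))
  representativesC {M} {B} Mc Bc xs =
    foldr⁺C {g = λ (x , acc , ρ) → if all (Separation.separates (sameDistance (M ρ)) (B ρ) x) acc then x ∷ acc else acc}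
      xs []C (ifC (allC v1 (separatesC (↑ ↑ ↑ Mc) (↑ ↑ ↑ Bc) v1 v0)) (v0 ∷C v1) v1) (suc≼ (size-small v0))
      λ x acc ρ → grows x acc (all (Separation.separates (sameDistance (M ρ)) (B ρ) x) acc)
    where
    grows : ∀ x acc b → size (list nat) (if b then x ∷ acc else acc) ≤ size (list nat) acc + suc (size nat x)
    grows x acc true  = ≤-reflexive (trans (cong suc (+-comm (size nat x) _)) (sym (+-suc _ _)))
    grows x acc false = m≤m+n _ _

  infixl 7 _∖C_

  _∖C_ : ∀ {xs ys} → Comp Γ (list nat) xs → Comp Γ (list nat) ys → Comp Γ (list nat) (λ ρ → xs ρ ∖ ys ρ)
  xs ∖C ys = filterC xs (notC (memberC v0 (↑ ys)))

PartsTy : Ty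
PartsTy = list nat ⊗ list nat

module _ {Γ : Ctx} {M : Env Γ → Matrix} where

  private
    module G (ρ : Env Γ) = Greedy (sameDistance (M ρ)) (vertexList (M ρ))

  extendsC : ∀ {st z u} → Comp Γ MatrixTy M → Comp Γ PartsTy st → Comp Γ nat z → Comp Γ nat u →
             Comp Γ bool (λ ρ → G.extends ρ (st ρ) (z ρ , u ρ))
  extendsC M st z u =
    notC (memberC u (fstC st ++C sndC st)) ∧C notC (memberC z (fstC st ++C sndC st)) ∧C notC (z ≡ᵇC u) ∧C
    allC (fstC st) (separatesC (↑ M) (↑ z ∷C sndC (↑ st)) (↑ u) v0)

  pairsC : Comp Γ MatrixTy M → Comp Γ (list (nat ⊗ nat)) G.pairs
  pairsC M = concatC (mapC (vertexListC M) (mapC (vertexListC (↑ M)) (v0 ,C v1)))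

module _ {Γ : Ctx} {M : Env Γ → Matrix} where

  private
    module G (ρ : Env Γ) = Greedy (sameDistance (M ρ)) (vertexList (M ρ))

  extendC : ∀ {st} → Comp Γ MatrixTy M → Comp Γ PartsTy st → Comp Γ PartsTy (λ ρ → G.extend ρ (st ρ))
  extendC M st = whenConsC (filterC (pairsC M) (extendsC (↑ M) (↑ st) (fstC v0) (sndC v0))) st
    ((sndC v0 ∷C fstC (↑ st)) ,C (fstC v0 ∷C sndC (↑ st)))

module _ {Γ : Ctx} {M : Env Γ → Matrix} where

  private
    module G (ρ : Env Γ) = Greedy (sameDistance (M ρ)) (vertexList (M ρ))

  -- A move adds one entry of `pairs`, whose size does not depend on the state, so the growth is
  -- additive.
  greedyC : ∀ {k} → Comp Γ MatrixTy M → Comp Γ nat k → Comp Γ PartsTy (λ ρ → G.greedy ρ (k ρ))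
  greedyC M k = foldC k ([]C ,C []C) (extendC (↑ M) v0) (suc≼ (suc≼ (size-small (pairsC M)))) λ st ρ → grows st ρ
    where
    added : ∀ st (zus : List (ℕ × ℕ)) →
            size PartsTy (foldr (λ (z , u) _ → u ∷ proj₁ st , z ∷ proj₂ st) st zus) ≤
            size PartsTy st + suc (suc (size (list (nat ⊗ nat)) zus))
    added st       []              = m≤m+n _ 2
    added (P , W) ((z , u) ∷ zus) = s≤s (begin
      suc (size nat u + p) + suc (size nat z + w)     ≡⟨ lemma (size nat u) (size nat z) p w ⟩
      p + w + suc (suc (size nat z + size nat u))     ≤⟨ +-monoʳ-≤ (p + w) (s≤s (s≤s (m≤n⇒m≤1+n (m≤n⇒m≤1+n (m≤m+n _ (size (list (nat ⊗ nat)) zus)))))) ⟩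
      p + w + suc (suc (suc (suc (size nat z + size nat u + size (list (nat ⊗ nat)) zus)))) ∎)
      where
      open ≤-Reasoning
      p = size (list nat) P
      w = size (list nat) W
      lemma : ∀ a b c d → suc (a + c) + suc (b + d) ≡ c + d + suc (suc (b + a))
      lemma = solve-∀
    grows : ∀ st ρ → size PartsTy (G.extend ρ st) ≤ size PartsTy st + suc (suc (size (list (nat ⊗ nat)) (G.pairs ρ)))
    grows st ρ = ≤-trans (added st (filterᵇ (G.extends ρ st) (G.pairs ρ)))
      (+-monoʳ-≤ (size PartsTy st) (s≤s (s≤s (size-filter (G.extends ρ st) (G.pairs ρ)))))

  coreC : ∀ {k} → Comp Γ MatrixTy M → Comp Γ nat k → Comp Γ (list nat) (λ ρ → G.core ρ (k ρ))
  coreC M k = fstC (greedyC M k) ++C sndC (greedyC M k)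

  twinRepresentativesC : ∀ {k} → Comp Γ MatrixTy M → Comp Γ nat k →
                         Comp Γ (list nat) (λ ρ → G.twinRepresentatives ρ (k ρ))
  twinRepresentativesC M k = representativesC M (coreC M k) (vertexListC M ∖C coreC M k)

  kernelC : ∀ {k} → Comp Γ MatrixTy M → Comp Γ nat k → Comp Γ (list nat) (λ ρ → G.kernel ρ (k ρ))
  kernelC M k = takeC (k +C k +C k) (coreC M k ++C twinRepresentativesC M k)

  candidatesC : ∀ {k B} → Comp Γ MatrixTy M → Comp Γ nat k → Comp Γ (list nat) B →
                Comp Γ (list nat) (λ ρ → G.candidates ρ (k ρ) (B ρ))
  candidatesC M k B = kernelC M k ∖C B

  landmarksC : ∀ {k B} → Comp Γ MatrixTy M → Comp Γ nat k → Comp Γ (list nat) B →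
               Comp Γ (list nat) (λ ρ → G.landmarks ρ (k ρ) (B ρ))
  landmarksC M k B = vertexListC M ∖C candidatesC M k B

  acceptsC : ∀ {k B} → Comp Γ MatrixTy M → Comp Γ nat k → Comp Γ (list nat) B →
             Comp Γ bool (λ ρ → G.accepts ρ (k ρ) (B ρ))
  acceptsC M k B = (k ≤ᵇC lengthC (fstC (greedyC M k))) ∨C (k ≤ᵇC lengthC (twinRepresentativesC M k)) ∨C
                   (k ≤ᵇC lengthC (representativesC M (landmarksC M k B) (candidatesC M k B)))

AssignmentTy : Ty
AssignmentTy = list (nat ⊗ bool)

size-sublists : ∀ xs → size (list (list nat)) (sublists xs) ≤ 2 ^ length xs * suc (size (list nat) xs)
size-sublists []       = ≤-refl
size-sublists (x ∷ xs) = begin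
  size (list (list nat)) (sublists xs ++ map (x ∷_) (sublists xs))
    ≡⟨ size-++ (list nat) (sublists xs) _ ⟩
  S + size (list (list nat)) (map (x ∷_) (sublists xs))
    ≡⟨ cong (S +_) (size-map (sublists xs)) ⟩
  S + (S + length (sublists xs) * suc (size nat x))
    ≡⟨ cong (λ m → S + (S + m * suc (size nat x))) (length-sublists xs) ⟩
  S + (S + 2 ^ length xs * suc (size nat x))
    ≤⟨ +-mono-≤ (size-sublists xs) (+-mono-≤ (size-sublists xs) (*-monoʳ-≤ (2 ^ length xs) (s≤s (m≤m+n (size nat x) (size nat x))))) ⟩
  P * suc s + (P * suc s + P * suc (size nat x + size nat x))
    -- The added term is the exact difference to the right-hand side, so that an identity of
    -- polynomials remains.
    ≤⟨ m≤m+n _ P ⟩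
  P * suc s + (P * suc s + P * suc (size nat x + size nat x)) + P
    ≡⟨ lemma P s (size nat x) ⟩
  2 * P * suc (suc (size nat x + s)) ∎
  where
  open ≤-Reasoning
  S = size (list (list nat)) (sublists xs)
  P = 2 ^ length xs
  s = size (list nat) xs
  size-map : ∀ vs → size (list (list nat)) (map (x ∷_) vs) ≡ size (list (list nat)) vs + length vs * suc (size nat x)
  size-map []       = refl
  size-map (v ∷ vs) rewrite size-map vs =
    lemma′ (size nat x) (size (list nat) v) (size (list (list nat)) vs) (length vs * suc (size nat x))
    where
    lemma′ : ∀ a b c d → suc (suc (a + b) + (c + d)) ≡ suc (b + c) + (suc a + d)
    lemma′ = solve-∀
  lemma : ∀ P s a → P * suc s + (P * suc s + P * suc (a + a)) + P ≡ 2 * P * suc (suc (a + s))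
  lemma = solve-∀

size-assignments : ∀ xs → size (list AssignmentTy) (assignments xs) ≤
                          2 ^ (length xs + length xs) * suc (3 * size (list nat) xs)
size-assignments []       = ≤-refl
size-assignments (x ∷ xs) = begin
  size (list AssignmentTy) (a ++ (map ((x , true) ∷_) a ++ map ((x , false) ∷_) a))
    ≡⟨ trans (size-++ AssignmentTy a _) (cong (S +_) (size-++ AssignmentTy (map ((x , true) ∷_) a) _)) ⟩
  S + (size (list AssignmentTy) (map ((x , true) ∷_) a) + size (list AssignmentTy) (map ((x , false) ∷_) a))
    ≤⟨ +-mono-≤ (size-assignments xs) (+-mono-≤ (each true) (each false)) ⟩
  P * suc (3 * s) + (P * (4 + 3 * s + z) + P * (4 + 3 * s + z))
    ≤⟨ m≤m+n _ (P * (7 + 3 * s + 10 * z)) ⟩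
  P * suc (3 * s) + (P * (4 + 3 * s + z) + P * (4 + 3 * s + z)) + P * (7 + 3 * s + 10 * z)
    ≡⟨ lemma P s z ⟩
  4 * P * suc (3 * suc (z + s))
    ≡⟨ cong (_* suc (3 * suc (z + s))) (trans (*-assoc 2 2 P) (cong (λ m → 2 ^ suc m) (sym (+-suc (length xs) (length xs))))) ⟩
  2 ^ (suc (length xs) + suc (length xs)) * suc (3 * suc (z + s)) ∎
  where
  open ≤-Reasoning
  a = assignments xs
  S = size (list AssignmentTy) a
  P = 2 ^ (length xs + length xs)
  s = size (list nat) xs
  z = size nat x
  lemma : ∀ P s z → P * suc (3 * s) + (P * (4 + 3 * s + z) + P * (4 + 3 * s + z)) + P * (7 + 3 * s + 10 * z) ≡
                    4 * P * suc (3 * suc (z + s))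
  lemma = solve-∀
  each : ∀ β → size (list AssignmentTy) (map ((x , β) ∷_) a) ≤ P * (4 + 3 * s + z)
  each β = begin
    size (list AssignmentTy) (map ((x , β) ∷_) a)  ≤⟨ go a ⟩
    S + length a * (3 + z)                         ≤⟨ +-mono-≤ (size-assignments xs) (*-monoˡ-≤ (3 + z) (length-assignments xs)) ⟩
    P * suc (3 * s) + P * (3 + z)                  ≡⟨ lemma′ P s z ⟩
    P * (4 + 3 * s + z)                            ∎
    where
    lemma′ : ∀ P s z → P * suc (3 * s) + P * (3 + z) ≡ P * (4 + 3 * s + z)
    lemma′ = solve-∀
    lemma″ : ∀ t l r b → suc (suc (suc (z + b) + t) + (l + r)) ≡ suc (t + l) + (2 + b + z + r)
    lemma″ t l r b = solve z t l r b
      where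
      solve : ∀ z t l r b → suc (suc (suc (z + b) + t) + (l + r)) ≡ suc (t + l) + (2 + b + z + r)
      solve = solve-∀
    go : ∀ τs → size (list AssignmentTy) (map ((x , β) ∷_) τs) ≤ size (list AssignmentTy) τs + length τs * (3 + z)
    go []       = z≤n
    go (τ ∷ τs) = ≤-trans (s≤s (+-monoʳ-≤ (suc (suc (z + size bool β) + size AssignmentTy τ)) (go τs)))
      (≤-trans (≤-reflexive (lemma″ (size AssignmentTy τ) (size (list AssignmentTy) τs) (length τs * (3 + z)) (size bool β)))
               (+-monoʳ-≤ (suc (size AssignmentTy τ + size (list AssignmentTy) τs))
                 (+-monoˡ-≤ (length τs * (3 + z)) (+-monoˡ-≤ z (+-monoʳ-≤ 2 (size-bit β))))))

module _ {Γ : Ctx} where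

  lgC : ∀ {k} → Comp Γ nat k → Comp Γ nat (lg ∘ k)
  lgC {k} kc = sndC (foldC kc (sucC 0C ,C 0C)
    (ifC ((fstC v0 +C fstC v0) ≤ᵇC sucC (↑ kc)) ((fstC v0 +C fstC v0) ,C sucC (sndC v0)) v0)
    (suc≼ (suc≼ (size-small kc))) λ (p , e) ρ → grows p e ρ)
    where
    grows : ∀ p e ρ →
            size (nat ⊗ nat) (if p + p ≤ᵇ suc (k ρ) then (p + p , suc e) else (p , e)) ≤
            size (nat ⊗ nat) (p , e) + suc (suc (size nat (k ρ)))
    grows p e ρ with p + p ≤ᵇ suc (k ρ) in eq
    ... | false = m≤m+n _ _
    ... | true rewrite size-nat (p + p) | size-nat p | size-nat e | size-nat (k ρ) =
      s≤s (≤-trans (≤-reflexive (lemma p e)) (+-monoʳ-≤ (p + e) (s≤s (≤-trans (m≤m+n p p) (≤ᵇ⇒≤ (p + p) (suc (k ρ)) (subst T (sym eq) _))))))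
      where
      lemma : ∀ p e → p + p + suc e ≡ p + e + suc p
      lemma = solve-∀

  compatibleC : ∀ {v τ} → Comp Γ (list nat) v → Comp Γ AssignmentTy τ →
                Comp Γ bool (λ ρ → compatible (v ρ) (τ ρ))
  compatibleC v τ = allC τ (notC (memberC (fstC v0) (↑ v) xorC sndC v0))

-- `sublists` doubles and `assignments` triples its list with every vertex. Both are polynomial only
-- through `short`, that is, because blocks have logarithmic length.
module FamilyC {Γ : Ctx} {blk : Env Γ → List ℕ} (blkC : Comp Γ (list nat) blk)
               (short : (λ ρ → 2 ^ length (blk ρ)) ≼ width Γ) where

  private
    suffix-length : ∀ {A : Set} {xs : List A} ys zs → xs ≡ ys ++ zs → length zs ≤ length xs
    suffix-length ys zs refl = ≤-trans (m≤n+m _ (length ys)) (≤-reflexive (sym (List.length-++ ys)))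

    suffix-size : ∀ {xs : List ℕ} ys zs → xs ≡ ys ++ zs → size (list nat) zs ≤ size (list nat) xs
    suffix-size ys zs refl = ≤-trans (m≤n+m _ (size (list nat) ys)) (≤-reflexive (sym (size-++ nat ys zs)))

  sublistsC : Comp Γ (list (list nat)) (sublists ∘ blk)
  sublistsC = foldrC {g = λ (x , acc , ρ) → acc ++ map (x ∷_) acc} blkC ([]C ∷C []C)
    (v1 ++C mapC v1 (v1 ∷C v0)) (≼-* short (suc≼ (size-small blkC))) λ ρ ys zs eq →
    ≤-trans (size-sublists zs) (*-mono-≤ (^-monoʳ-≤ 2 (suffix-length ys zs eq)) (s≤s (suffix-size ys zs eq)))

  assignmentsC : Comp Γ (list AssignmentTy) (assignments ∘ blk)
  assignmentsC = foldrC {g = λ (x , acc , ρ) → acc ++ (map ((x , true) ∷_) acc ++ map ((x , false) ∷_) acc)}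
    blkC ([]C ∷C []C) (v1 ++C (mapC v1 ((v1 ,C trueC) ∷C v0) ++C mapC v1 ((v1 ,C falseC) ∷C v0)))
    (≼-* (≼-* short short) (suc≼ (≼-* (const≼ 3) (size-small blkC)))) λ ρ ys zs eq →
    ≤-trans (size-assignments zs) (*-mono-≤
      (≤-trans (^-monoʳ-≤ 2 (+-mono-≤ (suffix-length ys zs eq) (suffix-length ys zs eq)))
               (≤-reflexive (^-distribˡ-+-* 2 (length (blk ρ)) (length (blk ρ)))))
      (s≤s (*-monoʳ-≤ 3 (suffix-size ys zs eq))))

module _ {Γ : Ctx} {blk : Env Γ → List ℕ} {b : Env Γ → ℕ} where

  private
    module F (ρ : Env Γ) = Family (blk ρ) (b ρ)

  bestC : ∀ {τs} → Comp Γ (list (list nat)) (sublists ∘ blk) → Comp Γ (list AssignmentTy) τs →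
          Comp Γ (list nat) (λ ρ → F.best ρ (τs ρ))
  bestC {τs} s τsC = foldr⁺C {g = λ (v , w , ρ) → if F.hits ρ (τs ρ) w ≤ᵇ F.hits ρ (τs ρ) v then v else w} s []C
    (ifC (lengthC (filterC (↑ ↑ τsC) (compatibleC v2 v0)) ≤ᵇC lengthC (filterC (↑ ↑ τsC) (compatibleC v1 v0))) v0 v1)
    (size-small v0) λ v w ρ → grows v w (F.hits ρ (τs ρ) w ≤ᵇ F.hits ρ (τs ρ) v)
    where
    grows : ∀ v w c → size (list nat) (if c then v else w) ≤ size (list nat) w + size (list nat) v
    grows v w true  = m≤n+m _ (size (list nat) w)
    grows v w false = m≤m+n _ _

  chooseC : ∀ {st} → Comp Γ (list (list nat)) (sublists ∘ blk) → Comp Γ (list AssignmentTy ⊗ list (list nat)) st →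
            Comp Γ (list AssignmentTy ⊗ list (list nat)) (λ ρ → F.choose ρ (st ρ))
  chooseC s st = ifC (nullC (fstC st)) st
    (filterC (fstC st) (notC (compatibleC (↑ bestC s (fstC st)) v0)) ,C (bestC s (fstC st) ∷C sndC st))

module _ {Γ : Ctx} {blk : Env Γ → List ℕ} {b : Env Γ → ℕ} (blkC : Comp Γ (list nat) blk)
         (short : (λ ρ → 2 ^ length (blk ρ)) ≼ width Γ) (bC : Comp Γ nat b) where

  private
    module F (ρ : Env Γ) = Family (blk ρ) (b ρ)
    open FamilyC blkC short

    constraintsC : Comp Γ (list AssignmentTy) F.constraints
    constraintsC = filterC assignmentsC (lengthC v0 ≤ᵇC ↑ bC)

    StTy : Ty
    StTy = list AssignmentTy ⊗ list (list nat)

    grows : ∀ st ρ → size StTy (F.choose ρ st) ≤ size StTy st + suc (size (list (list nat)) (sublists (blk ρ)))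
    grows ([] , vs)          ρ = m≤m+n _ _
    grows (τs@(_ ∷ _) , vs) ρ = s≤s (begin
      size (list AssignmentTy) (filterᵇ (λ τ → not (compatible (F.best ρ τs) τ)) τs) + suc (size (list nat) (F.best ρ τs) + w)
        ≤⟨ +-mono-≤ (size-filter (λ τ → not (compatible (F.best ρ τs) τ)) τs) (s≤s (+-monoˡ-≤ w (best≤ (F.best-∈ ρ τs (sublists (blk ρ)))))) ⟩
      t + suc (s + w)
        ≡⟨ lemma t s w ⟩
      t + w + suc s ∎)
      where
      open ≤-Reasoning
      t = size (list AssignmentTy) τs
      w = size (list (list nat)) vs
      s = size (list (list nat)) (sublists (blk ρ))
      lemma : ∀ t s w → t + suc (s + w) ≡ t + w + suc s
      lemma = solve-∀
      best≤ : ∀ {v} → v ∈ [] ∷ sublists (blk ρ) → size (list nat) v ≤ s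
      best≤ (here refl) = z≤n
      best≤ (there v∈)  = size-∈ v∈

  familyC : Comp Γ (list (list nat)) F.family
  familyC = sndC (foldC (lengthC constraintsC) (constraintsC ,C []C) (chooseC {blk = blk ∘ proj₂} {b ∘ proj₂} (↑ sublistsC) v0)
    (suc≼ (size-small sublistsC)) λ st ρ → grows st ρ)

module _ {Γ : Ctx} {k : Env Γ → ℕ} {x : Env Γ → Node} (kC : Comp Γ nat k) (xC : Comp Γ NodeTy x) where

  blockLengthC : Comp Γ nat (blockLength ∘ k)
  blockLengthC = sucC (lgC kC)

  blockC : Comp Γ (list nat) (λ ρ → take (blockLength (k ρ)) (undecided (x ρ)))
  blockC = takeC blockLengthC (fstC xC)

  -- `2 ^ blockLength k` is at most `2 * (k + 1)`, and `k` is its own size in unary.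
  block-short : (λ ρ → 2 ^ length (take (blockLength (k ρ)) (undecided (x ρ)))) ≼ width Γ
  block-short = ≼-below (λ ρ → ≤-trans
      (^-monoʳ-≤ 2 (≤-trans (≤-reflexive (List.length-take (blockLength (k ρ)) (undecided (x ρ)))) (m⊓n≤m _ (length (undecided (x ρ))))))
      (*-monoʳ-≤ 2 (≤-trans (2^lg≤ (k ρ)) (≤-reflexive (cong suc (sym (size-nat (k ρ))))))))
    (≼-* (const≼ 2) (suc≼ (size-small kC)))

module _ {Γ : Ctx} {k : Env Γ → ℕ} {x : Env Γ → Node} where

  childrenC : Comp Γ nat k → Comp Γ NodeTy x → Comp Γ (list NodeTy) (λ ρ → SearchTree.children (k ρ) (x ρ))
  childrenC kC xC = ifC (nullC (fstC xC)) []C (concatC (mapC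
    (filterC (downFromC (sucC (blockLengthC kC xC))) (v0 ≤ᵇC fstC (sndC (↑ xC))))
    (mapC (familyC (blockC (↑ kC) (↑ xC)) (block-short (↑ kC) (↑ xC)) v0)
          (dropC (blockLengthC (↑ ↑ kC) (↑ ↑ xC)) (fstC (↑ ↑ xC)) ,C
            ((fstC (sndC (↑ ↑ xC)) ∸C v1) ,C (v0 ++C sndC (sndC (↑ ↑ xC))))))))

-- The subexponential overhead

blocks : ℕ → ℕ
blocks k = suc ((k + k + k) / blockLength k)

-- The function `f` of the theorem, an exponent with `branching ^ blocks ≤ 4 ^ overhead`. The factor
-- `2 + lg L` arises since `branching` is at most `4 (L + 1)^2` and `L + 1` is below
-- `2 ^ (1 + lg L)`.
overhead : ℕ → ℕ
overhead k = blocks k * (2 + lg (blockLength k))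

lg-unbounded : ∀ e {k} → 2 ^ e ≤ k → e ≤ lg k
lg-unbounded e {k} 2^e≤k = ≮⇒≥ λ lg<e → <-irrefl refl (begin-strict
  suc k            <⟨ <2^1+lg k ⟩
  2 ^ suc (lg k)   ≤⟨ ^-monoʳ-≤ 2 lg<e ⟩
  2 ^ e            ≤⟨ 2^e≤k ⟩
  k                <⟨ n<1+n k ⟩
  suc k            ∎)
  where open ≤-Reasoning

^-distribʳ-* : ∀ n x y → (x * y) ^ n ≡ x ^ n * y ^ n
^-distribʳ-* zero    x y = refl
^-distribʳ-* (suc n) x y rewrite ^-distribʳ-* n x y = lemma x y (x ^ n) (y ^ n)
  where
  lemma : ∀ x y a b → x * y * (a * b) ≡ x * a * (y * b)
  lemma = solve-∀

-- With q = k / d, suc k ≤ d * suc q ≤ d * 2 ^ q.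
polynomial≤exponential : ∀ d .{{_ : NonZero d}} k → suc k ^ d ≤ d ^ d * 2 ^ k
polynomial≤exponential d k = begin
  suc k ^ d                    ≤⟨ ^-monoˡ-≤ d suck≤ ⟩
  (d * 2 ^ (k / d)) ^ d        ≡⟨ ^-distribʳ-* d d (2 ^ (k / d)) ⟩
  d ^ d * (2 ^ (k / d)) ^ d    ≡⟨ cong (d ^ d *_) (^-*-assoc 2 (k / d) d) ⟩
  d ^ d * 2 ^ (k / d * d)      ≤⟨ *-monoʳ-≤ (d ^ d) (^-monoʳ-≤ 2 (m/n*n≤m k d)) ⟩
  d ^ d * 2 ^ k                ∎
  where
  open ≤-Reasoning
  suck≤ : suc k ≤ d * 2 ^ (k / d)
  suck≤ = begin
    suc k                    ≡⟨ cong suc (m≡m%n+[m/n]*n k d) ⟩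
    suc (k % d) + k / d * d  ≤⟨ +-monoˡ-≤ (k / d * d) (m%n<n k d) ⟩
    suc (k / d) * d          ≡⟨ *-comm (suc (k / d)) d ⟩
    d * suc (k / d)          ≤⟨ *-monoʳ-≤ d (n<2^n (k / d)) ⟩
    d * 2 ^ (k / d)          ∎

-- This rests on `(e + 1)^2 ≤ 4 * 2 ^ e`. The threshold `8a + 4` is chosen such that the left side
-- and the slack add up to a multiple of `e + 1`.
linear≤exponential : ∀ a e → 8 * a + 4 ≤ e → a * (2 + e) < 2 ^ e
linear≤exponential a e a≤e = *-cancelˡ-< 4 _ _ (begin-strict
  4 * (a * (2 + e))                    <⟨ m<m+n (4 * (a * (2 + e))) (s≤s z≤n) ⟩
  4 * (a * (2 + e)) + 4 * suc e        ≤⟨ m≤m+n _ (4 * (a * e)) ⟩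
  4 * (a * (2 + e)) + 4 * suc e + 4 * (a * e)  ≡⟨ lemma a e ⟩
  (8 * a + 4) * suc e                  ≤⟨ *-monoˡ-≤ (suc e) (≤-trans a≤e (n≤1+n e)) ⟩
  suc e * suc e                        ≡⟨ cong (suc e *_) (*-identityʳ (suc e)) ⟨
  suc e ^ 2                            ≤⟨ polynomial≤exponential 2 e ⟩
  4 * 2 ^ e                            ∎)
  where
  open ≤-Reasoning
  lemma : ∀ a e → 4 * (a * (2 + e)) + 4 * suc e + 4 * (a * e) ≡ (8 * a + 4) * suc e
  lemma = solve-∀

-- `overhead k` is about `(3k / log k) * log log k`. With `q` the quotient of `3k` by `L`, twice
-- `m * overhead k` splits into a share of `q` blocks and a share of the one extra block, and each
-- share is at most `k`.
overhead-little-o : IsLittleO overhead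
overhead-little-o m = 2 ^ (2 ^ e₀) , small
  where
  -- In `6 * m` the 3 comes from the kernel size `3k` and the 2 from the splitting into two shares;
  -- the rest is the threshold of `linear≤exponential`. The double exponential forces `lg k` to be
  -- at least `2 ^ e₀`, and thereby `lg L` to be at least `e₀`.
  e₀ : ℕ
  e₀ = 8 * (6 * m) + 4
  small : ∀ k → 2 ^ (2 ^ e₀) ≤ k → m * overhead k ≤ k
  small k k₀≤k = *-cancelˡ-≤ 2 (begin
    2 * (m * (suc q * c))            ≡⟨ lemma₁ m q c ⟩
    2 * (m * c) * q + 2 * (m * c)    ≤⟨ +-mono-≤ (*-cancelˡ-≤ {2 * (m * c) * q} {k} 3 3≤) mc≤k ⟩
    k + k                            ≡⟨ cong (k +_) (+-identityʳ k) ⟨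
    2 * k                            ∎)
    where
    open ≤-Reasoning
    L q c : ℕ
    L = blockLength k
    q = (k + k + k) / L
    c = 2 + lg L
    6mc≤L : 6 * m * c ≤ L
    6mc≤L = s≤s⁻¹ (<-≤-trans (linear≤exponential (6 * m) (lg L)
      (lg-unbounded e₀ (≤-trans (lg-unbounded (2 ^ e₀) k₀≤k) (n≤1+n (lg k))))) (2^lg≤ L))
    3≤ : 3 * (2 * (m * c) * q) ≤ 3 * k
    3≤ = begin
      3 * (2 * (m * c) * q)  ≡⟨ lemma₂ m c q ⟩
      q * (6 * m * c)        ≤⟨ *-monoʳ-≤ q 6mc≤L ⟩
      q * L                  ≤⟨ m/n*n≤m (k + k + k) L ⟩
      k + k + k              ≡⟨ lemma₃ k ⟩
      3 * k                  ∎
      where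
      lemma₂ : ∀ m c q → 3 * (2 * (m * c) * q) ≡ q * (6 * m * c)
      lemma₂ = solve-∀
      lemma₃ : ∀ k → k + k + k ≡ 3 * k
      lemma₃ = solve-∀
    L≤ : L ≤ suc k
    L≤ = ≤-trans (n<2^n (lg k)) (2^lg≤ k)
    third : ∀ x {k} → 3 * x ≤ suc k → x ≤ k
    third zero    _  = z≤n
    third (suc x) le = s≤s⁻¹ (≤-trans (m≤n+m (2 + x) (suc (x + x))) (≤-trans (≤-reflexive (lemma₅ x)) le))
      where
      lemma₅ : ∀ x → suc (x + x) + (2 + x) ≡ 3 * suc x
      lemma₅ = solve-∀
    mc≤k : 2 * (m * c) ≤ k
    mc≤k = third (2 * (m * c)) (≤-trans (≤-reflexive (lemma₆ m c)) (≤-trans 6mc≤L L≤))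
      where
      lemma₆ : ∀ m c → 3 * (2 * (m * c)) ≡ 6 * m * c
      lemma₆ = solve-∀
    lemma₁ : ∀ m q c → 2 * (m * (suc q * c)) ≡ 2 * (m * c) * q + 2 * (m * c)
    lemma₁ = solve-∀

branching≤ : ∀ k → SearchTree.branching k ≤ 4 ^ (2 + lg (blockLength k))
branching≤ k = begin
  suc (suc L * suc (L + L))            ≤⟨ m≤m+n _ (2 + 5 * L + 2 * (L * L)) ⟩
  suc (suc L * suc (L + L)) + (2 + 5 * L + 2 * (L * L))  ≡⟨ lemma L ⟩
  4 * (suc L * suc L)                  ≤⟨ *-monoʳ-≤ 4 (*-mono-≤ (<⇒≤ (<2^1+lg L)) (<⇒≤ (<2^1+lg L))) ⟩
  4 * (2 ^ suc (lg L) * 2 ^ suc (lg L))  ≡⟨ cong (4 *_) (^-distribʳ-* (suc (lg L)) 2 2) ⟨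
  4 ^ (2 + lg L)                       ∎
  where
  open ≤-Reasoning
  L = blockLength k
  lemma : ∀ L → suc (suc L * suc (L + L)) + (2 + 5 * L + 2 * (L * L)) ≡ 4 * (suc L * suc L)
  lemma = solve-∀

kernel-blocks : ∀ k → k + k + k ≤ blocks k * blockLength k
kernel-blocks k = begin
  k + k + k                                  ≡⟨ m≡m%n+[m/n]*n (k + k + k) L ⟩
  (k + k + k) % L + (k + k + k) / L * L      ≤⟨ +-monoˡ-≤ _ (<⇒≤ (m%n<n (k + k + k) L)) ⟩
  blocks k * L                               ∎
  where
  open ≤-Reasoning
  L = blockLength k

branching^≤ : ∀ k → SearchTree.branching k ^ blocks k ≤ 4 ^ overhead k
branching^≤ k = begin
  SearchTree.branching k ^ blocks k           ≤⟨ ^-monoˡ-≤ (blocks k) (branching≤ k) ⟩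
  (4 ^ (2 + lg (blockLength k))) ^ blocks k   ≡⟨ ^-*-assoc 4 (2 + lg (blockLength k)) (blocks k) ⟩
  4 ^ ((2 + lg (blockLength k)) * blocks k)   ≡⟨ cong (4 ^_) (*-comm (2 + lg (blockLength k)) (blocks k)) ⟩
  4 ^ overhead k                              ∎
  where open ≤-Reasoning

-- The algorithm

InputTy : Ty
InputTy = MatrixTy ⊗ list bool

digits : ℕᵇ → List Bool
digits zero     = []
digits 2[1+ x ] = true ∷ digits x
digits 1+[2 x ] = false ∷ digits x

encode-digits : ∀ x → encode (list bool) (digits x) ≡ encodeBinary x
encode-digits zero     = refl
encode-digits 2[1+ x ] = cong (encodeBool true ∙_) (encode-digits x)
encode-digits 1+[2 x ] = cong (encodeBool false ∙_) (encode-digits x)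

length-digits : ∀ x → length (digits x) ≤ ⟦ x ⟧
length-digits zero     = z≤n
length-digits 2[1+ x ] = ≤-trans (s≤s (length-digits x)) (m≤m+n _ _)
length-digits 1+[2 x ] = s≤s (≤-trans (length-digits x) (m≤m+n _ _))

encode-tabulate : ∀ τ {n} (f : Fin n → El τ) →
                  encode (list τ) (tabulate f) ≡ encodeList (tabulate (encode τ ∘ f))
encode-tabulate τ {zero}  f = refl
encode-tabulate τ {suc n} f = cong (encode τ (f Fin.zero) ∙_) (encode-tabulate τ (f ∘ Fin.suc))

input : ∀ {n} → Graph n → ℕ → El InputTy
input G k = rows G , digits (fromℕ k)

encode-input : ∀ {n} (G : Graph n) k → encode InputTy (input G k) ≡ encodeInput G k
encode-input G k = cong₂ _∙_
  (trans (encode-tabulate (list bool) (λ u → tabulate (adj u)))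
         (cong encodeList (List.tabulate-cong λ u → encode-tabulate bool (adj u))))
  (encode-digits (fromℕ k))
  where open Graph G using (adj)

-- In unary, k may be too long to write down; but beyond n its value does not matter.
cutoff : ℕ → ℕ → ℕ
cutoff n m = if m ≤ᵇ suc n then m else suc n

readDigits : ℕ → List Bool → ℕ
readDigits n = foldr (λ d a → cutoff n (if d then suc (suc (a + a)) else suc (a + a))) 0

cutoff-≤ : ∀ n m → cutoff n m ≤ suc n
cutoff-≤ n m with m ≤ᵇ suc n in eq
... | true  = ≤ᵇ⇒≤ m (suc n) (subst T (sym eq) _)
... | false = ≤-refl

cutoff-⊓ : ∀ n m → cutoff n m ≡ m ⊓ suc n
cutoff-⊓ n m with m ≤ᵇ suc n in eq
... | true  = sym (m≤n⇒m⊓n≡m (≤ᵇ⇒≤ m (suc n) (subst T (sym eq) _)))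
... | false = sym (m≥n⇒m⊓n≡n (≰⇒≥ λ le → subst T eq (≤⇒≤ᵇ le)))

-- Once `t` reaches `m`, so do `f t` and `f m`, and both sides are `m`. Hence values may be cut off
-- after every digit instead of only at the end.
truncate : ∀ {f : ℕ → ℕ} → (∀ n → n ≤ f n) → ∀ t m → f (t ⊓ m) ⊓ m ≡ f t ⊓ m
truncate {f} n≤f t m with ≤-total t m
... | inj₁ t≤m = cong (λ a → f a ⊓ m) (m≤n⇒m⊓n≡m t≤m)
... | inj₂ m≤t rewrite m≥n⇒m⊓n≡n m≤t = trans (m≥n⇒m⊓n≡n (n≤f m)) (sym (m≥n⇒m⊓n≡n (≤-trans m≤t (n≤f t))))

readDigits-⊓ : ∀ n x → readDigits n (digits x) ≡ ⟦ x ⟧ ⊓ suc n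
readDigits-⊓ n zero     = refl
readDigits-⊓ n 2[1+ x ] rewrite readDigits-⊓ n x = trans (cutoff-⊓ n _)
  (trans (truncate {λ a → suc (suc (a + a))} (λ a → m≤n⇒m≤1+n (m≤n⇒m≤1+n (m≤m+n a a))) ⟦ x ⟧ (suc n))
         (cong (_⊓ suc n) (lemma ⟦ x ⟧)))
  where
  lemma : ∀ t → suc (suc (t + t)) ≡ 2 * suc t
  lemma = solve-∀
readDigits-⊓ n 1+[2 x ] rewrite readDigits-⊓ n x = trans (cutoff-⊓ n _)
  (trans (truncate {λ a → suc (a + a)} (λ a → m≤n⇒m≤1+n (m≤m+n a a)) ⟦ x ⟧ (suc n))
         (cong (λ m → suc (⟦ x ⟧ + m) ⊓ suc n) (sym (+-identityʳ ⟦ x ⟧))))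

readDigitsC : ∀ {Γ n ds} → Comp Γ nat n → Comp Γ (list bool) ds → Comp Γ nat (λ ρ → readDigits (n ρ) (ds ρ))
readDigitsC {Γ} {n} nC dsC = foldr⁺C {g = λ (d , a , ρ) → cutoff (n ρ) (if d then suc (suc (a + a)) else suc (a + a))}
  dsC 0C (cutoffC (↑ ↑ nC) (ifC v0 (sucC (sucC (v1 +C v1))) (sucC (v1 +C v1))))
  (suc≼ (size-small (↑ nC))) λ d a ρ → ≤-trans (small (n ρ) (if d then suc (suc (a + a)) else suc (a + a))) (m≤n+m _ (size nat a))
  where
  cutoffC : ∀ {Γ n m} → Comp Γ nat n → Comp Γ nat m → Comp Γ nat (λ ρ → cutoff (n ρ) (m ρ))
  cutoffC nC mC = ifC (mC ≤ᵇC sucC nC) mC (sucC nC)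
  small : ∀ n m → size nat (cutoff n m) ≤ suc (size nat n)
  small n m rewrite size-nat (cutoff n m) | size-nat n = cutoff-≤ n m

Γ₀ : Ctx
Γ₀ = InputTy ∷ []

budget : El InputTy → ℕ
budget (M , ds) = readDigits (length M) ds

rootNode : Matrix → ℕ → Node
rootNode M k = Greedy.kernel (sameDistance M) (vertexList M) k , k + k , []

-- A `k` larger than `n` has been cut off to `n + 1`. Then there is no node to explore, and the
-- answer is `false`.
initialNodes : Matrix → ℕ → List Node
initialNodes M k = if k ≤ᵇ length M then rootNode M k ∷ [] else []

acceptsNode : Matrix → ℕ → Node → Bool
acceptsNode M k (_ , _ , B) = Greedy.accepts (sameDistance M) (vertexList M) k B

module _ {Γ : Ctx} {inp : Env Γ → El InputTy} (inpC : Comp Γ InputTy inp) where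

  budgetC : Comp Γ nat (budget ∘ inp)
  budgetC = readDigitsC (lengthC (fstC inpC)) (sndC inpC)

  initialC : Comp Γ (list NodeTy) (λ ρ → initialNodes (proj₁ (inp ρ)) (budget (inp ρ)))
  initialC = ifC (budgetC ≤ᵇC lengthC (fstC inpC))
    ((kernelC (fstC inpC) budgetC ,C ((budgetC +C budgetC) ,C []C)) ∷C []C) []C

  acceptsNodeC : ∀ {x} → Comp Γ NodeTy x → Comp Γ bool (λ ρ → acceptsNode (proj₁ (inp ρ)) (budget (inp ρ)) (x ρ))
  acceptsNodeC xC = acceptsC (fstC inpC) budgetC (sndC (sndC xC))

opaque
  startC : Comp Γ₀ (list NodeTy) (λ (inp , _) → initialNodes (proj₁ inp) (budget inp))
  startC = initialC v0

  expandC : Comp (NodeTy ∷ Γ₀) (list NodeTy) (λ (x , inp , _) → SearchTree.children (budget inp) x)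
  expandC = childrenC (budgetC v1) v0

  testC : Comp (NodeTy ∷ Γ₀) bool (λ (x , inp , _) → acceptsNode (proj₁ inp) (budget inp) x)
  testC = acceptsNodeC v1 v0

algorithm : Program 1
algorithm = searchProgram startC expandC testC

start : El InputTy → List Node
start inp = initialNodes (proj₁ inp) (budget inp)

expand : El InputTy → Node → List Node
expand inp = SearchTree.children (budget inp)

test : El InputTy → Node → Bool
test inp = acceptsNode (proj₁ inp) (budget inp)

Light : El InputTy → Node → Set
Light inp x = size NodeTy x ≤ size (list NodeTy) (start inp)

opaque
  algorithm-runs : ∃[ d ] (∀ ρ {b t} → let inp = proj₁ ρ in Explores (expand inp) (test inp) (Light inp) (start inp) b t →
                   ∃[ r ] (encodeEnv Γ₀ ρ ⊢ algorithm ⇓ encodeBool b after r) × r ≤ t * width Γ₀ ρ ^ d)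
  algorithm-runs = search-polynomial startC expandC testC

-- Savable sets and resolving sets

module _ {n : ℕ} (G : Graph n) where

  private
    M : Matrix
    M = rows G

    symmetric : ∀ {x y} → x ∈ vertexList M → y ∈ vertexList M → distance M x y ≡ distance M y x
    symmetric x∈ y∈ with u , refl ← ∈⇒toℕ G x∈ | v , refl ← ∈⇒toℕ G y∈ = distance-sym G u v

  open Correctness (distance M) (sameDistance M) (vertexList M)
    (sameDistance-sound M) (sameDistance-complete M) symmetric (Unique.downFrom⁺ (length M)) public
  open Greedy (sameDistance M) (vertexList M) public

  count-tabulate : ∀ {A : Set} {m} (p : A → Bool) (g : Fin m → A) →
                   count p (tabulate g) ≡ ∣ Vec.tabulate (p ∘ g) ∣
  count-tabulate {m = zero}  p g = refl
  count-tabulate {m = suc m} p g with p (g Fin.zero)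
  ... | true  = cong suc (count-tabulate p (g ∘ Fin.suc))
  ... | false = count-tabulate p (g ∘ Fin.suc)

  ∣∣-count : (W : Subset n) → count (not ∘ lookup W) (allFin n) + ∣ W ∣ ≡ n
  ∣∣-count W = begin
    count (not ∘ lookup W) (allFin n) + ∣ W ∣
      ≡⟨ cong (λ V → count (not ∘ lookup W) (allFin n) + ∣ V ∣) (Vec.tabulate∘lookup W) ⟨
    count (not ∘ lookup W) (allFin n) + ∣ Vec.tabulate (lookup W) ∣
      ≡⟨ cong (count (not ∘ lookup W) (allFin n) +_) (count-tabulate (lookup W) id) ⟨
    count (not ∘ lookup W) (allFin n) + count (lookup W) (allFin n)
      ≡⟨ count-not (lookup W) (allFin n) ⟩
    length (allFin n)
      ≡⟨ List.length-tabulate id ⟩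
    n ∎
    where open ≡-Reasoning

  savable⇒saving : ∀ {S k} → Savable S → k ≤ length S → SavingLandmarks G k
  savable⇒saving {S} {k} (S⊆vs , u , sep) k≤S = W , resolving , (begin
    ∣ W ∣ + k                          ≤⟨ +-monoʳ-≤ ∣ W ∣ (≤-trans k≤S S≤) ⟩
    ∣ W ∣ + count (not ∘ lookup W) (allFin n)  ≡⟨ +-comm ∣ W ∣ _ ⟩
    count (not ∘ lookup W) (allFin n) + ∣ W ∣  ≡⟨ ∣∣-count W ⟩
    n                                  ∎)
    where
    open ≤-Reasoning
    W : Subset n
    W = Vec.tabulate λ i → not (member (toℕ i) S)
    ∈W : ∀ {v} → toℕ v ∉ S → v ∈ˢ W
    ∈W {v} v∉S = Vec.lookup⇒[]= v W (trans (Vec.lookup∘tabulate (λ i → not (member (toℕ i) S)) v)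
                                            (cong not (∉⇒¬member v∉S)))
    S≤ : length S ≤ count (not ∘ lookup W) (allFin n)
    S≤ = subst (length S ≤_) (List.length-map toℕ (filterᵇ (not ∘ lookup W) (allFin n)))
           (unique-length (map toℕ (filterᵇ (not ∘ lookup W) (allFin n))) u λ x∈S → listed x∈S (∈⇒toℕ G (S⊆vs x∈S)))
      where
      listed : ∀ {x} → x ∈ S → (∃[ v ] toℕ v ≡ x) → x ∈ map toℕ (filterᵇ (not ∘ lookup W) (allFin n))
      listed x∈S (v , refl) = ∈-map⁺ toℕ (∈-filterᵇ⁺ (∈-allFin v) (subst (T ∘ not)
        (sym (trans (Vec.lookup∘tabulate (λ i → not (member (toℕ i) S)) v)
                    (cong not (Equivalence.to T-≡ (member-complete x∈S))))) _))
    resolving : Resolving G W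
    resolving x y x≢y with ∈-dec (toℕ x) S | ∈-dec (toℕ y) S
    ... | no x∉S  | _       = x , ∈W x∉S , ≢⇒resolves G (self-distance G x y x≢y)
    ... | yes _   | no y∉S  = y , ∈W y∉S , ≢⇒resolves G (self-distance G y x (x≢y ∘ sym) ∘ sym)
    ... | yes x∈S | yes y∈S with z , z∈ , z∉S , d ← sep x∈S y∈S (x≢y ∘ Fin.toℕ-injective)
                            with v , refl ← ∈⇒toℕ G z∈ = v , ∈W z∉S , ≢⇒resolves G d

  saving⇒savable : ∀ {k} → SavingLandmarks G k → ∃[ S ] Savable S × k ≤ length S
  saving⇒savable {k} (W , resolving , W+k≤n) = S , (S⊆vs , unique , sep) , k≤S
    where
    outside : List (Fin n)
    outside = filterᵇ (not ∘ lookup W) (allFin n)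
    S : List ℕ
    S = map toℕ outside
    S⊆vs : ∀ {x} → x ∈ S → x ∈ vertexList M
    S⊆vs x∈ with v , _ , refl ← ∈-map⁻ toℕ x∈ = toℕ∈ G v
    unique : Unique S
    unique = Unique.map⁺ Fin.toℕ-injective (Unique.filter⁺ (T? ∘ not ∘ lookup W) (Unique.allFin⁺ n))
    ∉S : ∀ {v} → v ∈ˢ W → toℕ v ∉ S
    ∉S {v} v∈W v∈S with w , w∈ , eq ← ∈-map⁻ toℕ v∈S with refl ← Fin.toℕ-injective {i = v} {w} eq =
      T-not⁻ (proj₂ (∈-filterᵇ⁻ (not ∘ lookup W) (allFin n) w∈)) (Equivalence.from T-≡ (Vec.[]=⇒lookup v∈W))
    sep : ∀ {x y} → x ∈ S → y ∈ S → x ≢ y →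
          ∃[ z ] z ∈ vertexList M × z ∉ S × distance M z x ≢ distance M z y
    sep x∈ y∈ x≢y with a , _ , refl ← ∈-map⁻ toℕ x∈ | b , _ , refl ← ∈-map⁻ toℕ y∈
                  with v , v∈W , r ← resolving a b (x≢y ∘ cong toℕ) = toℕ v , toℕ∈ G v , ∉S v∈W , resolves⇒≢ G r
    k≤S : k ≤ length S
    k≤S = +-cancelˡ-≤ ∣ W ∣ k (length S) (≤-trans W+k≤n (≤-reflexive (begin
      n                                     ≡⟨ ∣∣-count W ⟨
      count (not ∘ lookup W) (allFin n) + ∣ W ∣  ≡⟨ +-comm _ ∣ W ∣ ⟩
      ∣ W ∣ + length outside                ≡⟨ cong (∣ W ∣ +_) (List.length-map toℕ outside) ⟨
      ∣ W ∣ + length S                      ∎)))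
      where open ≡-Reasoning

  module _ (k : ℕ) where

    open SearchTree k

    goodNode : Node → Bool
    goodNode (_ , _ , B) = accepts k B

    root : Node
    root = kernel k , k + k , []

    saving⇒found : SavingLandmarks G k → Found children goodNode (root ∷ [])
    saving⇒found sl =
      let S , sv , k≤S = saving⇒savable sl
          c , few , meets = accepts-complete k S sv k≤S
      in found c goodNode (λ B → T (accepts k B)) (λ a → a) (length (kernel k)) ≤-refl (kernel-unique k) (λ _ ()) few
           λ B _ → meets B

    good⇒saving : ∀ x → T (goodNode x) → SavingLandmarks G k
    good⇒saving (_ , _ , B) g = let S , sv , k≤S = accepts-sound k B g in savable⇒saving sv k≤S

-- The running time

size-tabulate : ∀ τ m {n} (f : Fin n → El τ) → (∀ i → size τ (f i) ≤ m) → size (list τ) (tabulate f) ≤ n * suc m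
size-tabulate τ m {zero}  f f≤ = z≤n
size-tabulate τ m {suc n} f f≤ = s≤s (+-mono-≤ (f≤ Fin.zero) (size-tabulate τ m (f ∘ Fin.suc) (f≤ ∘ Fin.suc)))

size-bits : ∀ bs → size (list bool) bs ≤ 2 * length bs
size-bits []          = z≤n
size-bits (true ∷ bs) = ≤-trans (s≤s (s≤s (size-bits bs))) (≤-reflexive (sym (*-suc 2 (length bs))))
size-bits (false ∷ bs) = ≤-trans (s≤s (m≤n⇒m≤1+n (size-bits bs))) (≤-reflexive (sym (*-suc 2 (length bs))))

module _ {n : ℕ} (G : Graph n) (k : ℕ) where

  open Graph G using (adj)

  private
    inp : El InputTy
    inp = input G k
    K : ℕ
    K = budget inp

  -- `k` is a crude bound for the number of its digits. It suffices because powers of `k + 1` are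
  -- polynomial in `n` for `k ≤ n` and are absorbed by `4 ^ k` for larger `k`.
  input-width : width Γ₀ (inp , tt) ≤ 8 * (suc n * suc n) * suc k
  input-width = begin
    suc (size MatrixTy (rows G) + size (list bool) (digits (fromℕ k))) + 2
      ≤⟨ +-monoˡ-≤ 2 (s≤s (+-mono-≤ rows≤ digits≤)) ⟩
    suc (n * suc (n * 2) + 2 * k) + 2
      ≤⟨ m≤m+n _ (5 + 15 * n + 6 * (n * n) + 6 * k + 8 * (n * n) * k + 16 * n * k) ⟩
    suc (n * suc (n * 2) + 2 * k) + 2 + (5 + 15 * n + 6 * (n * n) + 6 * k + 8 * (n * n) * k + 16 * n * k)
      ≡⟨ lemma n k ⟩
    8 * (suc n * suc n) * suc k ∎
    where
    open ≤-Reasoning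
    lemma : ∀ n k → suc (n * suc (n * 2) + 2 * k) + 2 + (5 + 15 * n + 6 * (n * n) + 6 * k + 8 * (n * n) * k + 16 * n * k) ≡
                    8 * (suc n * suc n) * suc k
    lemma = solve-∀
    rows≤ : size MatrixTy (rows G) ≤ n * suc (n * 2)
    rows≤ = size-tabulate (list bool) (n * 2) _ λ u → size-tabulate bool 1 (adj u) λ v → size-bit (adj u v)
    digits≤ : size (list bool) (digits (fromℕ k)) ≤ 2 * k
    digits≤ = ≤-trans (size-bits (digits (fromℕ k)))
      (*-monoʳ-≤ 2 (≤-trans (length-digits (fromℕ k)) (≤-reflexive (toℕ-fromℕ k))))

  budget-⊓ : K ≡ k ⊓ suc n
  budget-⊓ = trans (readDigits-⊓ (length (rows G)) (fromℕ k))
    (cong₂ (λ a b → a ⊓ suc b) (toℕ-fromℕ k) (length-rows G))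

  Decides : Bool → ℕ → Set
  Decides b t = Explores (expand inp) (test inp) (Light inp) (start inp) b t × (b ≡ true ⇔ SavingLandmarks G k)

  start-≤ : k ≤ n → start inp ≡ rootNode (rows G) K ∷ []
  start-≤ k≤n = cong (λ b → if b then rootNode (rows G) K ∷ [] else []) (Equivalence.to T-≡ (≤⇒≤ᵇ K≤))
    where
    K≤ : K ≤ length (rows G)
    K≤ = subst₂ _≤_ (sym (trans budget-⊓ (m≤n⇒m⊓n≡m (m≤n⇒m≤1+n k≤n)))) (sym (length-rows G)) k≤n

  start-> : n < k → start inp ≡ []
  start-> n<k = cong (λ b → if b then rootNode (rows G) K ∷ [] else []) (K≰ _ refl)
    where
    K≰ : ∀ b → (K ≤ᵇ length (rows G)) ≡ b → (K ≤ᵇ length (rows G)) ≡ false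
    K≰ false eq = eq
    K≰ true  eq = contradiction (≤ᵇ⇒≤ K (length (rows G)) (Equivalence.from T-≡ eq)) (<⇒≱ (subst₂ _<_ (sym (length-rows G))
      (sym (trans budget-⊓ (m≥n⇒m⊓n≡n n<k))) (n<1+n n)))

  decides-≤ : k ≤ n → ∃[ b ] ∃[ t ] Decides b t × t ≤ 3 * 4 ^ (k + overhead k)
  decides-≤ k≤n = b , t , (subst (λ xs → Explores (expand inp) (test inp) (Light inp) xs b t) (sym (start-≤ k≤n)) e , mk⇔ to from) , t≤
    where
    K≡k : K ≡ k
    K≡k = trans budget-⊓ (m≤n⇒m⊓n≡m (m≤n⇒m≤1+n k≤n))
    root≤ : size NodeTy (root G K) ≤ size (list NodeTy) (start inp)
    root≤ = subst (λ xs → size NodeTy (root G K) ≤ size (list NodeTy) xs) (sym (start-≤ k≤n))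
              (m≤n⇒m≤1+n (m≤m+n _ 0))
    kernel≤ : length (kernel G K) ≤ blocks K * blockLength K
    kernel≤ = ≤-trans (≤-reflexive (List.length-take (K + K + K) _)) (≤-trans (m⊓n≤m (K + K + K) _) (kernel-blocks K))
    outcome = SearchTree.explored K (test inp) (Light inp) (size (list NodeTy) (start inp)) (λ _ x≤ → x≤) (blocks K)
      (root G K ∷ []) λ { (here refl) → kernel-unique G K , kernel≤ , root≤ }
    b = proj₁ outcome
    t = proj₁ (proj₂ outcome)
    e = proj₁ (proj₂ (proj₂ outcome))
    to : b ≡ true → SavingLandmarks G k
    to b≡true = let x , g = explores-sound (expand inp) (test inp) (Light inp) e (Equivalence.from T-≡ b≡true)
                in subst (SavingLandmarks G) K≡k (good⇒saving G K x g)
    from : SavingLandmarks G k → b ≡ true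
    from sl = Equivalence.to T-≡ (explores-complete (expand inp) (test inp) (Light inp) e
                (saving⇒found G K (subst (SavingLandmarks G) (sym K≡k) sl)))
    t≤ : t ≤ 3 * 4 ^ (k + overhead k)
    t≤ = begin
      t
        ≤⟨ proj₂ (proj₂ (proj₂ outcome)) ⟩
      1 + (2 * 2 ^ (K + K) * SearchTree.branching K ^ blocks K + 0)
        ≡⟨ cong (λ K → 1 + (2 * 2 ^ (K + K) * SearchTree.branching K ^ blocks K + 0)) K≡k ⟩
      1 + (2 * 2 ^ (k + k) * SearchTree.branching k ^ blocks k + 0)
        ≤⟨ s≤s (+-monoˡ-≤ 0 (*-monoʳ-≤ (2 * 2 ^ (k + k)) (branching^≤ k))) ⟩
      1 + (2 * 2 ^ (k + k) * 4 ^ overhead k + 0)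
        -- The base 4 appears here: the root starts with a budget of `k + k` demands, each worth a
        -- factor of 2.
        ≡⟨ cong suc (trans (+-identityʳ _) (trans (*-assoc 2 (2 ^ (k + k)) _) (cong (2 *_)
             (trans (cong (_* 4 ^ overhead k) 4^k) (sym (^-distribˡ-+-* 4 k (overhead k))))))) ⟩
      1 + 2 * 4 ^ (k + overhead k)
        ≤⟨ +-monoˡ-≤ _ (m^n>0 4 (k + overhead k)) ⟩
      3 * 4 ^ (k + overhead k) ∎
      where
      open ≤-Reasoning
      4^k : 2 ^ (k + k) ≡ 4 ^ k
      4^k = trans (^-distribˡ-+-* 2 k k) (sym (^-distribʳ-* k 2 2))

  decides-> : n < k → Decides false 1
  decides-> n<k = subst (λ xs → Explores (expand inp) (test inp) (Light inp) xs false 1) (sym (start-> n<k)) [] ,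
    mk⇔ (λ ()) λ (W , _ , W+k≤n) → contradiction (≤-trans (m≤n+m k ∣ W ∣) W+k≤n) (<⇒≱ n<k)

exponent : ℕ
exponent = proj₁ algorithm-runs

-- A single number serves both as leading factor and as exponent of `n + 1`, hence the sum: the
-- first summand covers the factors that arise in `time-≤` and `time->`, the second the power
-- `3 * exponent`.
constant : ℕ
constant = 3 * (8 ^ exponent * suc exponent ^ suc exponent) + 3 * exponent

module _ (n k : ℕ) where

  private
    d = exponent
    A = 8 ^ d
    S = suc d ^ suc d
    N = suc n
    E = 4 ^ (k + overhead k)

    1≤S : 1 ≤ S
    1≤S = m^n>0 (suc d) (suc d)

    ^-3 : ∀ x → (8 * (x * x) * x) ^ d ≡ A * x ^ (3 * d)
    ^-3 x = begin
      (8 * (x * x) * x) ^ d  ≡⟨ cong (_^ d) (lemma x) ⟩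
      (8 * x ^ 3) ^ d        ≡⟨ ^-distribʳ-* d 8 (x ^ 3) ⟩
      A * (x ^ 3) ^ d        ≡⟨ cong (A *_) (^-*-assoc x 3 d) ⟩
      A * x ^ (3 * d)        ∎
      where
      open ≡-Reasoning
      lemma : ∀ x → 8 * (x * x) * x ≡ 8 * (x * (x * (x * 1)))
      lemma = solve-∀

    weaken : ∀ {e} → e ≤ 3 * (A * S) → e * E * N ^ (3 * d) ≤ constant * E * N ^ constant
    weaken e≤ = *-mono-≤ (*-monoˡ-≤ E (≤-trans e≤ (m≤m+n _ (3 * d)))) (^-monoʳ-≤ N (m≤n+m (3 * d) (3 * (A * S))))

  time-≤ : ∀ {w t} → k ≤ n → w ≤ 8 * (N * N) * suc k → t ≤ 3 * E → t * w ^ d ≤ constant * E * N ^ constant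
  time-≤ {w} {t} k≤n w≤ t≤ = begin
    t * w ^ d                      ≤⟨ *-mono-≤ t≤ (^-monoˡ-≤ d (≤-trans w≤ (*-monoʳ-≤ (8 * (N * N)) (s≤s k≤n)))) ⟩
    3 * E * (8 * (N * N) * N) ^ d  ≡⟨ cong (3 * E *_) (^-3 N) ⟩
    3 * E * (A * N ^ (3 * d))      ≡⟨ lemma E A (N ^ (3 * d)) ⟩
    3 * A * E * N ^ (3 * d)        ≤⟨ weaken (*-monoʳ-≤ 3 (≤-trans (≤-reflexive (sym (*-identityʳ A))) (*-monoʳ-≤ A 1≤S))) ⟩
    constant * E * N ^ constant    ∎
    where
    open ≤-Reasoning
    lemma : ∀ E A x → 3 * E * (A * x) ≡ 3 * A * E * x
    lemma = solve-∀

  -- For k > n only the size of the binary representation of k matters.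
  time-> : ∀ {w} → w ≤ 8 * (N * N) * suc k → 1 * w ^ d ≤ constant * E * N ^ constant
  time-> {w} w≤ = begin
    1 * w ^ d                           ≡⟨ +-identityʳ (w ^ d) ⟩
    w ^ d                               ≤⟨ ^-monoˡ-≤ d w≤ ⟩
    (8 * (N * N) * suc k) ^ d           ≤⟨ ^-monoˡ-≤ d (*-monoˡ-≤ (suc k) (m≤m*n (8 * (N * N)) N)) ⟩
    (8 * (N * N) * N * suc k) ^ d       ≡⟨ ^-distribʳ-* d (8 * (N * N) * N) (suc k) ⟩
    (8 * (N * N) * N) ^ d * suc k ^ d   ≤⟨ *-mono-≤ (≤-reflexive (^-3 N)) suck^d≤ ⟩
    A * N ^ (3 * d) * (S * E)           ≡⟨ lemma A (N ^ (3 * d)) S E ⟩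
    A * S * E * N ^ (3 * d)             ≤⟨ weaken (m≤n*m (A * S) 3) ⟩
    constant * E * N ^ constant         ∎
    where
    open ≤-Reasoning
    lemma : ∀ A x S E → A * x * (S * E) ≡ A * S * E * x
    lemma = solve-∀
    suck^d≤ : suc k ^ d ≤ S * E
    suck^d≤ = begin
      suc k ^ d            ≤⟨ ^-monoʳ-≤ (suc k) (n≤1+n d) ⟩
      suc k ^ suc d        ≤⟨ polynomial≤exponential (suc d) k ⟩
      S * 2 ^ k            ≤⟨ *-monoʳ-≤ S (≤-trans (^-monoˡ-≤ k (s≤s (s≤s z≤n))) (^-monoʳ-≤ 4 (m≤m+n k (overhead k)))) ⟩
      S * E                ∎

theorem2 : Σ[ algorithm ∈ Program 1 ] Σ[ f ∈ (ℕ → ℕ) ] Σ[ c ∈ ℕ ]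
    IsLittleO f ×
    (∀ (n : ℕ) (G : Graph n) (k : ℕ) →
    Σ[ answer ∈ Bool ] Σ[ t ∈ ℕ ]
    (encodeInput G k ∷ [] ⊢ algorithm ⇓ encodeBool answer after t) ×
    (answer ≡ true ⇔ SavingLandmarks G k) ×
    t ≤ c * 4 ^ (k + f k) * suc n ^ c)
theorem2 = algorithm , overhead , constant , overhead-little-o , λ n G k → solve G k (≤-<-connex k n)
  where
  run : ∀ {n} (G : Graph n) k {b t} → Decides G k b t →
        ∃[ r ] (encodeInput G k ∷ [] ⊢ algorithm ⇓ encodeBool b after r) × r ≤ t * width Γ₀ (input G k , tt) ^ exponent
  run G k {b} (e , _) = let r , d , r≤ = proj₂ algorithm-runs (input G k , tt) e in
    r , subst (λ v → v ∷ [] ⊢ algorithm ⇓ encodeBool b after r) (encode-input G k) d , r≤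
  solve : ∀ {n} (G : Graph n) k → k ≤ n ⊎ n < k →
          Σ[ answer ∈ Bool ] Σ[ t ∈ ℕ ] (encodeInput G k ∷ [] ⊢ algorithm ⇓ encodeBool answer after t) ×
          (answer ≡ true ⇔ SavingLandmarks G k) × t ≤ constant * 4 ^ (k + overhead k) * suc n ^ constant
  solve {n} G k (inj₁ k≤n) =
    let b , t , D , t≤ = decides-≤ G k k≤n
        r , d , r≤ = run G k D
    in b , r , d , proj₂ D , ≤-trans r≤ (time-≤ n k k≤n (input-width G k) t≤)
  solve {n} G k (inj₂ n<k) =
    let r , d , r≤ = run G k (decides-> G k n<k)
    in false , r , d , proj₂ (decides-> G k n<k) , ≤-trans r≤ (time-> n k (input-width G k))
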